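{- Let $\mathcal{G}$ and $\mathcal{G}'$ be locally definable groups, let $U$ be a definably connected definable neighborhood of the identity $e$ of $\mathcal{G}$, and let $f:U\subseteq\mathcal{G}\to\mathcal{G}'$ be a definable local homomorphism. Assume that there is a definable neighborhood $V$ of $e$ which is generic in $\mathcal{G}$ and satisfies $V^{ -1}V\subseteq U$. If $\mathcal{G}$ is simply connected, then $f$ extends uniquely to a locally definable group homomorphism $\overline{f}:\mathcal{G}\to\mathcal{G}'$.
   Context: Work in a sufficiently $\kappa$-saturated o-minimal structure $\mathcal{M}$; "definable" means definable in $\mathcal{M}$ with parameters. A group is locally definable if its domain and the graph of its group operation are countable unions of definable sets; a map between locally definable sets is locally definable if its restriction to each definable subset is definable. Every $n$-dimensional locally definable group carries a unique group topology (the $\tau$-topology) in which every point has a definable neighborhood definably homeomorphic to $M^n$; all topological notions refer to it. Path connectedness, homotopy and simple connectedness are defined as in algebraic topology, but using locally definable paths and homotopies (so $\mathcal{G}$ simply connected means it is path connected in this sense and every locally definable loop is locally definably null-homotopic). A local homomorphism $f:U\to\mathcal{G}'$ is a map with $f(hh')=f(h)f(h')$ whenever $h,h',hh'\in U$. A subset $X\subseteq\mathcal{G}$ is left (right) generic if $\mathcal{G}=AX$ ($\mathcal{G}=XA$) for some $A\subseteq\mathcal{G}$ with $|A|<\kappa$, and generic if it is both left and right generic. -}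

module Defs where

open import Level using (0ℓ)
open import Algebra.Bundles.Raw using (RawGroup)
open import Algebra.Structures using (IsGroup)
open import Data.Fin.Base using (Fin; zero)
open import Data.List.Base using (List)
open import Data.List.Relation.Unary.All using (All)
open import Data.List.Relation.Unary.Any using (Any)
open import Data.Nat.Base using (ℕ; suc; _+_)
open import Data.Product.Base using (Σ-syntax; ∃-syntax; _×_; _,_)
open import Data.Sum.Base using (_⊎_)
open import Data.Vec.Base using (Vec; []; _∷_; _++_; lookup; map)
open import Function.Base using (id)
open import Function.Bundles using (_↣_)
open import Function.Definitions using (Injective)
open import Relation.Binary.PropositionalEquality using (_≡_)
open import Relation.Binary.Structures using (IsDenseLinearOrder)
import Relation.Binary.Construct.Add.Extrema.Strict as AddExtrema
import Relation.Binary.Construct.StrictToNonStrict as StrictToNonStrict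
open import Relation.Nullary using (¬_)
open import Relation.Nullary.Construct.Add.Extrema using (_±; [_])
open import Relation.Unary using (Pred; U; Empty; _∈_; _⊆_; _∩_; _≐_; ⋃)

------------------------------------------------------------------------
-- Cardinalities and images

-- Comparison of cardinals, |I| < |K|, in the form that is equivalent to the
-- usual one in classical mathematics.
_≺_ : Set → Set → Set
I ≺ K = ¬ (K ↣ I)

Image : {A B : Set} → (A → B) → Pred A 0ℓ → Pred B 0ℓ
Image f X y = ∃[ x ] x ∈ X × f x ≡ y

------------------------------------------------------------------------
-- First-order logic with equality and a distinguished order symbol

record Signature : Set₁ where
  field
    Fun : ℕ → Set
    Rel : ℕ → Set

module _ (L : Signature) where
  open Signature L

  data Term (n : ℕ) : Set where
    var : Fin n → Term n
    fun : ∀ {m} → Fun m → Vec (Term n) m → Term n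

  -- Formulas with free variables in Fin n; a quantifier binds variable zero.
  data Formula (n : ℕ) : Set where
    _≈ᶠ_ _<ᶠ_       : Term n → Term n → Formula n
    rel             : ∀ {m} → Rel m → Vec (Term n) m → Formula n
    ¬ᶠ_             : Formula n → Formula n
    _∧ᶠ_ _∨ᶠ_ _⇒ᶠ_  : Formula n → Formula n → Formula n
    ∀ᶠ_ ∃ᶠ_         : Formula (suc n) → Formula n

  -- Formulas in n free variables with finitely many parameters named by
  -- elements of P.
  FormulaOver : Set → ℕ → Set
  FormulaOver P n = Σ[ m ∈ ℕ ] Formula (n + m) × Vec P m

record Structure (L : Signature) : Set₁ where
  open Signature L
  infix 4 _<_
  field
    Carrier : Set
    point   : Carrier  -- structures are nonempty
    _<_     : Carrier → Carrier → Set
    fun⟦_⟧  : ∀ {n} → Fun n → Vec Carrier n → Carrier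
    rel⟦_⟧  : ∀ {n} → Rel n → Vec Carrier n → Set

module _ {L : Signature} (𝓜 : Structure L) where
  open Structure 𝓜 renaming (Carrier to M)
  open AddExtrema _<_ using (_<±_)
  open StrictToNonStrict _≡_ _<_ using (_≤_)

  mutual
    evalTerm : ∀ {n} → Term L n → Vec M n → M
    evalTerm (var i)    ρ = lookup ρ i
    evalTerm (fun F ts) ρ = fun⟦ F ⟧ (evalTerms ts ρ)

    evalTerms : ∀ {n m} → Vec (Term L n) m → Vec M n → Vec M m
    evalTerms []       ρ = []
    evalTerms (t ∷ ts) ρ = evalTerm t ρ ∷ evalTerms ts ρ

  Sat : ∀ {n} → Formula L n → Vec M n → Set
  Sat (s ≈ᶠ t)   ρ = evalTerm s ρ ≡ evalTerm t ρ
  Sat (s <ᶠ t)   ρ = evalTerm s ρ < evalTerm t ρ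
  Sat (rel R ts) ρ = rel⟦ R ⟧ (evalTerms ts ρ)
  Sat (¬ᶠ φ)     ρ = ¬ Sat φ ρ
  Sat (φ ∧ᶠ ψ)   ρ = Sat φ ρ × Sat ψ ρ
  Sat (φ ∨ᶠ ψ)   ρ = Sat φ ρ ⊎ Sat ψ ρ
  Sat (φ ⇒ᶠ ψ)   ρ = Sat φ ρ → Sat ψ ρ
  Sat (∀ᶠ φ)     ρ = ∀ x → Sat φ (x ∷ ρ)
  Sat (∃ᶠ φ)     ρ = ∃[ x ] Sat φ (x ∷ ρ)

  SatOver : ∀ {P n} → (P → M) → FormulaOver L P n → Pred (Vec M n) 0ℓ
  SatOver val (_ , φ , ps) x = Sat φ (x ++ map val ps)

  Definable : ∀ {k} → Pred (Vec M k) 0ℓ → Set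
  Definable X = ∃[ φ ] X ≐ SatOver id φ

  CountableUnionOfDefinables : ∀ {k} → Pred (Vec M k) 0ℓ → Set₁
  CountableUnionOfDefinables {k} X =
    Σ[ Y ∈ (ℕ → Pred (Vec M k) 0ℓ) ] (∀ i → Definable (Y i)) × X ≐ ⋃ ℕ Y

  -- Every set of formulas in n variables, over fewer than κ parameters
  -- (the elements a i), that is finitely satisfiable in 𝓜 is realized in 𝓜.
  Saturated : Set → Set₁
  Saturated κ =
    ∀ {I : Set} → I ≺ κ → (a : I → M) →
    ∀ {n} (p : Pred (FormulaOver L I n) 0ℓ) →
    (∀ Γ → All p Γ → ∃[ x ] All (λ φ → SatOver a φ x) Γ) →
    ∃[ x ] (∀ φ → p φ → SatOver a φ x)

  data Piece : Set where
    singleton : M → Piece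
    interval  : M ± → M ± → Piece

  ⟦_⟧ₚ : Piece → Pred M 0ℓ
  ⟦ singleton a ⟧ₚ  x = x ≡ a
  ⟦ interval l u ⟧ₚ x = l <± [ x ] × [ x ] <± u

  record IsOMinimal : Set₁ where
    field
      isDenseLinearOrder : IsDenseLinearOrder _≡_ _<_
      noMinimum          : ∀ x → ∃[ y ] y < x
      noMaximum          : ∀ x → ∃[ y ] x < y
      finiteUnion        : ∀ (X : Pred (Vec M 1) 0ℓ) → Definable X →
                           Σ[ ps ∈ List Piece ]
                             ((λ x → (x ∷ []) ∈ X) ≐
                              (λ x → Any (λ p → x ∈ ⟦ p ⟧ₚ) ps))

  OpenBox ClosedBox : ∀ {n} → Vec M n → Vec M n → Pred (Vec M n) 0ℓ
  OpenBox   a b x = ∀ i → lookup a i < lookup x i × lookup x i < lookup b i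
  ClosedBox a b x = ∀ i → lookup a i ≤ lookup x i × lookup x i ≤ lookup b i

------------------------------------------------------------------------
-- Topologies

record Topology (A : Set) : Set₂ where
  field
    Open    : Pred A 0ℓ → Set₁
    resp-≐  : ∀ {X Y} → X ≐ Y → Open X → Open Y
    whole   : Open U
    meet    : ∀ {X Y} → Open X → Open Y → Open (X ∩ Y)
    union   : ∀ {I : Set} (X : I → Pred A 0ℓ) → (∀ i → Open (X i)) →
              Open (⋃ I X)

  Neighbourhood : A → Pred A 0ℓ → Set₁
  Neighbourhood x N = Σ[ O ∈ Pred A 0ℓ ] Open O × x ∈ O × O ⊆ N

  RelativelyOpen : Pred A 0ℓ → Pred A 0ℓ → Set₁
  RelativelyOpen X Y = Σ[ O ∈ Pred A 0ℓ ] Open O × Y ≐ X ∩ O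

-- Continuity of the restriction of f to X, for openness predicates on the
-- two sides.
ContinuousOn : ∀ {a b} {A B : Set} →
               (Pred A 0ℓ → Set a) → (Pred B 0ℓ → Set b) →
               Pred A 0ℓ → (A → B) → Set _
ContinuousOn {A = A} {B} OpenA OpenB X f =
  ∀ x → x ∈ X → (O : Pred B 0ℓ) → OpenB O → f x ∈ O →
  Σ[ W ∈ Pred A 0ℓ ] OpenA W × x ∈ W × (∀ y → y ∈ X → y ∈ W → f y ∈ O)

module _ {L : Signature} (𝓜 : Structure L) where
  open Structure 𝓜 renaming (Carrier to M)
  open StrictToNonStrict _≡_ _<_ using (_≤_)

  -- The product topology on Mⁿ of the order topology on M (which has no
  -- endpoints, so that bounded boxes form a basis).
  OpenInMⁿ : ∀ {n} → Pred (Vec M n) 0ℓ → Set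
  OpenInMⁿ X =
    ∀ x → x ∈ X → ∃[ a ] ∃[ b ] x ∈ OpenBox 𝓜 a b × OpenBox 𝓜 a b ⊆ X

------------------------------------------------------------------------
-- Locally definable groups

  -- The domain, a subset of M^k, is presented as the image of an injection.
  -- Subsets of the group are predicates on Carrier; they are called definable
  -- when their images in M^k are.
  record LocallyDefinableGroup : Set₁ where
    infixl 7 _∙_
    infix  8 _⁻¹
    field
      Carrier         : Set
      _∙_             : Carrier → Carrier → Carrier
      ε               : Carrier
      _⁻¹             : Carrier → Carrier
      isGroup         : IsGroup _≡_ _∙_ ε _⁻¹
      k               : ℕ
      embed           : Carrier → Vec M k
      embed-injective : Injective _≡_ _≡_ embed
      domain          : CountableUnionOfDefinables 𝓜 (Image embed U)
      graph           : CountableUnionOfDefinables 𝓜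
                          (Image (λ ((x , y) : Carrier × Carrier) →
                                    embed x ++ embed y ++ embed (x ∙ y)) U)

    rawGroup : RawGroup 0ℓ 0ℓ
    rawGroup = record
      { Carrier = Carrier ; _≈_ = _≡_ ; _∙_ = _∙_ ; ε = ε ; _⁻¹ = _⁻¹ }

    DefinableSubset : Pred Carrier 0ℓ → Set
    DefinableSubset X = Definable 𝓜 (Image embed X)

  -- A partial map with domain X is a total function of which only the values
  -- on X are used; it is definable when the graph of its restriction to X is.
  DefinableOn : ∀ {A B : Set} {m n} → (A → Vec M m) → (B → Vec M n) →
                Pred A 0ℓ → (A → B) → Set
  DefinableOn e e′ X f = Definable 𝓜 (Image (λ x → e x ++ e′ (f x)) X)

  module _ (𝓖 𝓖′ : LocallyDefinableGroup) where
    private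
      module G  = LocallyDefinableGroup 𝓖
      module G′ = LocallyDefinableGroup 𝓖′

    IsDefinableMapOn : Pred G.Carrier 0ℓ → (G.Carrier → G′.Carrier) → Set
    IsDefinableMapOn = DefinableOn G.embed G′.embed

    IsLocallyDefinableMap : (G.Carrier → G′.Carrier) → Set₁
    IsLocallyDefinableMap f =
      ∀ X → G.DefinableSubset X → IsDefinableMapOn X f

    IsLocalHomomorphismOn : Pred G.Carrier 0ℓ → (G.Carrier → G′.Carrier) → Set
    IsLocalHomomorphismOn X f =
      ∀ x y → x ∈ X → y ∈ X → (x G.∙ y) ∈ X → f (x G.∙ y) ≡ f x G′.∙ f y

  module _ (𝓖 : LocallyDefinableGroup) where
    open LocallyDefinableGroup 𝓖

    -- Some projection of X onto d of the k coordinates has nonempty interior.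
    DimensionAtLeast : ℕ → Pred Carrier 0ℓ → Set
    DimensionAtLeast d X =
      Σ[ π ∈ (Fin d → Fin k) ] Injective _≡_ _≡_ π ×
      (∃[ a ] ∃[ b ] (∀ i → lookup a i < lookup b i) ×
        (∀ y → y ∈ OpenBox 𝓜 a b →
         ∃[ x ] x ∈ X × (∀ i → lookup y i ≡ lookup (embed x) (π i))))

    -- The maximum of the dimensions of the definable subsets is n.
    HasDimension : ℕ → Set₁
    HasDimension n =
      (Σ[ X ∈ Pred Carrier 0ℓ ] DefinableSubset X × DimensionAtLeast n X) ×
      (∀ X → DefinableSubset X → ¬ DimensionAtLeast (suc n) X)

    LeftGeneric RightGeneric Generic : Set → Pred Carrier 0ℓ → Set₁
    LeftGeneric κ X =
      Σ[ I ∈ Set ] I ≺ κ × (Σ[ a ∈ (I → Carrier) ]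
        (∀ g → ∃[ i ] ∃[ x ] x ∈ X × g ≡ a i ∙ x))
    RightGeneric κ X =
      Σ[ I ∈ Set ] I ≺ κ × (Σ[ a ∈ (I → Carrier) ]
        (∀ g → ∃[ i ] ∃[ x ] x ∈ X × g ≡ x ∙ a i))
    Generic κ X = LeftGeneric κ X × RightGeneric κ X

    -- The properties that characterize the τ-topology.  Without the condition
    -- on n, a discrete topology would also qualify (with n = 0).
    record TauTopology : Set₂ where
      field
        topology : Topology Carrier
      open Topology topology public
      field
        ∙-continuous  : ∀ x y O → Open O → (x ∙ y) ∈ O →
                        Σ[ V ∈ Pred Carrier 0ℓ ] Σ[ W ∈ Pred Carrier 0ℓ ]
                          Open V × Open W × x ∈ V × y ∈ W ×
                          (∀ v w → v ∈ V → w ∈ W → (v ∙ w) ∈ O)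
        ⁻¹-continuous : ContinuousOn Open Open U _⁻¹
        n             : ℕ
        dimension     : HasDimension n
        -- A definable homeomorphism φ, with inverse ψ, from a definable
        -- neighbourhood N of x onto Mⁿ.
        chart         : ∀ x →
                        Σ[ N ∈ Pred Carrier 0ℓ ]
                        DefinableSubset N × Neighbourhood x N ×
                        (Σ[ φ ∈ (Carrier → Vec M n) ]
                         Σ[ ψ ∈ (Vec M n → Carrier) ]
                          DefinableOn embed id N φ ×
                          (∀ v → ψ v ∈ N) ×
                          (∀ v → φ (ψ v) ≡ v) ×
                          (∀ y → y ∈ N → ψ (φ y) ≡ y) ×
                          ContinuousOn Open OpenInMⁿ N φ ×
                          ContinuousOn OpenInMⁿ Open U ψ)

    module _ (τ : TauTopology) where
      open TauTopology τ

      DefinablyConnected : Pred Carrier 0ℓ → Set₁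
      DefinablyConnected X =
        ∀ Y Z → DefinableSubset Y → DefinableSubset Z →
        RelativelyOpen X Y → RelativelyOpen X Z →
        (∀ x → x ∈ X → x ∈ Y ⊎ x ∈ Z) → Empty (Y ∩ Z) →
        Empty Y ⊎ Empty Z

      -- A locally definable map on a closed box is definable, as the box is.
      record IsDefinableContinuousOnBox {m} (a b : Vec M m)
               (f : Vec M m → Carrier) : Set₁ where
        field
          definable  : DefinableOn id embed (ClosedBox 𝓜 a b) f
          continuous : ContinuousOn OpenInMⁿ Open (ClosedBox 𝓜 a b) f

      -- Since M is not assumed to have a canonical interval [0,1], paths are
      -- parametrized by arbitrary closed bounded intervals [a,b] of M.
      record IsPath (a b : M) (γ : M → Carrier) : Set₁ where
        field
          a<b     : a < b
          regular : IsDefinableContinuousOnBox (a ∷ []) (b ∷ [])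
                      (λ v → γ (lookup v zero))

      PathConnected : Set₁
      PathConnected =
        ∀ x y → ∃[ a ] ∃[ b ] ∃[ γ ] IsPath a b γ × γ a ≡ x × γ b ≡ y

      record NullHomotopy (a b : M) (γ : M → Carrier) : Set₁ where
        field
          c d     : M
          c<d     : c < d
          H       : Vec M 2 → Carrier
          regular : IsDefinableContinuousOnBox (a ∷ c ∷ []) (b ∷ d ∷ []) H
          start   : ∀ s → a ≤ s → s ≤ b → H (s ∷ c ∷ []) ≡ γ s
          end     : ∀ s → a ≤ s → s ≤ b → H (s ∷ d ∷ []) ≡ γ a
          left    : ∀ t → c ≤ t → t ≤ d → H (a ∷ t ∷ []) ≡ γ a
          right   : ∀ t → c ≤ t → t ≤ d → H (b ∷ t ∷ []) ≡ γ a

      SimplyConnected : Set₁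
      SimplyConnected =
        PathConnected ×
        (∀ a b γ → IsPath a b γ → γ a ≡ γ b → NullHomotopy a b γ)

-- Lift paths of 𝓖 to 𝓖′ by means of f: a lift h of γ satisfies
-- h(y) = h(x) f(γ(x)⁻¹ γ(y)) for y near x.  A path is a finite chain of pieces
-- along which all quotients γ(x)⁻¹ γ(y) are in U.  Indeed, it is covered by fewer
-- than κ translates of V, each of which contains finitely many intervals of it, so
-- that otherwise there would be points of the path, unreachable from each other
-- by finite chains, and by saturation a point between them that no translate
-- contains.  Hence paths lift, uniquely and definably; rectangles lift row by
-- row; and the lift of a loop at ε is a loop, by its null-homotopy.  The end of
-- the lift of a path from ε to g is therefore a function f̄(g), and lifting
-- (s , t) ↦ γ(s) γ₁(t) shows that f̄ is a homomorphism.
--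
-- 𝓖 is generated by the ends of paths in U that start at ε and all of whose
-- quotients are in U, where f̄ = f.  Those that are defined by a given formula
-- form a definable set over fixed parameters, so by compactness finitely many
-- formulas suffice on each definable set, and f̄ is locally definable.  It agrees
-- with f near ε, by moving along the coordinates of a chart, and then on all of U
-- because U is definably connected.

module Submission where

open import Level using (0ℓ)
open import Algebra.Bundles using (Group)
open import Algebra.Morphism.Structures using (module GroupMorphisms)
import Algebra.Properties.Group as GroupProperties
open import Axiom.ExcludedMiddle using (ExcludedMiddle)
open import Data.Empty using (⊥-elim)
open import Data.Fin.Base using (Fin; zero; suc; toℕ; _↑ˡ_; _↑ʳ_; splitAt)
open import Data.Fin.Properties using (splitAt-↑ˡ; splitAt-↑ʳ; toℕ-injective)
open import Data.List.Base as List using (List; []; _∷_; length)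
open import Data.List.Membership.Propositional using () renaming (_∈_ to _∈ˡ_)
open import Data.List.Relation.Unary.All as All using (All; []; _∷_)
open import Data.List.Relation.Unary.Any as Any using (Any; here; there)
open import Data.List.Relation.Unary.Any.Properties using (lookup-index)
open import Data.Nat.Base as ℕ using (ℕ; zero; suc; _+_)
import Data.Nat.Properties as ℕ
open import Data.Product using (∃!)
open import Data.Product.Base using (Σ; Σ-syntax; ∃-syntax; _×_; _,_; proj₁; proj₂)
open import Data.Sum.Base as Sum using (_⊎_; inj₁; inj₂; [_,_]′)
open import Data.Sum.Properties using (inj₁-injective; inj₂-injective)
open import Data.Unit.Base using (⊤; tt)
open import Data.Vec.Base using (Vec; []; _∷_; _++_; lookup; map; tabulate; take; drop; head; tail)
open import Data.Vec.Properties using (lookup∘tabulate; tabulate∘lookup; tabulate-cong; lookup-splitAt; lookup-++ˡ; lookup-++ʳ;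
  lookup-map; map-id; take++drop≡id; ++-injective; ++-injectiveˡ; ++-injectiveʳ)
open import Function.Base using (id; _∘_)
open import Function.Bundles using (_↣_; mk↣; module Injection)
open import Function.Construct.Composition using (_↣-∘_)
open import Function.Definitions using (Injective)
import Relation.Binary.Construct.Add.Extrema.Strict as AddExtrema
import Relation.Binary.Construct.StrictToNonStrict as StrictToNonStrict
open import Relation.Binary.Definitions using (tri<; tri≈; tri>)
open import Relation.Binary.PropositionalEquality using (_≡_; _≗_; refl; sym; trans; cong; cong₂; subst; module ≡-Reasoning)
open import Relation.Binary.Structures using (IsDenseLinearOrder)
open import Relation.Nullary using (¬_; Dec; yes; no; contradiction)
open import Relation.Nullary.Construct.Add.Extrema using ([_]; ⊥±; ⊤±)
open import Relation.Nullary.Decidable using (decidable-stable; toSum)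
open import Relation.Unary using (Pred; _∈_; _⊆_; _≐_; Empty)
open import Defs

-- The obstacle throughout is definability. Lifts are built from arbitrary choices, of a chain for
-- each path and each row, so a lift comes without a formula for its graph. But its value at the end
-- of a piece is determined by that at the beginning; once the number of pieces is bounded, this
-- describes the graph. Saturation supplies such bounds, uniformly in the rows of a rectangle, since
-- the points reached by n pieces form an increasing sequence of definable sets.
--
-- The extension is defined by an arbitrary path to each point, and first-order logic cannot
-- quantify over definable paths. It can quantify over the parameters of one formula at a time,
-- provided that describing a path is itself first-order; the definable boxes of a chart at ε
-- express its continuity. The language may have many formulas, but the parameters left over are
-- those of countably many fixed sets, which is what compactness asks for.
--
-- Two paths with the same ends are compared inside 𝓖: their pointwise quotient is a loop at ε.

vec-ext : ∀ {A : Set} {n} {xs ys : Vec A n} → (∀ i → lookup xs i ≡ lookup ys i) → xs ≡ ys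
vec-ext {xs = xs} {ys} eq =
  trans (sym (tabulate∘lookup xs)) (trans (tabulate-cong eq) (tabulate∘lookup ys))

take-++ : ∀ {A : Set} {m n} (xs : Vec A m) (ys : Vec A n) → take m (xs ++ ys) ≡ xs
take-++ {m = m} xs ys = ++-injectiveˡ (take m (xs ++ ys)) xs (take++drop≡id m (xs ++ ys))

drop-++ : ∀ {A : Set} {m n} (xs : Vec A m) (ys : Vec A n) → drop m (xs ++ ys) ≡ ys
drop-++ {m = m} xs ys = ++-injectiveʳ (take m (xs ++ ys)) xs (take++drop≡id m (xs ++ ys))

transport : {A B : Set} → A ≡ B → (A → B) × (B → A)
transport refl = id , id

-- Formulas and closure properties of definable sets

module Renaming (L : Signature) where

  mutual
    renameTerm : ∀ {m n} → (Fin m → Fin n) → Term L m → Term L n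
    renameTerm r (var i)    = var (r i)
    renameTerm r (fun F ts) = fun F (renameTerms r ts)

    renameTerms : ∀ {m n k} → (Fin m → Fin n) → Vec (Term L m) k → Vec (Term L n) k
    renameTerms r []       = []
    renameTerms r (t ∷ ts) = renameTerm r t ∷ renameTerms r ts

  lift : ∀ {m n} → (Fin m → Fin n) → Fin (suc m) → Fin (suc n)
  lift r zero    = zero
  lift r (suc i) = suc (r i)

  rename : ∀ {m n} → (Fin m → Fin n) → Formula L m → Formula L n
  rename r (s ≈ᶠ t)   = renameTerm r s ≈ᶠ renameTerm r t
  rename r (s <ᶠ t)   = renameTerm r s <ᶠ renameTerm r t
  rename r (rel R ts) = rel R (renameTerms r ts)
  rename r (¬ᶠ φ)     = ¬ᶠ rename r φ
  rename r (φ ∧ᶠ ψ)   = rename r φ ∧ᶠ rename r ψ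
  rename r (φ ∨ᶠ ψ)   = rename r φ ∨ᶠ rename r ψ
  rename r (φ ⇒ᶠ ψ)   = rename r φ ⇒ᶠ rename r ψ
  rename r (∀ᶠ φ)     = ∀ᶠ rename (lift r) φ
  rename r (∃ᶠ φ)     = ∃ᶠ rename (lift r) φ

module Definability {L : Signature} (𝓜 : Structure L) where
  open Structure 𝓜 renaming (Carrier to M)
  open StrictToNonStrict _≡_ _<_ using (_≤_)
  open Renaming L public

  Subset : ℕ → Set₁
  Subset n = Pred (Vec M n) 0ℓ

  mutual
    eval-renameTerm : ∀ {m n} {r : Fin m → Fin n} {ρ : Vec M n} {ρ₀ : Vec M m} →
      (∀ i → lookup ρ (r i) ≡ lookup ρ₀ i) →
      ∀ t → evalTerm 𝓜 (renameTerm r t) ρ ≡ evalTerm 𝓜 t ρ₀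
    eval-renameTerm eq (var i)    = eq i
    eval-renameTerm eq (fun F ts) = cong fun⟦ F ⟧ (eval-renameTerms eq ts)

    eval-renameTerms : ∀ {m n k} {r : Fin m → Fin n} {ρ : Vec M n} {ρ₀ : Vec M m} →
      (∀ i → lookup ρ (r i) ≡ lookup ρ₀ i) →
      (ts : Vec (Term L m) k) → evalTerms 𝓜 (renameTerms r ts) ρ ≡ evalTerms 𝓜 ts ρ₀
    eval-renameTerms eq []       = refl
    eval-renameTerms eq (t ∷ ts) = cong₂ _∷_ (eval-renameTerm eq t) (eval-renameTerms eq ts)

  Sat-rename : ∀ {m n} {r : Fin m → Fin n} (φ : Formula L m) {ρ : Vec M n} {ρ₀ : Vec M m} →
    (∀ i → lookup ρ (r i) ≡ lookup ρ₀ i) →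
    (Sat 𝓜 (rename r φ) ρ → Sat 𝓜 φ ρ₀) × (Sat 𝓜 φ ρ₀ → Sat 𝓜 (rename r φ) ρ)
  Sat-rename (s ≈ᶠ t) eq = transport (cong₂ _≡_ (eval-renameTerm eq s) (eval-renameTerm eq t))
  Sat-rename (s <ᶠ t) eq = transport (cong₂ _<_ (eval-renameTerm eq s) (eval-renameTerm eq t))
  Sat-rename (rel R ts) eq = transport (cong rel⟦ R ⟧ (eval-renameTerms eq ts))
  Sat-rename (¬ᶠ φ) eq with f , g ← Sat-rename φ eq = _∘ g , _∘ f
  Sat-rename (φ ∧ᶠ ψ) eq with f , g ← Sat-rename φ eq | f′ , g′ ← Sat-rename ψ eq =
    (λ (x , y) → f x , f′ y) , (λ (x , y) → g x , g′ y)
  Sat-rename (φ ∨ᶠ ψ) eq with f , g ← Sat-rename φ eq | f′ , g′ ← Sat-rename ψ eq =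
    Sum.map f f′ , Sum.map g g′
  Sat-rename (φ ⇒ᶠ ψ) eq with f , g ← Sat-rename φ eq | f′ , g′ ← Sat-rename ψ eq =
    (λ h → f′ ∘ h ∘ g) , (λ h → g′ ∘ h ∘ f)
  Sat-rename (∀ᶠ φ) eq =
    (λ h x → proj₁ (Sat-rename φ λ { zero → refl ; (suc i) → eq i }) (h x)) ,
    (λ h x → proj₂ (Sat-rename φ λ { zero → refl ; (suc i) → eq i }) (h x))
  Sat-rename (∃ᶠ φ) eq =
    (λ (x , h) → x , proj₁ (Sat-rename φ λ { zero → refl ; (suc i) → eq i }) h) ,
    (λ (x , h) → x , proj₂ (Sat-rename φ λ { zero → refl ; (suc i) → eq i }) h)

  -- Parameters are named by a map `val` from an arbitrary set. With `val = id` this is `Definable`;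
  -- with a small `P` it is the form to which saturation applies. One family of closure lemmas
  -- serves both.
  DefinableOver : {P : Set} → (P → M) → ∀ {n} → Subset n → Set
  DefinableOver val X = ∃[ φ ] X ≐ SatOver 𝓜 val φ

  mapParameters : ∀ {P Q : Set} {val : P → M} {val′ : Q → M} (h : P → Q) → val′ ∘ h ≗ val →
    ∀ {n} {X : Subset n} → DefinableOver val X → DefinableOver val′ X
  mapParameters {val = val} {val′} h eq ((l , φ , ps) , to , from) =
    (l , φ , map h ps) ,
    (λ {x} → subst (Sat 𝓜 φ) (cong (x ++_) (sym (same ps))) ∘ to) ,
    (λ {x} → from ∘ subst (Sat 𝓜 φ) (cong (x ++_) (same ps)))
    where
    same : ∀ {l} (qs : Vec _ l) → map val′ (map h qs) ≡ map val qs
    same []       = refl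
    same (q ∷ qs) = cong₂ _∷_ (eq q) (same qs)

  module Over {P : Set} (val : P → M) where

    Def : ∀ {n} → Subset n → Set
    Def = DefinableOver val

    def-resp : ∀ {n} {X Y : Subset n} → (∀ v → X v → Y v) → (∀ v → Y v → X v) → Def X → Def Y
    def-resp f g (φ , to , from) = φ , (λ {v} → to ∘ g v) , (λ {v} → f v ∘ from)

    -- Definable sets are pulled back only along maps whose coordinates are input coordinates or
    -- parameters. Such maps act on formulas by renaming variables, so terms never have to be
    -- substituted.
    Sel₁ : ∀ {m} → (Vec M m → M) → Set
    Sel₁ {m} s = Σ[ c ∈ Fin m ⊎ P ] (∀ v → s v ≡ [ lookup v , val ]′ c)

    record Sel {m n} (τ : Vec M m → Vec M n) : Set where
      constructor coordinates
      field
        coordinate : ∀ i → Sel₁ (λ v → lookup (τ v) i)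

    open Sel public

    assignment : ∀ {m N} → (Fin N → Fin m ⊎ P) → Vec M m → Vec M N
    assignment s v = tabulate (λ i → [ lookup v , val ]′ (s i))

    private
      -- Brings an assignment into the shape of `FormulaOver`, where the parameters come after the
      -- free variables. Every variable sent to a parameter contributes its own entry to `qs`,
      -- repetitions included, and a new entry in front shifts the earlier ones.
      gather : ∀ {m} N (s : Fin N → Fin m ⊎ P) →
        Σ[ k ∈ ℕ ] Σ[ qs ∈ Vec P k ] Σ[ r ∈ (Fin N → Fin (m + k)) ]
          (∀ v i → lookup (v ++ map val qs) (r i) ≡ [ lookup v , val ]′ (s i))
      gather {m} zero s = 0 , [] , (λ ()) , λ _ ()
      gather {m} (suc N) s with gather N (s ∘ suc) | s zero in e
      ... | k , qs , r , eq | inj₁ j =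
        k , qs , (λ { zero → j ↑ˡ k ; (suc i) → r i }) ,
        λ { v zero → trans (lookup-++ˡ v _ j) (cong [ lookup v , val ]′ (sym e)) ; v (suc i) → eq v i }
      ... | k , qs , r , eq | inj₂ p =
        suc k , p ∷ qs , (λ { zero → m ↑ʳ zero ; (suc i) → shift (splitAt m (r i)) }) ,
        λ { v zero → trans (lookup-++ʳ v _ zero) (cong [ lookup v , val ]′ (sym e)) ; v (suc i) →
            trans (lookup-shift v (r i)) (eq v i) }
        where
        shift : Fin m ⊎ Fin k → Fin (m + suc k)
        shift = [ _↑ˡ suc k , (λ j → m ↑ʳ suc j) ]′

        lookup-shift : ∀ v i →
          lookup (v ++ val p ∷ map val qs) (shift (splitAt m i)) ≡ lookup (v ++ map val qs) i
        lookup-shift v i with splitAt m i | lookup-splitAt m v (map val qs) i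
        ... | inj₁ j | e = trans (lookup-++ˡ v _ j) (sym e)
        ... | inj₂ j | e = trans (lookup-++ʳ v (val p ∷ map val qs) (suc j)) (sym e)

    reify : ∀ {m N} (φ : Formula L N) (s : Fin N → Fin m ⊎ P) → Def (λ v → Sat 𝓜 φ (assignment s v))
    reify {m} {N} φ s with k , qs , r , eq ← gather N s =
      (k , rename r φ , qs) ,
      (λ {v} → proj₂ (Sat-rename φ (λ i → trans (eq v i) (sym (lookup∘tabulate _ i))))) ,
      (λ {v} → proj₁ (Sat-rename φ (λ i → trans (eq v i) (sym (lookup∘tabulate _ i)))))

    private
      source : ∀ {m l} → Vec P l → Fin (m + l) → Fin m ⊎ P
      source {m} ps i = Sum.map id (lookup ps) (splitAt m i)

      assignment-source : ∀ {m l} (ps : Vec P l) (v : Vec M m) →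
        v ++ map val ps ≡ assignment (source ps) v
      assignment-source {m} ps v = vec-ext λ i → trans (go i) (sym (lookup∘tabulate _ i))
        where
        go : ∀ i → lookup (v ++ map val ps) i ≡ [ lookup v , val ]′ (source ps i)
        go i with splitAt m i | lookup-splitAt m v (map val ps) i
        ... | inj₁ j | e = e
        ... | inj₂ j | e = trans e (lookup-map j val ps)

    -- A normal form that separates a formula from the sources of its variables. Substitution then
    -- changes the sources only, and `reify` collects the parameters again.
    reflect : ∀ {m} {X : Subset m} → Def X →
      Σ[ N ∈ ℕ ] Σ[ φ ∈ Formula L N ] Σ[ s ∈ (Fin N → Fin m ⊎ P) ]
        X ≐ (λ v → Sat 𝓜 φ (assignment s v))
    reflect {m} ((l , φ , ps) , to , from) =
      m + l , φ , source ps ,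
      (λ {v} → subst (Sat 𝓜 φ) (assignment-source ps v) ∘ to) ,
      (λ {v} → from ∘ subst (Sat 𝓜 φ) (sym (assignment-source ps v)))

    def-sub : ∀ {m n} {X : Subset n} {τ : Vec M m → Vec M n} →
      Sel τ → Def X → Def (λ v → X (τ v))
    def-sub {m} {n} {X} {τ} sel X-def with N , φ , s , to , from ← reflect X-def =
      def-resp
        (λ v → from ∘ subst (Sat 𝓜 φ) (vec-ext (λ i → trans (lookup∘tabulate _ i)
           (trans (lookup-s v (s i)) (sym (lookup∘tabulate _ i))))))
        (λ v → subst (Sat 𝓜 φ) (sym (vec-ext (λ i → trans (lookup∘tabulate _ i)
           (trans (lookup-s v (s i)) (sym (lookup∘tabulate _ i)))))) ∘ to)
        (reify φ (target ∘ s))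
      where
      target : Fin n ⊎ P → Fin m ⊎ P
      target = [ (λ i → proj₁ (coordinate sel i)) , inj₂ ]′

      lookup-s : ∀ v c → [ lookup v , val ]′ (target c) ≡ [ lookup (τ v) , val ]′ c
      lookup-s v (inj₁ i) = sym (proj₂ (coordinate sel i) v)
      lookup-s v (inj₂ p) = refl

    def-¬ : ∀ {n} {X : Subset n} → Def X → Def (λ v → ¬ X v)
    def-¬ ((l , φ , ps) , to , from) = (l , ¬ᶠ φ , ps) , (λ h → h ∘ from) , (λ h → h ∘ to)

    private
      -- The two formulas are placed on disjoint blocks of variables, so that their parameter tuples
      -- may differ; the assignment identifies the common coordinates. `mono` takes maps in both
      -- directions because implication is contravariant on the left.
      module Binary (_•_ : ∀ {n} → Formula L n → Formula L n → Formula L n) (_⊛_ : Set → Set → Set)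
        (sat : ∀ {n} {φ ψ : Formula L n} {v} → Sat 𝓜 (φ • ψ) v ≡ (Sat 𝓜 φ v ⊛ Sat 𝓜 ψ v))
        (mono : ∀ {A B A′ B′ : Set} → (A → A′) → (A′ → A) → (B → B′) → (B′ → B) → A ⊛ B → A′ ⊛ B′)
        where

        def : ∀ {n} {X Y : Subset n} → Def X → Def Y → Def (λ v → X v ⊛ Y v)
        def {X = X} {Y} X-def Y-def
          with N , φ , s , to , from ← reflect X-def | N′ , ψ , s′ , to′ , from′ ← reflect Y-def =
          def-resp
            (λ v h → mono (from ∘ proj₁ (left v)) (proj₂ (left v) ∘ to)
                          (from′ ∘ proj₁ (right v)) (proj₂ (right v) ∘ to′) (subst id sat h))
            (λ v h → subst id (sym sat) (mono (proj₂ (left v) ∘ to) (from ∘ proj₁ (left v))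
                          (proj₂ (right v) ∘ to′) (from′ ∘ proj₁ (right v)) h))
            (reify (rename (_↑ˡ N′) φ • rename (N ↑ʳ_) ψ) both)
          where
          both : Fin (N + N′) → _
          both i = [ s , s′ ]′ (splitAt N i)
          left : ∀ v → _
          left v = Sat-rename φ {ρ = assignment both v} {ρ₀ = assignment s v} λ i →
            trans (lookup∘tabulate _ (i ↑ˡ N′)) (trans
              (cong (λ c → [ lookup v , val ]′ ([ s , s′ ]′ c)) (splitAt-↑ˡ N i N′))
              (sym (lookup∘tabulate _ i)))
          right : ∀ v → _
          right v = Sat-rename ψ {ρ = assignment both v} {ρ₀ = assignment s′ v} λ i →
            trans (lookup∘tabulate _ (N ↑ʳ i)) (trans
              (cong (λ c → [ lookup v , val ]′ ([ s , s′ ]′ c)) (splitAt-↑ʳ N N′ i))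
              (sym (lookup∘tabulate _ i)))

    def-formula : ∀ {n} (φ : Formula L n) → Def (Sat 𝓜 φ)
    def-formula φ = def-resp (λ v → subst (Sat 𝓜 φ) (tabulate∘lookup v)) (λ v → subst (Sat 𝓜 φ) (sym (tabulate∘lookup v)))
      (reify φ inj₁)

    opaque
      def-∧ : ∀ {n} {X Y : Subset n} → Def X → Def Y → Def (λ v → X v × Y v)
      def-∧ = Binary.def _∧ᶠ_ _×_ refl (λ f _ g _ (x , y) → f x , g y)

      def-∨ : ∀ {n} {X Y : Subset n} → Def X → Def Y → Def (λ v → X v ⊎ Y v)
      def-∨ = Binary.def _∨ᶠ_ _⊎_ refl (λ f _ g _ → Sum.map f g)

      def-⇒ : ∀ {n} {X Y : Subset n} → Def X → Def Y → Def (λ v → X v → Y v)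
      def-⇒ = Binary.def _⇒ᶠ_ (λ A B → A → B) refl (λ _ f g _ h → g ∘ h ∘ f)

      def-∃₁ : ∀ {m} {Q : Vec M m → M → Set} → Def (λ v → Q (tail v) (head v)) → Def (λ v → ∃[ x ] Q v x)
      def-∃₁ ((l , φ , ps) , to , from) =
        (l , ∃ᶠ φ , ps) , (λ (x , h) → x , to h) , (λ (x , h) → x , from h)

      def-∀₁ : ∀ {m} {Q : Vec M m → M → Set} → Def (λ v → Q (tail v) (head v)) → Def (λ v → ∀ x → Q v x)
      def-∀₁ ((l , φ , ps) , to , from) =
        (l , ∀ᶠ φ , ps) , (λ h x → to (h x)) , (λ h x → from (h x))

      private
        def-∃-++ : ∀ k {m} {X : Subset (k + m)} → Def X → Def {m} (λ v → Σ[ u ∈ Vec M k ] X (u ++ v))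
        def-∃-++ zero    d = def-resp (λ v h → [] , h) (λ { v ([] , h) → h }) d
        def-∃-++ (suc k) {X = X} d =
          def-resp (λ { v (u , x , h) → x ∷ u , h }) (λ { v (x ∷ u , h) → u , x , h })
            (def-∃-++ k (def-∃₁ {Q = λ w x → X (x ∷ w)} (def-resp (λ { (x ∷ v) h → h }) (λ { (x ∷ v) h → h }) d)))

        def-∀-++ : ∀ k {m} {X : Subset (k + m)} → Def X → Def {m} (λ v → (u : Vec M k) → X (u ++ v))
        def-∀-++ zero    d = def-resp (λ { v h [] → h }) (λ v h → h []) d
        def-∀-++ (suc k) {X = X} d =
          def-resp (λ { v h (x ∷ u) → h u x }) (λ { v h u x → h (x ∷ u) })
            (def-∀-++ k (def-∀₁ {Q = λ w x → X (x ∷ w)} (def-resp (λ { (x ∷ v) h → h }) (λ { (x ∷ v) h → h }) d)))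

      def-∃ : ∀ k {m} {Q : Vec M m → Vec M k → Set} →
        Def (λ v → Q (drop k v) (take k v)) → Def (λ v → ∃[ u ] Q v u)
      def-∃ k {Q = Q} d = def-resp
        (λ v (u , h) → u , subst (λ (x , y) → Q x y) (cong₂ _,_ (drop-++ u v) (take-++ u v)) h)
        (λ v (u , h) → u , subst (λ (x , y) → Q x y) (sym (cong₂ _,_ (drop-++ u v) (take-++ u v))) h)
        (def-∃-++ k {X = λ w → Q (drop k w) (take k w)} d)

      def-∀ : ∀ k {m} {Q : Vec M m → Vec M k → Set} →
        Def (λ v → Q (drop k v) (take k v)) → Def (λ v → ∀ u → Q v u)
      def-∀ k {Q = Q} d = def-resp
        (λ v h u → subst (λ (x , y) → Q x y) (cong₂ _,_ (drop-++ u v) (take-++ u v)) (h u))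
        (λ v h u → subst (λ (x , y) → Q x y) (sym (cong₂ _,_ (drop-++ u v) (take-++ u v))) (h u))
        (def-∀-++ k {X = λ w → Q (drop k w) (take k w)} d)

      def-< : ∀ {m} {s t : Vec M m → M} → Sel₁ s → Sel₁ t → Def (λ v → s v < t v)
      def-< (c , p) (d , q) = def-resp
        (λ v h → subst id (sym (cong₂ _<_ (p v) (q v))) h) (λ v h → subst id (cong₂ _<_ (p v) (q v)) h)
        (reify {N = 2} (var zero <ᶠ var (suc zero)) λ { zero → c ; (suc zero) → d })

      def-≡₁ : ∀ {m} {s t : Vec M m → M} → Sel₁ s → Sel₁ t → Def (λ v → s v ≡ t v)
      def-≡₁ (c , p) (d , q) = def-resp
        (λ v h → subst id (sym (cong₂ _≡_ (p v) (q v))) h) (λ v h → subst id (cong₂ _≡_ (p v) (q v)) h)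
        (reify {N = 2} (var zero ≈ᶠ var (suc zero)) λ { zero → c ; (suc zero) → d })

      def-≤ : ∀ {m} {s t : Vec M m → M} → Sel₁ s → Sel₁ t → Def (λ v → s v ≤ t v)
      def-≤ p q = def-∨ (def-< p q) (def-≡₁ p q)

      def-true : ∀ {m} {X : Subset m} → (∀ v → X v) → Def X
      def-true h = def-resp (λ v _ → h v) (λ v _ x → refl)
        (reify {N = 0} (∀ᶠ (var zero ≈ᶠ var zero)) λ ())

      def-false : ∀ {m} {X : Subset m} → (∀ v → ¬ X v) → Def X
      def-false h = def-resp (λ v f → ⊥-elim (f tt)) (λ v x _ → h v x) (def-¬ (def-true {X = λ _ → ⊤} (λ _ → tt)))

      def-∀Fin : ∀ {m} k {X : Fin k → Subset m} → (∀ i → Def (X i)) → Def (λ v → ∀ i → X i v)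
      def-∀Fin zero    d = def-true (λ v ())
      def-∀Fin (suc k) d = def-resp (λ { v (h , h′) zero → h ; v (h , h′) (suc i) → h′ i })
        (λ v h → h zero , h ∘ suc) (def-∧ (d zero) (def-∀Fin k (d ∘ suc)))

      def-≡ : ∀ {m k} {σ τ : Vec M m → Vec M k} → Sel σ → Sel τ → Def (λ v → σ v ≡ τ v)
      def-≡ {k = k} p q = def-resp (λ v → vec-ext) (λ v eq i → cong (λ u → lookup u i) eq)
        (def-∀Fin k λ i → def-≡₁ (coordinate p i) (coordinate q i))

      sel-lookup : ∀ {m} (i : Fin m) → Sel₁ (λ v → lookup v i)
      sel-lookup i = inj₁ i , λ v → refl

      sel-param : ∀ {m} (p : P) → Sel₁ {m} (λ _ → val p)
      sel-param p = inj₂ p , λ v → refl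

      sel-id : ∀ {m} → Sel {m} id
      sel-id = coordinates sel-lookup

      sel-[] : ∀ {m} → Sel {m} (λ _ → [])
      sel-[] = coordinates λ ()

      sel-∷ : ∀ {m n} {s : Vec M m → M} {τ : Vec M m → Vec M n} → Sel₁ s → Sel τ → Sel (λ v → s v ∷ τ v)
      sel-∷ p q = coordinates λ { zero → p ; (suc i) → coordinate q i }

      sel-head : ∀ {m n} {τ : Vec M m → Vec M (suc n)} → Sel τ → Sel₁ (λ v → head (τ v))
      sel-head {τ = τ} p = proj₁ (coordinate p zero) , λ v → trans (head≡lookup (τ v)) (proj₂ (coordinate p zero) v)
        where
        head≡lookup : ∀ {n} (v : Vec M (suc n)) → head v ≡ lookup v zero
        head≡lookup (x ∷ v) = refl

      sel-tail : ∀ {m n} {τ : Vec M m → Vec M (suc n)} → Sel τ → Sel (λ v → tail (τ v))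
      sel-tail {τ = τ} p = coordinates λ i →
        proj₁ (coordinate p (suc i)) , λ v → trans (tail-lookup i (τ v)) (proj₂ (coordinate p (suc i)) v)
        where
        tail-lookup : ∀ {n} i (v : Vec M (suc n)) → lookup (tail v) i ≡ lookup v (suc i)
        tail-lookup i (x ∷ v) = refl

      v₀ : ∀ {m} → Sel₁ {suc m} head
      v₀ = sel-head sel-id

      v₁ : ∀ {m} → Sel₁ {2 + m} (head ∘ tail)
      v₁ = sel-head (sel-tail sel-id)

      v₂ : ∀ {m} → Sel₁ {3 + m} (head ∘ tail ∘ tail)
      v₂ = sel-head (sel-tail (sel-tail sel-id))

      v₃ : ∀ {m} → Sel₁ {4 + m} (head ∘ tail ∘ tail ∘ tail)
      v₃ = sel-head (sel-tail (sel-tail (sel-tail sel-id)))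

      sel-++ : ∀ {m k l} {σ : Vec M m → Vec M k} {τ : Vec M m → Vec M l} →
        Sel σ → Sel τ → Sel (λ v → σ v ++ τ v)
      sel-++ {k = k} {l} {σ} {τ} p q = coordinates λ i → go i (splitAt k i) refl
        where
        go : ∀ i c → splitAt k i ≡ c → Sel₁ (λ v → lookup (σ v ++ τ v) i)
        go i (inj₁ j) e = proj₁ (coordinate p j) , λ v →
          trans (trans (lookup-splitAt k (σ v) (τ v) i) (cong [ lookup (σ v) , lookup (τ v) ]′ e)) (proj₂ (coordinate p j) v)
        go i (inj₂ j) e = proj₁ (coordinate q j) , λ v →
          trans (trans (lookup-splitAt k (σ v) (τ v) i) (cong [ lookup (σ v) , lookup (τ v) ]′ e)) (proj₂ (coordinate q j) v)

      sel-take : ∀ {m} k {l} {τ : Vec M m → Vec M (k + l)} → Sel τ → Sel (λ v → take k (τ v))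
      sel-take k {l} {τ} p = coordinates λ i → proj₁ (coordinate p (i ↑ˡ l)) , λ v →
        trans (trans (sym (lookup-++ˡ (take k (τ v)) (drop k (τ v)) i))
          (cong (λ u → lookup u (i ↑ˡ l)) (take++drop≡id k (τ v)))) (proj₂ (coordinate p (i ↑ˡ l)) v)

      sel-drop : ∀ {m} k {l} {τ : Vec M m → Vec M (k + l)} → Sel τ → Sel (λ v → drop k (τ v))
      sel-drop k {l} {τ} p = coordinates λ i → proj₁ (coordinate p (k ↑ʳ i)) , λ v →
        trans (trans (sym (lookup-++ʳ (take k (τ v)) (drop k (τ v)) i))
          (cong (λ u → lookup u (k ↑ʳ i)) (take++drop≡id k (τ v)))) (proj₂ (coordinate p (k ↑ʳ i)) v)

      sel-∘ : ∀ {l m n} {σ : Vec M m → Vec M n} {τ : Vec M l → Vec M m} → Sel σ → Sel τ → Sel (σ ∘ τ)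
      sel-∘ {m = m} {τ = τ} s t = coordinates λ i → compose (coordinate s i)
        where
        compose : ∀ {s : Vec M m → M} → Sel₁ s → Sel₁ (s ∘ τ)
        compose (inj₁ j , eq) = proj₁ (coordinate t j) , λ v → trans (eq (τ v)) (proj₂ (coordinate t j) v)
        compose (inj₂ p , eq) = inj₂ p , λ v → eq (τ v)

      def-OpenBox : ∀ {m k} {α β τ : Vec M m → Vec M k} → Sel α → Sel β → Sel τ →
        Def (λ v → OpenBox 𝓜 (α v) (β v) (τ v))
      def-OpenBox {k = k} p q r = def-∀Fin k λ i →
        def-∧ (def-< (coordinate p i) (coordinate r i)) (def-< (coordinate r i) (coordinate q i))

      def-ClosedBox : ∀ {m k} {α β τ : Vec M m → Vec M k} → Sel α → Sel β → Sel τ →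
        Def (λ v → ClosedBox 𝓜 (α v) (β v) (τ v))
      def-ClosedBox {k = k} p q r = def-∀Fin k λ i →
        def-∧ (def-≤ (coordinate p i) (coordinate r i)) (def-≤ (coordinate r i) (coordinate q i))

-- Cardinals below κ

double : ℕ → ℕ
double zero    = zero
double (suc n) = suc (suc (double n))

double-injective : ∀ {m n} → double m ≡ double n → m ≡ n
double-injective {zero}  {zero}  _  = refl
double-injective {suc m} {suc n} eq = cong suc (double-injective (ℕ.suc-injective (ℕ.suc-injective eq)))

double≢suc-double : ∀ m n → ¬ double m ≡ suc (double n)
double≢suc-double (suc m) zero    ()
double≢suc-double (suc m) (suc n) eq = double≢suc-double m n (ℕ.suc-injective (ℕ.suc-injective eq))

-- The number 2^m (2n + 1) - 1: the binary digits of n, followed by a zero and m ones.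
pair : ℕ → ℕ → ℕ
pair zero    n = double n
pair (suc m) n = suc (double (pair m n))

pair-injective : ∀ {m n m′ n′} → pair m n ≡ pair m′ n′ → m ≡ m′ × n ≡ n′
pair-injective {zero}  {n} {zero}   {n′} eq = refl , double-injective eq
pair-injective {zero}  {n} {suc m′} {n′} eq = contradiction eq (double≢suc-double n _)
pair-injective {suc m} {n} {zero}   {n′} eq = contradiction (sym eq) (double≢suc-double n′ _)
pair-injective {suc m} {n} {suc m′} {n′} eq
  with refl , refl ← pair-injective {m} {n} {m′} {n′} (double-injective (ℕ.suc-injective eq)) = refl , refl

≺-resp-↣ : {I J K : Set} → I ↣ J → J ≺ K → I ≺ K
≺-resp-↣ f J≺K g = J≺K (f ↣-∘ g)

Σ-Fin↣ℕ : {J : Set} (m : J → ℕ) → J ↣ ℕ → (Σ[ j ∈ J ] Fin (m j)) ↣ ℕ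
Σ-Fin↣ℕ m e = mk↣ {to = λ (j , i) → pair (to e j) (toℕ i)} λ eq → inj (pair-injective eq)
  where
  open Injection using (to; injective)
  inj : ∀ {j i j′ i′} → to e j ≡ to e j′ × toℕ i ≡ toℕ i′ → (j , i) ≡ (j′ , i′)
  inj (p , q) with refl ← injective e p = cong (_ ,_) (toℕ-injective q)

ℕ⊎ℕ↣ℕ : (ℕ ⊎ ℕ) ↣ ℕ
ℕ⊎ℕ↣ℕ = mk↣ inj
  where
  inj : Injective _≡_ _≡_ [ double , suc ∘ double ]′
  inj {inj₁ m} {inj₁ n} eq = cong inj₁ (double-injective eq)
  inj {inj₁ m} {inj₂ n} eq = contradiction eq (double≢suc-double m n)
  inj {inj₂ m} {inj₁ n} eq = contradiction (sym eq) (double≢suc-double n m)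
  inj {inj₂ m} {inj₂ n} eq = cong inj₂ (double-injective (ℕ.suc-injective eq))

⊤⊎↣ℕ : {J : Set} → J ↣ ℕ → (⊤ ⊎ J) ↣ ℕ
⊤⊎↣ℕ {J} e = mk↣ inj
  where
  inj : Injective _≡_ _≡_ [ (λ (_ : ⊤) → zero) , suc ∘ Injection.to e ]′
  inj {inj₁ _} {inj₁ _} eq = refl
  inj {inj₂ m} {inj₂ n} eq = cong inj₂ (Injection.injective e (ℕ.suc-injective eq))

⊎-map-↣ : {I J K : Set} → J ↣ K → (I ⊎ J) ↣ (I ⊎ K)
⊎-map-↣ {I} e = mk↣ inj
  where
  inj : Injective _≡_ _≡_ (Sum.map (id {A = I}) (Injection.to e))
  inj {inj₁ _} {inj₁ _} refl = refl
  inj {inj₂ m} {inj₂ n} eq   = cong inj₂ (Injection.injective e (inj₂-injective eq))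

id↣ : {A : Set} → A ↣ A
id↣ = mk↣ {to = id} id

module Classical (em : ∀ {ℓ} → ExcludedMiddle ℓ) where

  by-contradiction : ∀ {ℓ} {A : Set ℓ} → ¬ ¬ A → A
  by-contradiction = decidable-stable em

  ¬∀⇒∃¬ : ∀ {a b} {A : Set a} {B : A → Set b} → ¬ (∀ x → B x) → ∃[ x ] ¬ B x
  ¬∀⇒∃¬ h = by-contradiction λ k → h λ x → by-contradiction λ ¬b → k (x , ¬b)

  -- Hilbert's hotel if ℕ ↣ I; otherwise I is finite.
  ⊎ℕ-≺ : {I κ : Set} → ℕ ≺ κ → I ≺ κ → (I ⊎ ℕ) ≺ κ
  ⊎ℕ-≺ {I} {κ} ℕ≺κ I≺κ with em {P = ℕ ↣ I}
  ... | yes j = ≺-resp-↣ (mk↣ {to = [ move , g ∘ suc ∘ double ]′} injective) I≺κ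
    where
    g : ℕ → I
    g = Injection.to j

    g-injective : Injective _≡_ _≡_ g
    g-injective = Injection.injective j

    -- Members of the sequence move to its even places, which frees the odd places for ℕ.
    move : I → I
    move i with em {P = ∃[ n ] g n ≡ i}
    ... | yes (n , _) = g (double n)
    ... | no _        = i

    move-injective : Injective _≡_ _≡_ move
    move-injective {i} {i′} eq with em {P = ∃[ n ] g n ≡ i} | em {P = ∃[ n ] g n ≡ i′}
    ... | yes (n , p) | yes (n′ , p′) =
      trans (sym p) (trans (cong g (double-injective (g-injective eq))) p′)
    ... | yes (n , p) | no ¬p = contradiction (_ , eq) ¬p
    ... | no ¬p | yes (n , p) = contradiction (_ , sym eq) ¬p
    ... | no _ | no _ = eq

    move≢ : ∀ i n → ¬ move i ≡ g (suc (double n))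
    move≢ i n eq with em {P = ∃[ n ] g n ≡ i}
    ... | yes (m , _) = double≢suc-double m n (g-injective eq)
    ... | no ¬p = ¬p (_ , sym eq)

    injective : Injective _≡_ _≡_ [ move , g ∘ suc ∘ double ]′
    injective {inj₁ i} {inj₁ i′} eq = cong inj₁ (move-injective eq)
    injective {inj₁ i} {inj₂ n}  eq = contradiction eq (move≢ i n)
    injective {inj₂ n} {inj₁ i}  eq = contradiction (sym eq) (move≢ i n)
    injective {inj₂ m} {inj₂ n}  eq = cong inj₂ (double-injective (ℕ.suc-injective (g-injective eq)))
  ... | no ¬j = ≺-resp-↣ (ℕ⊎ℕ↣ℕ ↣-∘ mk↣ {to = Sum.map index id} injective) ℕ≺κ
    where
    -- If every list left out an element of `I`, picking such elements one after the other would
    -- inject ℕ into `I`. Hence some list exhausts `I`.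
    Fresh : Set
    Fresh = ∀ (xs : List I) → ∃[ i ] ¬ i ∈ˡ xs

    sequence : Fresh → ℕ ↣ I
    sequence fresh = mk↣ {to = new} λ {m} {n} → inj m n
      where
      used : ℕ → List I
      used zero    = []
      used (suc n) = proj₁ (fresh (used n)) ∷ used n

      new : ℕ → I
      new n = proj₁ (fresh (used n))

      new∈used : ∀ {m n} → m ℕ.<′ n → new m ∈ˡ used n
      new∈used ℕ.<′-base    = here refl
      new∈used (ℕ.≤′-step p) = there (new∈used p)

      inj : ∀ m n → new m ≡ new n → m ≡ n
      inj m n eq with ℕ.<-cmp m n
      ... | tri≈ _ p _ = p
      ... | tri< p _ _ = contradiction (subst (_∈ˡ used n) eq (new∈used (ℕ.<⇒<′ p))) (proj₂ (fresh (used n)))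
      ... | tri> _ _ p = contradiction (subst (_∈ˡ used m) (sym eq) (new∈used (ℕ.<⇒<′ p))) (proj₂ (fresh (used m)))

    finite : Σ[ xs ∈ List I ] (∀ i → i ∈ˡ xs)
    finite = by-contradiction λ h → ¬j (sequence λ xs → ¬∀⇒∃¬ λ all → h (xs , all))

    position : ∀ i → Fin (List.length (proj₁ finite))
    position i = Any.index (proj₂ finite i)

    index : I → ℕ
    index i = toℕ (position i)

    index-injective : Injective _≡_ _≡_ index
    index-injective {i} {i′} eq = trans (lookup-index (proj₂ finite i))
      (trans (cong (List.lookup (proj₁ finite)) (toℕ-injective eq)) (sym (lookup-index (proj₂ finite i′))))

    injective : Injective _≡_ _≡_ (Sum.map index (id {A = ℕ}))
    injective {inj₁ i} {inj₁ i′} eq = cong inj₁ (index-injective (inj₁-injective eq))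
    injective {inj₂ m} {inj₂ n}  refl = refl

-- Saturation as compactness

module Compactness (em : ∀ {ℓ} → ExcludedMiddle ℓ) {L : Signature} (𝓜 : Structure L) (κ : Set)
  (ℕ≺κ : ℕ ≺ κ) (saturated : Saturated 𝓜 κ) where
  open Structure 𝓜 renaming (Carrier to M)
  open Definability 𝓜
  open Classical em

  opaque
    -- The type consists of `X` and the complements of all `Y j`. If no finite subfamily covered
    -- `X`, it would be finitely satisfiable, and a realization would be a point of `X` outside
    -- every `Y j`. The bound concerns the parameters; `J` may run through all formulas of the
    -- language.
    compactness : {P J : Set} {val : P → M} → P ≺ κ → ∀ {n} {X : Subset n} {Y : J → Subset n} →
      DefinableOver val X → (∀ j → DefinableOver val (Y j)) →
      (∀ v → X v → ∃[ j ] Y j v) → Σ[ js ∈ List J ] (∀ v → X v → Any (λ j → Y j v) js)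
    compactness {P} {J} {val} P≺κ {n} {X} {Y} X-def Y-def cover = by-contradiction absurd
      where
      open Over val
      ¬Y-def : ∀ j → Def (λ v → ¬ Y j v)
      ¬Y-def j = def-¬ (Y-def j)

      type : Pred (FormulaOver L P n) 0ℓ
      type φ = φ ≡ proj₁ X-def ⊎ (∃[ j ] φ ≡ proj₁ (¬Y-def j))

      indices : ∀ Γ → All type Γ → Σ[ js ∈ List J ]
        (∀ x → X x → ¬ Any (λ j → Y j x) js → All (λ φ → SatOver 𝓜 val φ x) Γ)
      indices [] [] = [] , λ _ _ _ → []
      indices (φ ∷ Γ) (inj₁ refl ∷ all) with js , back ← indices Γ all =
        js , λ x x∈X ¬y → proj₁ (proj₂ X-def) x∈X ∷ back x x∈X ¬y
      indices (φ ∷ Γ) (inj₂ (j , refl) ∷ all) with js , back ← indices Γ all =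
        j ∷ js , λ x x∈X ¬y → proj₁ (proj₂ (¬Y-def j)) (¬y ∘ here) ∷ back x x∈X (¬y ∘ there)

      absurd : ¬ ¬ (Σ[ js ∈ List J ] (∀ v → X v → Any (λ j → Y j v) js))
      absurd none = proj₂ (proj₂ (¬Y-def j)) (real _ (inj₂ (j , refl))) y
        where
        finitely-satisfiable : ∀ Γ → All type Γ → ∃[ x ] All (λ φ → SatOver 𝓜 val φ x) Γ
        finitely-satisfiable Γ all with js , back ← indices Γ all
          with x , h ← ¬∀⇒∃¬ (λ h → none (js , h)) =
          x , back x (by-contradiction λ ¬x → h λ m → contradiction m ¬x) (λ y → h λ _ → y)

        realized : ∃[ x ] (∀ φ → type φ → SatOver 𝓜 val φ x)
        realized = saturated P≺κ val type finitely-satisfiable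

        x : Vec M n
        x = proj₁ realized

        real : ∀ φ → type φ → SatOver 𝓜 val φ x
        real = proj₂ realized

        covered : ∃[ j ] Y j x
        covered = cover x (proj₂ (proj₂ X-def) (real _ (inj₁ refl)))

        j : J
        j = proj₁ covered

        y : Y j x
        y = proj₂ covered

  -- A single definable set uses finitely many parameters, so a countable family lives over a
  -- countable set of them. The arities may vary, so that ingredients of different kinds can share
  -- `Param`.
  record CommonParameters {J : Set} (Z : J → Σ[ k ∈ ℕ ] Subset k) : Set₁ where
    field
      Param    : Set
      val      : Param → M
      small    : Param ↣ ℕ
      overThem : ∀ j → DefinableOver val (proj₂ (Z j))

    Param≺κ : Param ≺ κ
    Param≺κ = ≺-resp-↣ small ℕ≺κ

  opaque
    commonParameters : {J : Set} → J ↣ ℕ → (Z : J → Σ[ k ∈ ℕ ] Subset k) →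
      (∀ j → Definable 𝓜 (proj₂ (Z j))) → CommonParameters Z
    commonParameters {J} e Z def = record
      { Param    = Σ[ j ∈ J ] Fin (proj₁ (proj₁ (def j)))
      ; val      = λ (j , i) → lookup (parameters j) i
      ; small    = Σ-Fin↣ℕ _ e
      ; overThem = λ j → over (def j) (j ,_) (λ i → refl)
      }
      where
      parameters : ∀ j → Vec M (proj₁ (proj₁ (def j)))
      parameters j = proj₂ (proj₂ (proj₁ (def j)))

      over : ∀ {k} {X : Subset k} (d : Definable 𝓜 X) {P : Set} {val : P → M}
        (h : Fin (proj₁ (proj₁ d)) → P) → (∀ i → val (h i) ≡ lookup (proj₂ (proj₂ (proj₁ d))) i) →
        DefinableOver val X
      over ((l , φ , ps) , to , from) {val = val} h eq =
        (l , φ , tabulate h) ,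
        (λ {x} → subst (Sat 𝓜 φ) (cong (x ++_) (sym same)) ∘ to) ,
        (λ {x} → from ∘ subst (Sat 𝓜 φ) (cong (x ++_) same))
        where
        same : map val (tabulate h) ≡ map id ps
        same = vec-ext λ i → trans (lookup-map i val (tabulate h)) (trans (cong val (lookup∘tabulate h i))
          (trans (eq i) (cong (λ v → lookup v i) (sym (map-id ps)))))

    countable-compactness : {J : Set} → J ↣ ℕ → ∀ {n} {X : Subset n} {Y : J → Subset n} →
      Definable 𝓜 X → (∀ j → Definable 𝓜 (Y j)) →
      (∀ v → X v → ∃[ j ] Y j v) → Σ[ js ∈ List J ] (∀ v → X v → Any (λ j → Y j v) js)
    countable-compactness {J} e {n} {X} {Y} X-def Y-def =
      compactness Param≺κ (overThem (inj₁ tt)) (overThem ∘ inj₂)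
      where
      family : ⊤ ⊎ J → Σ[ k ∈ ℕ ] Subset k
      family = [ (λ _ → n , X) , (λ j → n , Y j) ]′

      family-def : ∀ j → Definable 𝓜 (proj₂ (family j))
      family-def (inj₁ _) = X-def
      family-def (inj₂ j) = Y-def j

      common : CommonParameters family
      common = commonParameters (⊤⊎↣ℕ e) family family-def

      open CommonParameters common

    -- The source of every uniform bound below: a length that exists for each point separately is
    -- bounded on the whole definable set.
    increasing-compactness : ∀ {n} {X : Subset n} {Y : ℕ → Subset n} →
      Definable 𝓜 X → (∀ j → Definable 𝓜 (Y j)) → (∀ j v → Y j v → Y (suc j) v) →
      (∀ v → X v → ∃[ j ] Y j v) → Σ[ N ∈ ℕ ] (∀ v → X v → Y N v)
    increasing-compactness {n} {X} {Y} X-def Y-def step cover =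
      bound (proj₁ subcover) , λ v x → ∈-bound (proj₁ subcover) v (proj₂ subcover v x)
      where
      subcover : Σ[ js ∈ List ℕ ] (∀ v → X v → Any (λ j → Y j v) js)
      subcover = countable-compactness id↣ X-def Y-def cover

      bound : List ℕ → ℕ
      bound []       = 0
      bound (j ∷ js) = j ℕ.⊔ bound js

      mono : ∀ {i j} v → i ℕ.≤′ j → Y i v → Y j v
      mono v ℕ.≤′-refl     y = y
      mono v (ℕ.≤′-step p) y = step _ v (mono v p y)

      ∈-bound : ∀ js v → Any (λ j → Y j v) js → Y (bound js) v
      ∈-bound (j ∷ js) v (here y)  = mono v (ℕ.≤⇒≤′ (ℕ.m≤m⊔n j (bound js))) y
      ∈-bound (j ∷ js) v (there y) = mono v (ℕ.≤⇒≤′ (ℕ.m≤n⊔m j (bound js))) (∈-bound js v y)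

-- Order, boxes and definable completeness

module Order {L : Signature} (𝓜 : Structure L) (oMinimal : IsOMinimal 𝓜) where
  open Structure 𝓜 renaming (Carrier to M)
  open StrictToNonStrict _≡_ _<_ public using (_≤_; <⇒≤)
  open IsOMinimal oMinimal public
  open IsDenseLinearOrder isDenseLinearOrder public using (compare; dense) renaming (trans to <-trans)
  open Definability 𝓜
  open Over {P = M} id
  private
    module Strict = IsDenseLinearOrder isDenseLinearOrder

  <-irrefl : ∀ {x} → ¬ x < x
  <-irrefl = Strict.irrefl refl

  ≤-refl : ∀ {x} → x ≤ x
  ≤-refl = inj₂ refl

  ≤-trans : ∀ {x y z} → x ≤ y → y ≤ z → x ≤ z
  ≤-trans (inj₁ p)    (inj₁ q)    = inj₁ (<-trans p q)
  ≤-trans (inj₁ p)    (inj₂ refl) = inj₁ p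
  ≤-trans (inj₂ refl) q           = q

  <-≤-trans : ∀ {x y z} → x < y → y ≤ z → x < z
  <-≤-trans p (inj₁ q)    = <-trans p q
  <-≤-trans p (inj₂ refl) = p

  ≤-<-trans : ∀ {x y z} → x ≤ y → y < z → x < z
  ≤-<-trans (inj₁ p)    q = <-trans p q
  ≤-<-trans (inj₂ refl) q = q

  <⇒≱ : ∀ {x y} → x < y → ¬ y ≤ x
  <⇒≱ p q = <-irrefl (<-≤-trans p q)

  ≤-antisym : ∀ {x y} → x ≤ y → y ≤ x → x ≡ y
  ≤-antisym (inj₂ p) _ = p
  ≤-antisym (inj₁ p) q = contradiction q (<⇒≱ p)

  <-≤-connex : ∀ x y → x < y ⊎ y ≤ x
  <-≤-connex x y with compare x y
  ... | tri< p _ _ = inj₁ p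
  ... | tri≈ _ p _ = inj₂ (inj₂ (sym p))
  ... | tri> _ _ p = inj₂ (inj₁ p)

  ≤-total : ∀ x y → x ≤ y ⊎ y ≤ x
  ≤-total x y = Sum.map inj₁ id (<-≤-connex x y)

  upper : ∀ x y → ∃[ z ] x ≤ z × y ≤ z × (∀ {w} → x < w → y < w → z < w)
  upper x y with ≤-total x y
  ... | inj₁ p = y , p , ≤-refl , λ _ q → q
  ... | inj₂ p = x , ≤-refl , p , λ q _ → q

  lower : ∀ x y → ∃[ z ] z ≤ x × z ≤ y × (∀ {w} → w < x → w < y → w < z)
  lower x y with ≤-total x y
  ... | inj₁ p = x , ≤-refl , p , λ q _ → q
  ... | inj₂ p = y , p , ≤-refl , λ _ q → q

  -- `Q` belongs to the neighbourhood filter of `p` in Mⁿ. Since `Q` is an arbitrary predicate,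
  -- local conditions can be intersected and pulled back freely, without regard to their
  -- definability.
  record Near {n} (p : Vec M n) (Q : Subset n) : Set where
    constructor box
    field
      lo hi  : Vec M n
      centre : OpenBox 𝓜 lo hi p
      inside : ∀ q → OpenBox 𝓜 lo hi q → Q q

  near-map : ∀ {n} {p : Vec M n} {Q R : Subset n} → (∀ q → Q q → R q) → Near p Q → Near p R
  near-map f (box a b p∈ h) = box a b p∈ λ q → f q ∘ h q

  near-point : ∀ {n} {p : Vec M n} {Q : Subset n} → Near p Q → Q p
  near-point (box a b p∈ h) = h _ p∈

  private
    OpenBox-∷ : ∀ {n x y z} {a b p : Vec M n} → y < x → x < z → OpenBox 𝓜 a b p → OpenBox 𝓜 (y ∷ a) (z ∷ b) (x ∷ p)
    OpenBox-∷ y<x x<z h zero    = y<x , x<z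
    OpenBox-∷ y<x x<z h (suc i) = h i

  near-coordinate : ∀ {n} (p : Vec M n) i {l r} → l < lookup p i → lookup p i < r →
    Near p (λ q → l < lookup q i × lookup q i < r)
  near-everywhere : ∀ {n} (p : Vec M n) → Near p (λ _ → ⊤)

  near-everywhere []      = box [] [] (λ ()) _
  near-everywhere (x ∷ p)
    with box a b p∈ _ ← near-everywhere p | y , y<x ← noMinimum x | z , x<z ← noMaximum x =
    box (y ∷ a) (z ∷ b) (OpenBox-∷ y<x x<z p∈) _

  near-coordinate (x ∷ p) zero {l} {r} l<x x<r with box a b p∈ _ ← near-everywhere p =
    box (l ∷ a) (r ∷ b) (OpenBox-∷ l<x x<r p∈) λ q h → h zero
  near-coordinate (x ∷ p) (suc i) l<x x<r
    with box a b p∈ h ← near-coordinate p i l<x x<r | y , y<x ← noMinimum x | z , x<z ← noMaximum x =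
    box (y ∷ a) (z ∷ b) (OpenBox-∷ y<x x<z p∈) λ { (_ ∷ q) q∈ → h q (q∈ ∘ suc) }

  near-all : ∀ {n} {p : Vec M n} {Q : Subset n} → (∀ q → Q q) → Near p Q
  near-all h = near-map (λ q _ → h q) (near-everywhere _)

  near-∧ : ∀ {n} {p : Vec M n} {Q R : Subset n} → Near p Q → Near p R → Near p (λ q → Q q × R q)
  near-∧ {p = []} (box a b p∈ h) (box a′ b′ p∈′ h′) = box [] [] (λ ()) λ { [] _ → h [] (λ ()) , h′ [] λ () }
  near-∧ {p = x ∷ p} {Q} {R} (box (a ∷ as) (b ∷ bs) p∈ h) (box (a′ ∷ as′) (b′ ∷ bs′) p∈′ h′)
    with l , a≤l , a′≤l , l-max ← upper a a′ | r , r≤b , r≤b′ , r-min ← lower b b′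
       | box α β p∈αβ k ← near-∧ {p = p} {Q = OpenBox 𝓜 as bs} {R = OpenBox 𝓜 as′ bs′}
                              (box as bs (p∈ ∘ suc) λ _ q → q) (box as′ bs′ (p∈′ ∘ suc) λ _ q → q) =
    box (l ∷ α) (r ∷ β)
    (OpenBox-∷ (l-max (proj₁ (p∈ zero)) (proj₁ (p∈′ zero))) (r-min (proj₂ (p∈ zero)) (proj₂ (p∈′ zero))) p∈αβ)
    λ { (y ∷ q) q∈ →
      h (y ∷ q) (OpenBox-∷ (≤-<-trans a≤l (proj₁ (q∈ zero))) (<-≤-trans (proj₂ (q∈ zero)) r≤b) (proj₁ (k q (q∈ ∘ suc)))) ,
      h′ (y ∷ q) (OpenBox-∷ (≤-<-trans a′≤l (proj₁ (q∈ zero))) (<-≤-trans (proj₂ (q∈ zero)) r≤b′) (proj₂ (k q (q∈ ∘ suc)))) }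

  near-∀Fin : ∀ {n} {p : Vec M n} k {Q : Fin k → Subset n} → (∀ i → Near p (Q i)) → Near p (λ q → ∀ i → Q i q)
  near-∀Fin zero    h = near-all λ _ ()
  near-∀Fin (suc k) h = near-map (λ { q (x , y) zero → x ; q (x , y) (suc i) → y i })
    (near-∧ (h zero) (near-∀Fin k (h ∘ suc)))

  -- Each coordinate of a selection is a projection or a constant, hence continuous.
  near-sel : ∀ {m n} {σ : Vec M m → Vec M n} → Sel σ → ∀ {p} {Q : Subset n} →
    Near (σ p) Q → Near p (Q ∘ σ)
  near-sel {m} {n} {σ} sel {p} (box a b p∈ h) = near-map (λ q → h (σ q)) (near-∀Fin n λ i → near-sel₁ (coordinate sel i) (p∈ i))
    where
    near-sel₁ : ∀ {s l r} → Sel₁ s → l < s p × s p < r → Near p (λ q → l < s q × s q < r)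
    near-sel₁ {s} {l} {r} (inj₁ j , eq) (l< , <r) =
      near-map (λ q (x , y) → subst (l <_) (sym (eq q)) x , subst (_< r) (sym (eq q)) y)
        (near-coordinate p j (subst (l <_) (eq p) l<) (subst (_< r) (eq p) <r))
    near-sel₁ {s} {l} {r} (inj₂ c , eq) (l< , <r) = near-all λ q →
      subst (l <_) (trans (eq p) (sym (eq q))) l< , subst (_< r) (trans (eq p) (sym (eq q))) <r

  interval-near : ∀ {x l r} {Q : M → Set} → l < x → x < r → (∀ y → l < y → y < r → Q y) → Near (x ∷ []) (λ v → Q (head v))
  interval-near {l = l} {r} l<x x<r h = box (l ∷ []) (r ∷ []) (λ { zero → l<x , x<r })
    λ { (y ∷ []) q → h y (proj₁ (q zero)) (proj₂ (q zero)) }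

  near-interval : ∀ {x} {Q : Subset 1} → Near (x ∷ []) Q →
    ∃[ l ] ∃[ r ] l < x × x < r × (∀ y → l < y → y < r → Q (y ∷ []))
  near-interval (box (l ∷ []) (r ∷ []) p∈ h) = l , r , proj₁ (p∈ zero) , proj₂ (p∈ zero) ,
    λ y l<y y<r → h (y ∷ []) λ { zero → l<y , y<r }

  DefinableSet : (M → Set) → Set
  DefinableSet S = Def {1} (λ v → S (head v))

  IsSupremum : (M → Set) → M → Set
  IsSupremum S c = (∀ x → S x → x ≤ c) × (∀ y → y < c → ∃[ x ] S x × y < x)

  private
    open AddExtrema _<_ using (_<±_; <±-trans; <±-asym)

    -- By density, the right end of a nonempty bounded interval is its supremum. A right end at
    -- minus infinity makes the piece empty, and one at plus infinity contradicts the bound.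
    sup-piece : ∀ p {x b} → ⟦_⟧ₚ 𝓜 p x → (∀ y → ⟦_⟧ₚ 𝓜 p y → y ≤ b) → ∃[ c ] IsSupremum (⟦_⟧ₚ 𝓜 p) c
    sup-piece (singleton a) x∈ bounded = a , (λ _ eq → inj₂ eq) , λ y y<a → a , refl , y<a
    sup-piece (interval l ⊥±) {x} (_ , x<⊥) bounded = contradiction AddExtrema.⊥±<[ x ] (<±-asym Strict.asym x<⊥)
    sup-piece (interval l ⊤±) {x} {b} (l<x , _) bounded
      with c , x≤c , b≤c , _ ← upper x b
      with d , c<d ← noMaximum c =
      contradiction
        (bounded d (<±-trans <-trans l<x AddExtrema.[ ≤-<-trans x≤c c<d ] , AddExtrema.[ d ]<⊤±))
        (<⇒≱ (≤-<-trans b≤c c<d))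
    sup-piece (interval l [ c ]) {x} (l<x , AddExtrema.[ x<c ]) bounded =
      c , (λ { y (_ , AddExtrema.[ y<c ]) → inj₁ y<c }) , λ y y<c →
        let m , x≤m , y≤m , m-max = upper x y
            z , m<z , z<c = dense (m-max x<c y<c)
        in z , (<±-trans <-trans l<x AddExtrema.[ ≤-<-trans x≤m m<z ] , AddExtrema.[ z<c ]) , ≤-<-trans y≤m m<z

    sup-∪ : ∀ {S T c d} → IsSupremum S c → IsSupremum T d → ∃[ e ] IsSupremum (λ x → S x ⊎ T x) e
    sup-∪ {c = c} {d} (ub , approx) (ub′ , approx′) with ≤-total c d
    ... | inj₁ c≤d = d , (λ x → [ (λ s → ≤-trans (ub x s) c≤d) , ub′ x ]′) ,
      λ y y<d → let x , t , y<x = approx′ y y<d in x , inj₂ t , y<x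
    ... | inj₂ d≤c = c , (λ x → [ ub x , (λ t → ≤-trans (ub′ x t) d≤c) ]′) ,
      λ y y<c → let x , s , y<x = approx y y<c in x , inj₁ s , y<x

    sup-resp : ∀ {S T c} → (∀ x → S x → T x) → (∀ x → T x → S x) → IsSupremum S c → IsSupremum T c
    sup-resp f g (ub , approx) = (λ x → ub x ∘ g x) ,
      λ y y<c → let x , s , y<x = approx y y<c in x , f x s , y<x

  module Completeness (em : ∀ {ℓ} → ExcludedMiddle ℓ) where

    private
      Union : List (Piece 𝓜) → M → Set
      Union ps x = Any (λ p → ⟦_⟧ₚ 𝓜 p x) ps

      sup-pieces : ∀ ps {b} → (∀ x → Union ps x → x ≤ b) → (∀ x → ¬ Union ps x) ⊎ (∃[ c ] IsSupremum (Union ps) c)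
      sup-pieces []       bounded = inj₁ λ x ()
      sup-pieces (p ∷ ps) bounded with em {P = ∃[ x ] ⟦_⟧ₚ 𝓜 p x} | sup-pieces ps (λ x → bounded x ∘ there)
      ... | no empty | inj₁ empty′ = inj₁ λ { x (here h) → empty (x , h) ; x (there h) → empty′ x h }
      ... | no empty | inj₂ (c , sup) = inj₂ (c , sup-resp (λ _ → there)
        (λ { x (here h) → contradiction (x , h) empty ; x (there h) → h }) sup)
      ... | yes (x , h) | inj₁ empty′ with c , sup ← sup-piece p h (λ y → bounded y ∘ here) =
        inj₂ (c , sup-resp (λ _ → here) (λ { x (here h) → h ; x (there h) → contradiction h (empty′ x) }) sup)
      sup-pieces (p ∷ ps) bounded | yes (x , h) | inj₂ (c , sup) with c′ , sup′ ← sup-piece p h (λ y → bounded y ∘ here)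
        with e , sup″ ← sup-∪ sup′ sup = inj₂ (e , sup-resp (λ _ → [ here , there ]′)
          (λ { x (here h) → inj₁ h ; x (there h) → inj₂ h }) sup″)

    opaque
      -- By o-minimality the set is a finite union of points and intervals, and the largest of their
      -- suprema is the supremum of the union.
      supremum : ∀ {S x b} → DefinableSet S → S x → (∀ y → S y → y ≤ b) → ∃[ c ] IsSupremum S c
      supremum {S} {x} S-def s bounded with ps , to , from ← finiteUnion _ S-def
        with sup-pieces ps (λ y → bounded y ∘ from)
      ... | inj₁ empty = contradiction (to s) (empty x)
      ... | inj₂ (c , sup) = c , sup-resp (λ _ → from) (λ _ → to) sup

      -- Take the supremum c of all z such that `S` holds on [a,z]. The truth value of `S` is
      -- constant near c, so `S` spreads from the left of c to its right, which forces c = b and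
      -- reaches b itself. The local hypothesis says that `S` is relatively open and closed at once.
      interval-connected : ∀ {S : M → Set} {a b} → DefinableSet S →
        (∀ p → a ≤ p → p ≤ b → Near (p ∷ []) (λ v → a ≤ head v → head v ≤ b → (S p → S (head v)) × (S (head v) → S p))) →
        S a → ∀ x → a ≤ x → x ≤ b → S x
      interval-connected {S} {a} {b} S-def local s-a x a≤x x≤b = proj₂ (proj₂ b∈X) x a≤x x≤b
        where
        X : M → Set
        X z = a ≤ z × z ≤ b × (∀ y → a ≤ y → y ≤ z → S y)

        X-def : DefinableSet X
        X-def = def-∧ (def-≤ (sel-param a) v₀) (def-∧ (def-≤ v₀ (sel-param b))
          (def-∀₁ {Q = λ v y → a ≤ y → y ≤ head v → S y} (def-⇒ (def-≤ (sel-param a) v₀) (def-⇒ (def-≤ v₀ v₁)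
            (def-sub (sel-∷ {s = head} v₀ sel-[]) S-def)))))

        a∈X : X a
        a∈X = ≤-refl , ≤-trans a≤x x≤b , λ y a≤y y≤a → subst S (≤-antisym a≤y y≤a) s-a

        module At {c} (sup : IsSupremum X c) where
          a≤c : a ≤ c
          a≤c = proj₁ sup a a∈X

          c≤b : c ≤ b
          c≤b with <-≤-connex b c
          ... | inj₂ p = p
          ... | inj₁ b<c with z , z∈X , b<z ← proj₂ sup b b<c = contradiction (proj₁ (proj₂ z∈X)) (<⇒≱ b<z)

          module _ {l r} (l<c : l < c) (c<r : c < r)
            (same : ∀ y → l < y → y < r → a ≤ y → y ≤ b → (S c → S y) × (S y → S c))
            {z} (z∈X : X z) (l<z : l < z) where

            z<r : z < r
            z<r = ≤-<-trans (proj₁ sup z z∈X) c<r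

            s-c : S c
            s-c = proj₂ (same z l<z z<r (proj₁ z∈X) (proj₁ (proj₂ z∈X))) (proj₂ (proj₂ z∈X) z (proj₁ z∈X) ≤-refl)

            extend : ∀ w → a ≤ w → w ≤ b → w < r → X w
            extend w a≤w w≤b w<r = a≤w , w≤b , λ y a≤y y≤w →
              [ (λ z<y → proj₁ (same y (<-trans l<z z<y) (≤-<-trans y≤w w<r) a≤y (≤-trans y≤w w≤b)) s-c) ,
                proj₂ (proj₂ z∈X) y a≤y ]′ (<-≤-connex z y)

            end : X b
            end with <-≤-connex c b
            ... | inj₂ b≤c = extend b (≤-trans a≤c c≤b) ≤-refl (≤-<-trans b≤c c<r)
            ... | inj₁ c<b with m , m≤b , m≤r , m-min ← lower b r
              with w , c<w , w<m ← dense (m-min c<b c<r) =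
              contradiction (proj₁ sup w
                (extend w (≤-trans a≤c (<⇒≤ c<w)) (≤-trans (<⇒≤ w<m) m≤b) (<-≤-trans w<m m≤r))) (<⇒≱ c<w)

        b∈X : X b
        b∈X =
          let c , sup = supremum X-def a∈X (λ y y∈X → proj₁ (proj₂ y∈X))
              l , r , l<c , c<r , same = near-interval (local c (At.a≤c sup) (At.c≤b sup))
              z , z∈X , l<z = proj₂ sup l l<c
          in At.end sup l<c c<r same z∈X l<z

-- A path is a definable set over a tuple of parameters; which parameters
-- define paths is itself a definable condition.
module DefinablePaths {L : Signature} (𝓜 : Structure L) (k d : ℕ)
  (Unit : Pred (Vec (Structure.Carrier 𝓜) k) 0ℓ)
  (Boxes : Pred (Vec (Structure.Carrier 𝓜) (d + d)) 0ℓ)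
  (Quotient : Pred (Vec (Structure.Carrier 𝓜) (k + k)) 0ℓ)
  (QuotientBox : Pred (Vec (Structure.Carrier 𝓜) ((k + k) + (d + d))) 0ℓ) where
  open Structure 𝓜 renaming (Carrier to M)
  open StrictToNonStrict _≡_ _<_ using (_≤_)
  open Definability 𝓜

  module _ (r : ℕ) (φ : Formula L ((1 + k) + r)) where

    -- The tuple `v` lists the two ends of the interval of definition, then the parameters of `φ`.
    -- The formula is meant to define the graph of a path, `w` being the coordinates in M^k of the
    -- point at time `x`.
    Γ : Vec M (2 + r) → M → Vec M k → Set
    Γ v x w = Sat 𝓜 φ ((x ∷ w) ++ tail (tail v))

    Within : Vec M (2 + r) → M → Set
    Within v x = head v ≤ x × x ≤ head (tail v)

    -- `Total` and `Functional` make the formula define a map, `Coherent` puts its values and all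
    -- their quotients into U, and `Starts` fixes the initial point ε. `Local` is continuity: (c,e)
    -- runs through the boxes around the chart coordinates of ε, and quotients of nearby points have
    -- to lie in the chart box given by (c,e).
    Total Coherent Functional Local Starts : Subset (2 + r)
    Total v      = ∀ x → Within v x → ∃[ w ] Γ v x w
    Coherent v   = ∀ x y → Within v x → Within v y → ∀ w z → Γ v x w → Γ v y z → Quotient (w ++ z)
    Functional v = ∀ x → Within v x → ∀ w z → Γ v x w → Γ v x z → w ≡ z
    Local v      = ∀ x → Within v x → ∀ (c e : Vec M d) → Boxes (c ++ e) →
      ∃[ l ] ∃[ u ] l < x × x < u × (∀ y → Within v y → l < y → y < u → ∀ w z → Γ v x w → Γ v y z → QuotientBox ((w ++ z) ++ (c ++ e)))
    Starts v     = ∃[ w ] Unit w × Γ v (head v) w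

    record Describes (v : Vec M (2 + r)) : Set where
      constructor describes
      field
        ordered    : head v < head (tail v)
        total      : Total v
        coherent   : Coherent v
        functional : Functional v
        local      : Local v
        starts     : Starts v

    End : Subset k
    End z = ∃[ v ] Describes v × Γ v (head (tail v)) z

    module _ {P : Set} {val : P → M} (Unit-def : DefinableOver val Unit) (Boxes-def : DefinableOver val Boxes)
      (Quotient-def : DefinableOver val Quotient) (QuotientBox-def : DefinableOver val QuotientBox) where
      open Over val

      private
        module _ {m} {v : Vec M m → Vec M (2 + r)} (sv : Sel v) where

          Γ-def : ∀ {x : Vec M m → M} {w : Vec M m → Vec M k} → Sel₁ x → Sel w → Def (λ u → Γ (v u) (x u) (w u))
          Γ-def sx sw = def-sub (sel-++ (sel-∷ sx sw) (sel-tail (sel-tail sv))) (def-formula φ)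

          Within-def : ∀ {x : Vec M m → M} → Sel₁ x → Def (λ u → Within (v u) (x u))
          Within-def sx = def-∧ (def-≤ (sel-head sv) sx) (def-≤ sx (sel-head (sel-tail sv)))

        total-def : Def Total
        total-def = def-∀₁ (def-⇒ (Within-def (sel-tail sel-id) v₀)
          (def-∃ k (Γ-def (sel-tail (sel-drop k sel-id)) (sel-head (sel-drop k sel-id)) (sel-take k sel-id))))

        coherent-def : Def Coherent
        coherent-def = def-∀₁ (def-∀₁ (def-⇒ (Within-def (sel-tail (sel-tail sel-id)) v₁)
          (def-⇒ (Within-def (sel-tail (sel-tail sel-id)) v₀)
          (def-∀ k (def-∀ k
            (def-⇒ (Γ-def (sel-tail (sel-tail sxy)) (sel-head (sel-tail sxy)) (sel-take k (sel-drop k sel-id)))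
            (def-⇒ (Γ-def (sel-tail (sel-tail sxy)) (sel-head sxy) (sel-take k sel-id))
              (def-sub (sel-++ (sel-take k (sel-drop k sel-id)) (sel-take k sel-id)) Quotient-def))))))))
          where
          sxy : Sel (λ (u : Vec M (k + (k + (2 + (2 + r))))) → drop k (drop k u))
          sxy = sel-drop k (sel-drop k sel-id)

        functional-def : Def Functional
        functional-def = def-∀₁ (def-⇒ (Within-def (sel-tail sel-id) v₀)
          (def-∀ k (def-∀ k
            (def-⇒ (Γ-def (sel-tail sx) (sel-head sx) (sel-take k (sel-drop k sel-id)))
            (def-⇒ (Γ-def (sel-tail sx) (sel-head sx) (sel-take k sel-id))
              (def-≡ (sel-take k (sel-drop k sel-id)) (sel-take k sel-id)))))))
          where
          sx : Sel (λ (u : Vec M (k + (k + (1 + (2 + r))))) → drop k (drop k u))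
          sx = sel-drop k (sel-drop k sel-id)

        local-def : Def Local
        local-def = def-∀₁ (def-⇒ (Within-def (sel-tail sel-id) v₀)
          (def-∀ d (def-∀ d (def-⇒ (def-sub (sel-++ (sel-take d (sel-drop d sel-id)) (sel-take d sel-id)) Boxes-def)
          (def-∃₁ (def-∃₁
            (def-∧ (def-< v₁ (sel-head (sel-drop d (sel-drop d (sel-tail (sel-tail sel-id))))))
            (def-∧ (def-< (sel-head (sel-drop d (sel-drop d (sel-tail (sel-tail sel-id))))) v₀)
            (def-∀₁ (def-⇒ (Within-def (sel-tail (sel-drop d (sel-drop d (sel-tail (sel-tail (sel-tail sel-id)))))) v₀)
              (def-⇒ (def-< v₂ v₀)
              (def-⇒ (def-< v₀ v₁)
              (def-∀ k (def-∀ k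
                (def-⇒ (Γ-def (sel-tail sx) (sel-head sx) (sel-take k (sel-drop k sel-id)))
                (def-⇒ (Γ-def (sel-tail sx) (sel-head sy) (sel-take k sel-id))
                (def-sub (sel-++ (sel-++ (sel-take k (sel-drop k sel-id)) (sel-take k sel-id))
                                 (sel-++ (sel-take d (sel-drop d sce)) (sel-take d sce)))
                  QuotientBox-def)))))))))))))))))
          where
          sy : Sel (λ (u : Vec M (k + (k + (3 + (d + (d + (1 + (2 + r)))))))) → drop k (drop k u))
          sy = sel-drop k (sel-drop k sel-id)

          sce : Sel (λ (u : Vec M (k + (k + (3 + (d + (d + (1 + (2 + r)))))))) → tail (tail (tail (drop k (drop k u)))))
          sce = sel-tail (sel-tail (sel-tail sy))

          sx : Sel (λ (u : Vec M (k + (k + (3 + (d + (d + (1 + (2 + r)))))))) →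
              drop d (drop d (tail (tail (tail (drop k (drop k u)))))))
          sx = sel-drop d (sel-drop d sce)

        starts-def : Def Starts
        starts-def = def-∃ k (def-∧ (def-sub (sel-take k sel-id) Unit-def)
          (Γ-def (sel-drop k sel-id) (sel-head (sel-drop k sel-id)) (sel-take k sel-id)))

        describes-def : Def Describes
        describes-def = def-resp (λ v (o , t , c , f , l , s) → describes o t c f l s) (λ v (describes o t c f l s) →
            o , t , c , f , l , s)
          (def-∧ (def-< v₀ v₁)
            (def-∧ total-def (def-∧ coherent-def (def-∧ functional-def (def-∧ local-def starts-def)))))

      opaque
        -- The parameters of the path are quantified away, so only those of the four ambient sets
        -- remain. Therefore the sets `End` of all formulas are definable over common parameters.
        end-def : Def End
        end-def = def-∃ (2 + r) (def-∧ (def-sub (sel-take (2 + r) sel-id) describes-def)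
          (Γ-def (sel-take (2 + r) sel-id) (sel-head (sel-tail (sel-take (2 + r) sel-id))) (sel-drop (2 + r) sel-id)))

-- Division in groups

module Groups {L : Signature} (𝓜 : Structure L) (𝓖 : LocallyDefinableGroup 𝓜) where
  open LocallyDefinableGroup 𝓖 public hiding (k; embed; embed-injective; domain; graph; rawGroup)

  group : Group 0ℓ 0ℓ
  group = record { isGroup = isGroup }

  open Group group public using (assoc; identityˡ; identityʳ; inverseˡ; inverseʳ; _\\_)
  open GroupProperties group public using (⁻¹-involutive; ⁻¹-anti-homo-∙; ∙-cancelˡ; ∙-cancelʳ; ε⁻¹≈ε; inverseʳ-unique)

  ∙-\\ : ∀ x y → x ∙ (x \\ y) ≡ y
  ∙-\\ x y = trans (sym (assoc x (x ⁻¹) y)) (trans (cong (_∙ y) (inverseʳ x)) (identityˡ y))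

  \\-∙ : ∀ x y → x \\ (x ∙ y) ≡ y
  \\-∙ x y = trans (sym (assoc (x ⁻¹) x y)) (trans (cong (_∙ y) (inverseˡ x)) (identityˡ y))

  \\-unique : ∀ {x y z} → x ∙ y ≡ z → y ≡ x \\ z
  \\-unique {x} {y} eq = trans (sym (\\-∙ x y)) (cong (x \\_) eq)

  \\-chain : ∀ x y z → (x \\ y) ∙ (y \\ z) ≡ x \\ z
  \\-chain x y z = trans (assoc (x ⁻¹) y (y \\ z)) (cong (x ⁻¹ ∙_) (∙-\\ y z))

  \\-self : ∀ x → x \\ x ≡ ε
  \\-self = inverseˡ

  ε-\\ : ∀ x → ε \\ x ≡ x
  ε-\\ x = trans (cong (_∙ x) ε⁻¹≈ε) (identityˡ x)

  \\-⁻¹ : ∀ x y → (x \\ y) ⁻¹ ≡ y \\ x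
  \\-⁻¹ x y = trans (⁻¹-anti-homo-∙ (x ⁻¹) y) (cong (y ⁻¹ ∙_) (⁻¹-involutive x))

  ∙-\\-∙ : ∀ g x y → (g ∙ x) \\ (g ∙ y) ≡ x \\ y
  ∙-\\-∙ g x y = trans (cong (_∙ (g ∙ y)) (⁻¹-anti-homo-∙ g x))
    (trans (assoc (x ⁻¹) (g ⁻¹) (g ∙ y)) (cong (x ⁻¹ ∙_) (\\-∙ g y)))

  ∙-as-\\ : ∀ x y → (x \\ ε) \\ y ≡ x ∙ y
  ∙-as-\\ x y = cong (_∙ y) (trans (\\-⁻¹ x ε) (ε-\\ x))

-- Definable maps into a locally definable group

module Model (em : ∀ {ℓ} → ExcludedMiddle ℓ) {L : Signature} (𝓜 : Structure L) (κ : Set)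
  (oMinimal : IsOMinimal 𝓜) (ℕ≺κ : ℕ ≺ κ) (saturated : Saturated 𝓜 κ) where
  open Structure 𝓜 renaming (Carrier to M)
  open Classical em
  open Order 𝓜 oMinimal
  open Completeness em
  open Definability 𝓜
  open Over {P = M} id
  open Compactness em 𝓜 κ ℕ≺κ saturated

  sel-const : ∀ {m k} (c : Vec M k) → Sel {m} (λ _ → c)
  sel-const c = coordinates λ i → sel-param (lookup c i)

  def-Any : ∀ {J : Set} {n} {Y : J → Subset n} js → (∀ j → Def (Y j)) → Def (λ v → Any (λ j → Y j v) js)
  def-Any []       d = def-false λ v ()
  def-Any (j ∷ js) d = def-resp (λ v → [ here , there ]′) (λ { v (here h) → inj₁ h ; v (there h) → inj₂ h })
    (def-∨ (d j) (def-Any js d))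

  module _ (𝓖 : LocallyDefinableGroup 𝓜) where
    open Groups 𝓜 𝓖
    open LocallyDefinableGroup 𝓖 using (k; embed; embed-injective; domain; graph)

    record DefMap {n} (X : Subset n) (p : Vec M n → Carrier) : Set where
      constructor defMap
      field
        definable : DefinableOn 𝓜 id embed X p

  module _ {𝓖 : LocallyDefinableGroup 𝓜} where
    open Groups 𝓜 𝓖
    open LocallyDefinableGroup 𝓖 using (k; embed; embed-injective; domain; graph)
    open DefMap

    def-graph : ∀ {m n} {X : Subset n} {p : Vec M n → Carrier} {τ : Vec M m → Vec M n} {σ : Vec M m → Vec M k} →
      DefMap 𝓖 X p → Sel τ → Sel σ → Def (λ v → X (τ v) × embed (p (τ v)) ≡ σ v)
    def-graph {X = X} {p} {τ} {σ} d s t = def-resp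
      (λ { v (x , x∈X , eq) → from-graph v x x∈X (++-injective x (τ v) eq) })
      (λ { v (x∈X , eq) → τ v , x∈X , cong (τ v ++_) eq })
      (def-sub (sel-++ s t) (definable d))
      where
      from-graph : ∀ v x → X x → x ≡ τ v × embed (p x) ≡ σ v → X (τ v) × embed (p (τ v)) ≡ σ v
      from-graph v x x∈X (refl , eq) = x∈X , eq

    defMap-intro : ∀ {n} {X : Subset n} {p : Vec M n → Carrier} →
      Def {n + k} (λ v → X (take n v) × embed (p (take n v)) ≡ drop n v) → DefMap 𝓖 X p
    defMap-intro {n} {X} {p} d = defMap (def-resp
      (λ v (x , eq) → take n v , x , trans (cong (take n v ++_) eq) (take++drop≡id n v))
      (λ { v (x , x∈X , refl) → subst X (sym (take-++ x (embed (p x)))) x∈X ,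
          trans (cong (embed ∘ p) (take-++ x (embed (p x)))) (sym (drop-++ x (embed (p x)))) }) d)

    opaque
      domain-def : ∀ {n} {X : Subset n} {p : Vec M n → Carrier} → DefMap 𝓖 X p → Def X
      domain-def {X = X} {p} d = def-resp (λ { v (u , x , _) → x }) (λ v x → _ , x , refl)
        (def-∃ k {Q = λ v u → X v × embed (p v) ≡ u} (def-graph d (sel-drop k sel-id) (sel-take k sel-id)))

      defMap-cong : ∀ {n} {X : Subset n} {p q : Vec M n → Carrier} →
        (∀ x → X x → p x ≡ q x) → DefMap 𝓖 X p → DefMap 𝓖 X q
      defMap-cong {n} eq d = defMap-intro (def-resp
        (λ v (x , e) → x , trans (cong embed (sym (eq _ x))) e)
        (λ v (x , e) → x , trans (cong embed (eq _ x)) e)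
        (def-graph d (sel-take n sel-id) (sel-drop n sel-id)))

      defMap-sub : ∀ {m n} {X : Subset n} {p : Vec M n → Carrier} {Y : Subset m} {τ : Vec M m → Vec M n} →
        Sel τ → Def Y → (∀ y → Y y → X (τ y)) → DefMap 𝓖 X p → DefMap 𝓖 Y (p ∘ τ)
      defMap-sub {m} {τ = τ} s Y-def h d = defMap-intro (def-resp
        (λ v (y , x , e) → y , e) (λ v (y , e) → y , h _ y , e)
        (def-∧ (def-sub (sel-take m sel-id) Y-def) (def-graph d (sel-∘ s (sel-take m sel-id)) (sel-drop m sel-id))))

      defMap-⊆ : ∀ {n} {X Y : Subset n} {p : Vec M n → Carrier} →
        Def Y → (∀ y → Y y → X y) → DefMap 𝓖 X p → DefMap 𝓖 Y p
      defMap-⊆ = defMap-sub sel-id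

      defMap-∪ : ∀ {n} {X Y : Subset n} {p : Vec M n → Carrier} →
        DefMap 𝓖 X p → DefMap 𝓖 Y p → DefMap 𝓖 (λ v → X v ⊎ Y v) p
      defMap-∪ {n} d d′ = defMap-intro (def-resp
        (λ { v (inj₁ (x , e)) → inj₁ x , e ; v (inj₂ (y , e)) → inj₂ y , e })
        (λ { v (inj₁ x , e) → inj₁ (x , e) ; v (inj₂ y , e) → inj₂ (y , e) })
        (def-∨ (def-graph d (sel-take n sel-id) (sel-drop n sel-id)) (def-graph d′ (sel-take n sel-id) (sel-drop n sel-id))))

      defMap-const : ∀ {n} {X : Subset n} g → Def X → DefMap 𝓖 X (λ _ → g)
      defMap-const {n} g X-def = defMap-intro
        (def-∧ (def-sub (sel-take n sel-id) X-def) (def-≡ (sel-const (embed g)) (sel-drop n sel-id)))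

      defMap-∈ : ∀ {n} {X : Subset n} {p : Vec M n → Carrier} {D : Pred Carrier 0ℓ} →
        LocallyDefinableGroup.DefinableSubset 𝓖 D → DefMap 𝓖 X p → Def (λ x → X x × D (p x))
      defMap-∈ {X = X} {p} {D} D-def d = def-resp
        (λ { v (u , (x , e) , g , g∈D , e′) → x , subst D (embed-injective (trans e′ (sym e))) g∈D })
        (λ { v (x , g∈D) → _ , (x , refl) , _ , g∈D , refl })
        (def-∃ k {Q = λ v u → (X v × embed (p v) ≡ u) × Image embed D u}
          (def-∧ (def-graph d (sel-drop k sel-id) (sel-take k sel-id)) (def-sub (sel-take k sel-id) D-def)))

      defMap-≡ : ∀ {n} {X : Subset n} {p q : Vec M n → Carrier} →
        DefMap 𝓖 X p → DefMap 𝓖 X q → Def (λ x → X x × p x ≡ q x)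
      defMap-≡ {X = X} {p} {q} d d′ = def-resp
        (λ { v (u , (x , e) , (_ , e′)) → x , embed-injective (trans e (sym e′)) })
        (λ { v (x , e) → _ , (x , refl) , (x , cong embed (sym e)) })
        (def-∃ k {Q = λ v u → (X v × embed (p v) ≡ u) × (X v × embed (q v) ≡ u)}
          (def-∧ (def-graph d (sel-drop k sel-id) (sel-take k sel-id)) (def-graph d′ (sel-drop k sel-id) (sel-take k sel-id))))

      -- The graph of `p` is a projection of the graph of `q`. The witness `u` will be the last
      -- break point of a chain, or a factorization of a group element.
      defMap-descend : ∀ {n} j {X : Subset n} {p : Vec M n → Carrier}
        {T : Subset (j + n)} {q : Vec M (j + n) → Carrier} → DefMap 𝓖 T q →
        (∀ x → X x → ∃[ u ] T (u ++ x)) → (∀ x u → T (u ++ x) → X x × p x ≡ q (u ++ x)) → DefMap 𝓖 X p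
      defMap-descend {n} j {X} {p} {T} {q} d lifts descends = defMap-intro (def-resp
        (λ { v (u , t , e) → let x , e′ = descends _ u t in x , trans (cong embed e′) e })
        (λ { v (x , e) → let u , t = lifts _ x in u , t , trans (cong embed (sym (proj₂ (descends _ u t)))) e })
        (def-∃ j {Q = λ v u → T (u ++ take n v) × embed (q (u ++ take n v)) ≡ drop n v}
            (def-graph d (sel-++ (sel-take j sel-id) (sel-take n (sel-drop j sel-id))) (sel-drop n (sel-drop j sel-id)))))

      -- Each `Y i` lies in the graph over `X`, and together they exhaust it. Their projections
      -- cover `X`, so by compactness finitely many of them do, and the graph is the union of these
      -- finitely many pieces.
      defMap-countable : ∀ {n} {X : Subset n} {p : Vec M n → Carrier} {Y : ℕ → Subset (n + k)} →
        Def X → (∀ i → Def (Y i)) → (∀ x → X x → ∃[ i ] Y i (x ++ embed (p x))) →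
        (∀ i x z → X x → Y i (x ++ z) → embed (p x) ≡ z) → DefMap 𝓖 X p
      defMap-countable {n} {X} {p} {Y} X-def Y-def total functional = defMap-intro (def-resp
        (λ v (x , y) → x , sound v x y)
        (λ v (x , e) → x , Any.map (λ {j} (z , y) → subst (Y j) (trans (cong (take n v ++_)
             (trans (sym (functional j _ z x y)) e)) (take++drop≡id n v)) y) (proj₂ finite _ x))
        (def-∧ (def-sub (sel-take n sel-id) X-def) (def-Any (proj₁ finite) Y-def)))
        where
        finite : Σ[ js ∈ List ℕ ] (∀ x → X x → Any (λ j → Σ[ z ∈ Vec M k ] Y j (x ++ z)) js)
        finite = countable-compactness id↣ X-def
          (λ j → def-∃ k (def-sub (sel-++ (sel-drop k sel-id) (sel-take k sel-id)) (Y-def j)))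
          (λ x x∈X → let j , y = total x x∈X in j , _ , y)

        sound : ∀ {js} v → X (take n v) → Any (λ j → Y j v) js → embed (p (take n v)) ≡ drop n v
        sound v x (here {j} y)  = functional j _ _ x (subst (Y j) (sym (take++drop≡id n v)) y)
        sound v x (there y) = sound v x y

      -- The quotient is the solution z of p z = q, which the countable union `graph` describes when
      -- it is read backwards. Products are obtained from quotients afterwards, so that `graph` is
      -- taken apart only once.
      defMap-\\ : ∀ {n} {X : Subset n} {p q : Vec M n → Carrier} →
        DefMap 𝓖 X p → DefMap 𝓖 X q → DefMap 𝓖 X (λ x → p x \\ q x)
      defMap-\\ {n} {X} {p} {q} d d′ = defMap-countable {Y = Y} (domain-def d) Y-def total functional
        where
        piece : ℕ → Subset (k + (k + k))
        piece = proj₁ graph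

        piece-def : ∀ i → Def (piece i)
        piece-def = proj₁ (proj₂ graph)

        Y : ℕ → Subset (n + k)
        Y i v = ∃[ u ] ∃[ w ] (X (take n v) × embed (p (take n v)) ≡ u) ×
          (X (take n v) × embed (q (take n v)) ≡ w) × piece i (u ++ drop n v ++ w)

        Y-def : ∀ i → Def (Y i)
        Y-def i = def-∃ k (def-∃ k (def-∧
          (def-graph d (sel-take n (sel-drop k (sel-drop k sel-id))) (sel-take k (sel-drop k sel-id)))
          (def-∧ (def-graph d′ (sel-take n (sel-drop k (sel-drop k sel-id))) (sel-take k sel-id))
            (def-sub (sel-++ (sel-take k (sel-drop k sel-id)) (sel-++ (sel-drop n (sel-drop k (sel-drop k sel-id)))
                (sel-take k sel-id)))
              (piece-def i)))))

        total : ∀ x → X x → ∃[ i ] Y i (x ++ embed (p x \\ q x))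
        total x x∈X = relabel (proj₁ (proj₂ (proj₂ graph)) ((p x , p x \\ q x) , tt , refl))
          where
          relabel : (∃[ i ] piece i (embed (p x) ++ embed (p x \\ q x) ++ embed (p x ∙ (p x \\ q x)))) →
            ∃[ i ] Y i (x ++ embed (p x \\ q x))
          relabel (i , h) rewrite take-++ x (embed (p x \\ q x)) | drop-++ x (embed (p x \\ q x)) | ∙-\\ (p x) (q x) =
            i , _ , _ , (x∈X , refl) , (x∈X , refl) , h

        functional : ∀ i x z → X x → Y i (x ++ z) → embed (p x \\ q x) ≡ z
        functional i x z x∈X h rewrite take-++ x z | drop-++ x z
          with _ , _ , (_ , refl) , (_ , refl) , piece-i ← h
          with (g , h) , _ , eq ← proj₂ (proj₂ (proj₂ graph)) (i , piece-i)
          with eq₁ , eq′ ← ++-injective (embed g) _ eq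
          with eq₂ , eq₃ ← ++-injective (embed h) z eq′ =
          trans (cong embed (sym (\\-unique (trans (cong (_∙ h) (sym (embed-injective eq₁))) (embed-injective eq₃))))) eq₂

      defMap-∙ : ∀ {n} {X : Subset n} {p q : Vec M n → Carrier} →
        DefMap 𝓖 X p → DefMap 𝓖 X q → DefMap 𝓖 X (λ x → p x ∙ q x)
      defMap-∙ d d′ = defMap-cong (λ x _ → ∙-as-\\ _ _)
        (defMap-\\ (defMap-\\ d (defMap-const ε (domain-def d))) d′)

    -- The value is ε off the image of embed.
    point-at : Vec M k → Carrier
    point-at z with em {P = ∃[ g ] embed g ≡ z}
    ... | yes (g , _) = g
    ... | no _        = ε

    point-at-embed : ∀ g → point-at (embed g) ≡ g
    point-at-embed g with em {P = ∃[ h ] embed h ≡ embed g}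
    ... | yes (h , eq) = embed-injective eq
    ... | no none      = contradiction (g , refl) none

    opaque
      defMap-point-at : ∀ {X : Pred Carrier 0ℓ} → LocallyDefinableGroup.DefinableSubset 𝓖 X →
        DefMap 𝓖 (Image embed X) point-at
      defMap-point-at X-def = defMap-intro (def-resp
        (λ { v ((g , g∈X , e) , e′) → (g , g∈X , e) , trans (cong (embed ∘ point-at) (sym e))
            (trans (cong embed (point-at-embed g)) (trans e e′)) })
        (λ { v ((g , g∈X , e) , e′) → (g , g∈X , e) , trans (sym e) (trans (cong embed (sym (point-at-embed g)))
            (trans (cong (embed ∘ point-at) e) e′)) })
        (def-∧ (def-sub (sel-take k sel-id) X-def) (def-≡ (sel-take k sel-id) (sel-drop k sel-id))))

  module _ {𝓖 𝓖′ : LocallyDefinableGroup 𝓜} where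
    private
      module G  = LocallyDefinableGroup 𝓖
      module G′ = LocallyDefinableGroup 𝓖′

    opaque
      defMap-∘ : ∀ {n} {X : Subset n} {p : Vec M n → G.Carrier} {D : Pred G.Carrier 0ℓ} {f : G.Carrier → G′.Carrier} →
        IsDefinableMapOn 𝓜 𝓖 𝓖′ D f → DefMap 𝓖 X p → (∀ x → X x → D (p x)) → DefMap 𝓖′ X (f ∘ p)
      defMap-∘ {n} {X} {p} {D} {f} f-def d p∈D = defMap-intro (def-resp
        (λ { v (u , (x , refl) , g , _ , e) → let e₁ , e₂ = ++-injective (G.embed g) _ e in
               x , trans (cong (G′.embed ∘ f) (sym (G.embed-injective e₁))) e₂ })
        (λ { v (x , e) → _ , (x , refl) , _ , p∈D _ x , cong (G.embed (p (take n v)) ++_) e })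
        (def-∃ G.k {Q = λ v u → (X (take n v) × G.embed (p (take n v)) ≡ u) ×
             Image (λ x → G.embed x ++ G′.embed (f x)) D (u ++ drop n v)}
                 (def-∧ (def-graph d (sel-take n (sel-drop G.k sel-id)) (sel-take G.k sel-id))
          (def-sub (sel-++ (sel-take G.k sel-id) (sel-drop n (sel-drop G.k sel-id))) f-def))))

      definableMapOn : ∀ {X : Pred G.Carrier 0ℓ} {f : G.Carrier → G′.Carrier} →
        DefMap 𝓖′ (Image G.embed X) (f ∘ point-at {𝓖}) → IsDefinableMapOn 𝓜 𝓖 𝓖′ X f
      definableMapOn {X} {f} d = def-resp
        (λ { v (z , (g , g∈X , refl) , e) → g , g∈X , trans (cong (λ h → G.embed g ++ G′.embed (f h)) (sym (point-at-embed g))) e })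
        (λ { v (g , g∈X , e) → G.embed g , (g , g∈X , refl) , trans (cong (λ h → G.embed g ++ G′.embed (f h)) (point-at-embed g)) e })
        (DefMap.definable d)

  -- Continuity and the chart at the identity

  module Topological (𝓖 : LocallyDefinableGroup 𝓜) (τ : TauTopology 𝓜 𝓖) where
    open Groups 𝓜 𝓖
    open LocallyDefinableGroup 𝓖 using (k; embed; embed-injective)
    open TauTopology τ using (Open; resp-≐; meet; union; Neighbourhood; RelativelyOpen; ∙-continuous; ⁻¹-continuous; chart)

    record Continuous {n} (A : Subset n) (F : Vec M n → Carrier) : Set₁ where
      constructor continuous
      field
        continuousAt : ∀ p → A p → ∀ O → Open O → O (F p) → Near p (λ q → A q → O (F q))

    open Continuous public

    fromContinuousOn : ∀ {n} {A : Subset n} {F : Vec M n → Carrier} →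
      ContinuousOn (OpenInMⁿ 𝓜) Open A F → Continuous A F
    fromContinuousOn h = continuous λ p p∈A O O-open Fp∈O →
      let W , W-open , p∈W , k = h p p∈A O O-open Fp∈O
          a , b , p∈ab , ab⊆W = W-open p p∈W
      in box a b p∈ab λ q q∈ab q∈A → k q q∈A (ab⊆W q∈ab)

    toContinuousOn : ∀ {n} {A : Subset n} {F : Vec M n → Carrier} →
      Continuous A F → ContinuousOn (OpenInMⁿ 𝓜) Open A F
    toContinuousOn c p p∈A O O-open Fp∈O with box a b p∈ab h ← continuousAt c p p∈A O O-open Fp∈O =
      OpenBox 𝓜 a b , (λ x x∈ab → a , b , x∈ab , id) , p∈ab , λ q q∈A q∈ab → h q q∈ab q∈A

    continuous-cong : ∀ {n} {A : Subset n} {F H : Vec M n → Carrier} →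
      (∀ x → A x → F x ≡ H x) → Continuous A F → Continuous A H
    continuous-cong eq c = continuous λ p p∈A O O-open Hp∈O →
      near-map (λ q h q∈A → subst O (eq q q∈A) (h q∈A))
        (continuousAt c p p∈A O O-open (subst O (sym (eq p p∈A)) Hp∈O))

    -- Continuity of `σ` is given as the ability to pull back neighbourhoods. This covers clamping
    -- to an interval, which is not a selection of coordinates.
    continuous-∘ : ∀ {m n} {A : Subset n} {F : Vec M n → Carrier} {B : Subset m} {σ : Vec M m → Vec M n} →
      (∀ p {Q : Subset n} → Near (σ p) Q → Near p (Q ∘ σ)) → (∀ y → B y → A (σ y)) →
      Continuous A F → Continuous B (F ∘ σ)
    continuous-∘ near σ∈A c = continuous λ p p∈B O O-open h →
      near-map (λ q k q∈B → k (σ∈A q q∈B)) (near p (continuousAt c _ (σ∈A p p∈B) O O-open h))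

    continuous-sub : ∀ {m n} {A : Subset n} {F : Vec M n → Carrier} {B : Subset m} {σ : Vec M m → Vec M n} →
      Sel σ → (∀ y → B y → A (σ y)) → Continuous A F → Continuous B (F ∘ σ)
    continuous-sub s = continuous-∘ λ p → near-sel s

    continuous-const : ∀ {n} {A : Subset n} g → Continuous A (λ _ → g)
    continuous-const g = continuous λ p p∈A O O-open g∈O → near-all λ q _ → g∈O

    continuous-∙ : ∀ {n} {A : Subset n} {F H : Vec M n → Carrier} →
      Continuous A F → Continuous A H → Continuous A (λ x → F x ∙ H x)
    continuous-∙ {F = F} {H} c d = continuous λ p p∈A O O-open h →
      let V , W , V-open , W-open , v , w , VW⊆O = ∙-continuous (F p) (H p) O O-open h
      in near-map (λ q (k , k′) q∈A → VW⊆O _ _ (k q∈A) (k′ q∈A))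
           (near-∧ (continuousAt c p p∈A V V-open v) (continuousAt d p p∈A W W-open w))

    continuous-⁻¹ : ∀ {n} {A : Subset n} {F : Vec M n → Carrier} →
      Continuous A F → Continuous A (λ x → F x ⁻¹)
    continuous-⁻¹ {F = F} c = continuous λ p p∈A O O-open h →
      let W , W-open , w , k = ⁻¹-continuous (F p) tt O O-open h
      in near-map (λ q l q∈A → k (F q) tt (l q∈A)) (continuousAt c p p∈A W W-open w)

    continuous-\\ : ∀ {n} {A : Subset n} {F H : Vec M n → Carrier} →
      Continuous A F → Continuous A H → Continuous A (λ x → F x \\ H x)
    continuous-\\ c d = continuous-∙ (continuous-⁻¹ c) d

    -- Continuity of multiplication at (g,x) gives an open set around x that g maps into `O`; the
    -- translate is the union of these sets over all its points x.
    translate-open : ∀ {O} g → Open O → Open (λ x → O (g ∙ x))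
    translate-open {O} g O-open = resp-≐ ((λ { (x , w) → slice-⊆ _ w }) , (λ {x} x∈ → (x , x∈) , slice-∋ x x∈))
      (union (λ ((x , x∈) : Σ Carrier (λ x → O (g ∙ x))) → slice x x∈) (λ (x , x∈) → slice-open x x∈))
      where
      slice : ∀ x → O (g ∙ x) → Pred Carrier 0ℓ
      slice x x∈ = proj₁ (proj₂ (∙-continuous g x O O-open x∈))

      slice-open : ∀ x x∈ → Open (slice x x∈)
      slice-open x x∈ = let _ , _ , _ , W-open , _ = ∙-continuous g x O O-open x∈ in W-open

      slice-∋ : ∀ x x∈ → slice x x∈ x
      slice-∋ x x∈ = let _ , _ , _ , _ , _ , w , _ = ∙-continuous g x O O-open x∈ in w

      slice-⊆ : ∀ {y} ((x , x∈) : Σ Carrier (λ x → O (g ∙ x))) → slice x x∈ y → O (g ∙ y)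
      slice-⊆ (x , x∈) y∈ = let _ , _ , _ , _ , v , _ , VW⊆O = ∙-continuous g x O O-open x∈ in VW⊆O g _ v y∈

    divisionNeighbourhood : ∀ {N} → Neighbourhood ε N →
      Σ[ O ∈ Pred Carrier 0ℓ ] Open O × O ε × (∀ x y → O x → O y → N (x \\ y))
    divisionNeighbourhood {N} (O , O-open , ε∈O , O⊆N) =
      let V , W , V-open , W-open , v , w , VW⊆O = ∙-continuous (ε ⁻¹) ε O O-open (subst O (sym (\\-self ε)) ε∈O)
          V′ , V′-open , v′ , k = ⁻¹-continuous ε tt V V-open v
      in (λ x → V′ x × W x) , meet V′-open W-open , (v′ , w) ,
         λ x y (x∈V′ , _) (_ , y∈W) → O⊆N (VW⊆O _ _ (k x tt x∈V′) y∈W)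

    continuous-near : ∀ {n} {A : Subset n} {F : Vec M n → Carrier} {O} → Continuous A F →
      ∀ p → A p → Open O → O ε → Near p (λ q → A q → O (F p \\ F q))
    continuous-near {F = F} {O} c p p∈A O-open ε∈O = continuousAt c p p∈A (λ x → O (F p \\ x))
      (translate-open (F p ⁻¹) O-open) (subst O (sym (\\-self (F p))) ε∈O)

    -- The quotient of F(q) and F(r) equals the quotient of F(p)⁻¹ F(q) and F(p)⁻¹ F(r), both of
    -- which are near ε.
    continuous-pairs : ∀ {n} {A : Subset n} {F : Vec M n → Carrier} {N} → Continuous A F →
      ∀ p → A p → Neighbourhood ε N → Σ[ B ∈ Subset n ] Near p B ×
        (∀ q r → A q → A r → B q → B r → N (F q \\ F r))
    continuous-pairs {A = A} {F} {N} c p p∈A N-nbhd =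
      let O , O-open , ε∈O , h = divisionNeighbourhood N-nbhd
      in (λ q → A q → O (F p \\ F q)) , continuous-near c p p∈A O-open ε∈O ,
         λ q r q∈A r∈A q∈O r∈O → subst N (∙-\\-∙ (F p ⁻¹) (F q) (F r)) (h _ _ (q∈O q∈A) (r∈O r∈A))

    Segment : M → M → Subset 1
    Segment a b v = a ≤ head v × head v ≤ b

    Rectangle : M → M → M → M → Subset 2
    Rectangle a b c d v = (a ≤ head v × head v ≤ b) × Segment c d (tail v)

    segment-def : ∀ {a b} → Def (Segment a b)
    segment-def {a} {b} = def-∧ (def-≤ (sel-param a) v₀) (def-≤ v₀ (sel-param b))

    rectangle-def : ∀ {a b c d} → Def (Rectangle a b c d)
    rectangle-def {a} {b} = def-∧ (def-∧ (def-≤ (sel-param a) v₀) (def-≤ v₀ (sel-param b)))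
      (def-sub (sel-tail sel-id) segment-def)

    segment⇔box : ∀ {a b} v → (Segment a b v → ClosedBox 𝓜 (a ∷ []) (b ∷ []) v) × (ClosedBox 𝓜 (a ∷ []) (b ∷ []) v → Segment a b v)
    segment⇔box (x ∷ []) = (λ { h zero → h }) , (λ h → h zero)

    rectangle⇔box : ∀ {a b c d} v → (Rectangle a b c d v → ClosedBox 𝓜 (a ∷ c ∷ []) (b ∷ d ∷ []) v) ×
      (ClosedBox 𝓜 (a ∷ c ∷ []) (b ∷ d ∷ []) v → Rectangle a b c d v)
    rectangle⇔box (x ∷ y ∷ []) = (λ { (h , k) zero → h ; (h , k) (suc zero) → k }) , (λ h → h zero , h (suc zero))

    record Path (a b : M) (γ : M → Carrier) : Set₁ where
      constructor path
      field
        a<b        : a < b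
        γ-def      : DefMap 𝓖 (Segment a b) (γ ∘ head)
        γ-cont     : Continuous (Segment a b) (γ ∘ head)

    fromIsPath : ∀ {a b γ} → IsPath 𝓜 𝓖 τ a b γ → Path a b γ
    fromIsPath {a} {b} {γ} p = path (IsPath.a<b p)
      (defMap-cong {q = γ ∘ head} (λ { (x ∷ []) _ → refl }) (defMap-⊆ segment-def (λ v → proj₁ (segment⇔box v))
        (defMap (IsDefinableContinuousOnBox.definable (IsPath.regular p)))))
      (continuous-cong {H = γ ∘ head} (λ { (x ∷ []) _ → refl }) (continuous-sub sel-id (λ v → proj₁ (segment⇔box v))
        (fromContinuousOn (IsDefinableContinuousOnBox.continuous (IsPath.regular p)))))

    toIsPath : ∀ {a b γ} → Path a b γ → IsPath 𝓜 𝓖 τ a b γ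
    toIsPath {a} {b} {γ} (path a<b d c) = record
      { a<b = a<b
      ; regular = record
        { definable = DefMap.definable (defMap-cong {q = λ v → γ (lookup v zero)} (λ { (x ∷ []) _ → refl })
            (defMap-⊆ box-def (λ v → proj₂ (segment⇔box v)) d))
        ; continuous = toContinuousOn (continuous-cong {H = λ v → γ (lookup v zero)} (λ { (x ∷ []) _ → refl })
            (continuous-sub sel-id (λ v → proj₂ (segment⇔box v)) c))
        }
      }
      where
      box-def : Def (ClosedBox 𝓜 (a ∷ []) (b ∷ []))
      box-def = def-ClosedBox (sel-const (a ∷ [])) (sel-const (b ∷ [])) sel-id

    dim : ℕ
    dim = TauTopology.n τ

    N : Pred Carrier 0ℓ
    N = proj₁ (chart ε)

    N-nbhd : Neighbourhood ε N
    N-nbhd = proj₁ (proj₂ (proj₂ (chart ε)))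

    φ : Carrier → Vec M dim
    φ = let _ , _ , _ , φ , _ = chart ε in φ

    ψ : Vec M dim → Carrier
    ψ = let _ , _ , _ , _ , ψ , _ = chart ε in ψ

    φ-def : DefinableOn 𝓜 embed id N φ
    φ-def = let _ , _ , _ , _ , _ , d , _ = chart ε in d

    ψ∈N : ∀ v → N (ψ v)
    ψ∈N = let _ , _ , _ , _ , _ , _ , h , _ = chart ε in h

    φ-ψ : ∀ v → φ (ψ v) ≡ v
    φ-ψ = let _ , _ , _ , _ , _ , _ , _ , h , _ = chart ε in h

    ψ-φ : ∀ g → N g → ψ (φ g) ≡ g
    ψ-φ = let _ , _ , _ , _ , _ , _ , _ , _ , h , _ = chart ε in h

    ε∈N : N ε
    ε∈N = let O , _ , ε∈O , O⊆N = N-nbhd in O⊆N ε∈O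

    ψ-φε : ψ (φ ε) ≡ ε
    ψ-φε = ψ-φ ε ε∈N

    ψ-def : DefMap 𝓖 (λ _ → ⊤) ψ
    ψ-def = defMap-intro (def-resp
      (λ v (g , g∈N , e) → tt , let e₁ , e₂ = ++-injective (embed g) (drop dim v) e in
         trans (cong (embed ∘ ψ) (sym e₂)) (trans (cong embed (ψ-φ g g∈N)) e₁))
      (λ v (_ , e) → ψ (take dim v) , ψ∈N _ , cong₂ _++_ e (φ-ψ _))
      (def-sub (sel-++ (sel-drop dim sel-id) (sel-take dim sel-id)) φ-def))

    ψ-cont : Continuous (λ _ → ⊤) ψ
    ψ-cont = fromContinuousOn (let _ , _ , _ , _ , _ , _ , _ , _ , _ , _ , c = chart ε in c)

    -- A definable neighbourhood basis of ε, indexed by tuples of elements of M. It makes continuity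
    -- expressible by a formula; at other points, translates of these boxes serve.
    BoxAt : Vec M dim → Vec M dim → Pred Carrier 0ℓ
    BoxAt c e g = N g × OpenBox 𝓜 c e (φ g)

    boxAt-nbhd : ∀ {c e} → OpenBox 𝓜 c e (φ ε) → Neighbourhood ε (BoxAt c e)
    boxAt-nbhd {c} {e} ε∈ =
      let _ , _ , _ , _ , _ , _ , _ , _ , _ , φ-cont , _ = chart ε
          O , O-open , ε∈O , O⊆N = N-nbhd
          W , W-open , ε∈W , h = φ-cont ε ε∈N (OpenBox 𝓜 c e) (λ x x∈ → c , e , x∈ , id) ε∈
      in (λ g → O g × W g) , meet O-open W-open , (ε∈O , ε∈W) , λ (o , w) → O⊆N o , h _ (O⊆N o) w

    opaque
      boxAt-basis : ∀ {O} → Open O → O ε → ∃[ c ] ∃[ e ] OpenBox 𝓜 c e (φ ε) × (∀ v → OpenBox 𝓜 c e v → O (ψ v))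
      boxAt-basis {O} O-open ε∈O =
        let box c e centre inside = continuousAt ψ-cont (φ ε) tt O O-open (subst O (sym ψ-φε) ε∈O)
        in c , e , centre , λ v v∈ → inside v v∈ tt

    -- The corners vary with the point because the formula for continuity quantifies over boxes.
    boxAt-def : ∀ {n} {X : Subset n} {p : Vec M n → Carrier} {c e : Vec M n → Vec M dim} →
      Sel c → Sel e → DefMap 𝓖 X p → Def (λ x → X x × BoxAt (c x) (e x) (p x))
    boxAt-def {X = X} {p} {c} {e} c-sel e-sel d = def-resp
      (λ { v (u , w , (x , eq) , (g , g∈N , eq′) , w∈) →
        let e₁ , e₂ = ++-injective (embed g) u eq′
            g≡p = embed-injective (trans e₁ (sym eq))
        in x , subst N g≡p g∈N , subst (OpenBox 𝓜 (c v) (e v)) (trans (sym e₂) (cong φ g≡p)) w∈ })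
      (λ { v (x , p∈N , p∈) → _ , _ , (x , refl) , (p v , p∈N , refl) , p∈ })
      (def-∃ k {Q = λ v u → ∃[ w ] (X v × embed (p v) ≡ u) × Image (λ g → embed g ++ φ g) N (u ++ w) × OpenBox 𝓜 (c v) (e v) w}
      (def-∃ dim {Q = λ v w → (X (drop k v) × embed (p (drop k v)) ≡ take k v) × Image (λ g → embed g ++ φ g) N (take k v ++ w) ×
                              OpenBox 𝓜 (c (drop k v)) (e (drop k v)) w}
      (def-∧ (def-graph d (sel-drop k (sel-drop dim sel-id)) (sel-take k (sel-drop dim sel-id)))
      (def-∧ (def-sub (sel-++ (sel-take k (sel-drop dim sel-id)) (sel-take dim sel-id)) φ-def)
        (def-OpenBox (sel-∘ c-sel (sel-drop k (sel-drop dim sel-id))) (sel-∘ e-sel (sel-drop k (sel-drop dim sel-id)))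
            (sel-take dim sel-id))))))

    -- Chains of pieces with quotients in U

    module Local (U : Pred Carrier 0ℓ) (U-def : LocallyDefinableGroup.DefinableSubset 𝓖 U) (U-nbhd : Neighbourhood ε U) where

      ε∈U : U ε
      ε∈U = let O , _ , ε∈O , O⊆U = U-nbhd in O⊆U ε∈O

      \\-self∈U : ∀ x → U (x \\ x)
      \\-self∈U x = subst U (sym (\\-self x)) ε∈U

      module Chains (a b : M) (γ : M → Carrier) where

        Good : M → M → Set
        Good s t = a ≤ s × s ≤ t × t ≤ b × (∀ x y → s ≤ x → x ≤ t → s ≤ y → y ≤ t → U (γ x \\ γ y))

        -- Pieces may be degenerate, so n is only an upper bound for the length: a chain can be
        -- padded, and the points reachable by n pieces increase with n.
        Chain : ℕ → M → M → Set
        Chain zero    s t = a ≤ s × s ≤ b × s ≡ t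
        Chain (suc n) s t = ∃[ r ] Chain n s r × Good r t

        good-refl : ∀ {s} → a ≤ s → s ≤ b → Good s s
        good-refl a≤s s≤b = a≤s , ≤-refl , s≤b , λ x y s≤x x≤s s≤y y≤s →
          subst (λ z → U (γ x \\ γ z)) (trans (≤-antisym x≤s s≤x) (≤-antisym s≤y y≤s)) (\\-self∈U (γ x))

        good-shrink : ∀ {s t s′ t′} → s ≤ s′ → s′ ≤ t′ → t′ ≤ t → Good s t → Good s′ t′
        good-shrink s≤s′ s′≤t′ t′≤t (a≤s , _ , t≤b , h) = ≤-trans a≤s s≤s′ , s′≤t′ , ≤-trans t′≤t t≤b ,
          λ x y p q p′ q′ → h x y (≤-trans s≤s′ p) (≤-trans q t′≤t) (≤-trans s≤s′ p′) (≤-trans q′ t′≤t)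

        good-∈ : ∀ {s t} → Good s t → U (γ s \\ γ t)
        good-∈ (_ , s≤t , _ , h) = h _ _ ≤-refl s≤t s≤t ≤-refl

        chain-bounds : ∀ n {s t} → Chain n s t → a ≤ s × s ≤ t × t ≤ b
        chain-bounds zero    (a≤s , s≤b , refl) = a≤s , ≤-refl , s≤b
        chain-bounds (suc n) (r , c , _ , r≤t , t≤b , _) with a≤s , s≤r , _ ← chain-bounds n c = a≤s , ≤-trans s≤r r≤t , t≤b

        chain-suc : ∀ n {s t} → Chain n s t → Chain (suc n) s t
        chain-suc n c with a≤s , s≤t , t≤b ← chain-bounds n c = _ , c , good-refl (≤-trans a≤s s≤t) t≤b

        chain-refl : ∀ n {s} → a ≤ s → s ≤ b → Chain n s s
        chain-refl zero    p q = p , q , refl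
        chain-refl (suc n) p q = chain-suc n (chain-refl n p q)

        chain-trans : ∀ m n {s r t} → Chain m s r → Chain n r t → Chain (n + m) s t
        chain-trans m zero    c (_ , _ , refl) = c
        chain-trans m (suc n) c (r , d , g)    = r , chain-trans m n c d , g

        good⇒chain : ∀ {s t} → Good s t → Chain 1 s t
        good⇒chain g@(a≤s , s≤t , t≤b , _) = _ , chain-refl 0 a≤s (≤-trans s≤t t≤b) , g

        -- Restriction does not lengthen a chain. By induction on the last piece: it is dropped if
        -- it begins beyond t′, cut at t′ if it begins inside, and it alone suffices if it begins
        -- before s′.
        chain-shrink : ∀ n {s t s′ t′} → s ≤ s′ → s′ ≤ t′ → t′ ≤ t → Chain n s t → Chain n s′ t′
        chain-shrink zero s≤s′ s′≤t′ t′≤t (a≤s , s≤b , refl) =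
          ≤-trans a≤s s≤s′ , ≤-trans s′≤t′ (≤-trans t′≤t s≤b) , ≤-antisym s′≤t′ (≤-trans t′≤t s≤s′)
        chain-shrink (suc n) {s′ = s′} {t′} s≤s′ s′≤t′ t′≤t (r , c , g) with <-≤-connex r t′ | <-≤-connex r s′
        ... | inj₂ t′≤r | _ = chain-suc n (chain-shrink n s≤s′ s′≤t′ t′≤r c)
        ... | inj₁ r<t′ | inj₂ s′≤r = r , chain-shrink n s≤s′ s′≤r ≤-refl c , good-shrink ≤-refl (<⇒≤ r<t′) t′≤t g
        ... | inj₁ r<t′ | inj₁ r<s′ with g′@(a≤s′ , _ , t′≤b , _) ← good-shrink (<⇒≤ r<s′) s′≤t′ t′≤t g =
          s′ , chain-refl n a≤s′ (≤-trans s′≤t′ t′≤b) , g′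

        good-near : Continuous (Segment a b) (γ ∘ head) → ∀ {p} → a ≤ p → p ≤ b →
          Σ[ B ∈ Subset 1 ] Near (p ∷ []) B ×
            (∀ x y → a ≤ x → x ≤ y → y ≤ b → B (x ∷ []) → B (y ∷ []) → Good x y)
        good-near c {p} a≤p p≤b =
          let B , near , h = continuous-pairs c (p ∷ []) (a≤p , p≤b) U-nbhd
              l , r , l<p , p<r , k = near-interval near
          in (λ v → l < head v × head v < r) , interval-near l<p p<r (λ y l<y y<r → l<y , y<r) ,
             λ x y a≤x x≤y y≤b (l<x , x<r) (l<y , y<r) → a≤x , x≤y , y≤b , λ z w x≤z z≤y x≤w w≤y →
               h (z ∷ []) (w ∷ []) (≤-trans a≤x x≤z , ≤-trans z≤y y≤b) (≤-trans a≤x x≤w , ≤-trans w≤y y≤b)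
                 (k z (<-≤-trans l<x x≤z) (≤-<-trans z≤y y<r)) (k w (<-≤-trans l<x x≤w) (≤-<-trans w≤y y<r))

      -- `F` is a family of paths indexed by `w` in `T`. A single path is the case j = 0, and the
      -- rows of a rectangle are the case j = 1; definability is joint in `w` and the ends of the
      -- chain.
      module FamilyDefinability {j} {T : Subset j} {F : Vec M (suc j) → Carrier} {a b : M}
        (T-def : Def T) (F-def : DefMap 𝓖 (λ v → (a ≤ head v × head v ≤ b) × T (tail v)) F) where
        open module ChainsAt (w : Vec M j) = Chains a b (λ x → F (x ∷ w)) using (Good; Chain)

        private
          Related : Subset (suc (suc j))
          Related v = (((a ≤ head (tail v) × head (tail v) ≤ b) × T (tail (tail v))) ×
                       ((a ≤ head v × head v ≤ b) × T (tail (tail v)))) ×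
                      U (F (tail v) \\ F (head v ∷ tail (tail v)))

          related-def : Def Related
          related-def = defMap-∈ U-def (defMap-\\
            (defMap-⊆ both-def (λ _ → proj₁)
                (defMap-sub (sel-tail sel-id) (def-sub (sel-tail sel-id) (domain-def F-def)) (λ _ → id) F-def))
            (defMap-⊆ both-def (λ _ → proj₂) (defMap-sub (sel-∷ v₀ (sel-tail (sel-tail sel-id)))
              (def-sub (sel-∷ v₀ (sel-tail (sel-tail sel-id))) (domain-def F-def)) (λ _ → id) F-def)))
            where
            both-def : Def (λ (v : Vec M (suc (suc j))) → ((a ≤ head (tail v) × head (tail v) ≤ b) × T (tail (tail v))) ×
                                       ((a ≤ head v × head v ≤ b) × T (tail (tail v))))
            both-def = def-∧ (def-sub (sel-tail sel-id) (domain-def F-def))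
              (def-sub (sel-∷ v₀ (sel-tail (sel-tail sel-id))) (domain-def F-def))

        opaque
          good-def : Def {suc (suc j)} (λ v → T (tail (tail v)) × Good (tail (tail v)) (head v) (head (tail v)))
          good-def = def-resp
            (λ v (t , a≤s , s≤u , u≤b , h) → t , a≤s , s≤u , u≤b , λ x y p q p′ q′ → proj₂ (h x y p q p′ q′))
            (λ v (t , a≤s , s≤u , u≤b , h) → t , a≤s , s≤u , u≤b , λ x y p q p′ q′ →
              (((≤-trans a≤s p , ≤-trans q u≤b) , t) , ((≤-trans a≤s p′ , ≤-trans q′ u≤b) , t)) , h x y p q p′ q′)
            (def-∧ (def-sub (sel-tail (sel-tail sel-id)) T-def)
              (def-∧ (def-≤ (sel-param a) v₀)
              (def-∧ (def-≤ v₀ v₁)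
              (def-∧ (def-≤ v₁ (sel-param b))
              (def-∀₁ {Q = λ v x → ∀ y → head v ≤ x → x ≤ head (tail v) → head v ≤ y → y ≤ head (tail v) →
                  Related (y ∷ x ∷ tail (tail v))}
                (def-∀₁ {Q = λ v y → head (tail v) ≤ head v → head v ≤ head (tail (tail v)) → head (tail v) ≤ y →
                    y ≤ head (tail (tail v)) →
                                     Related (y ∷ head v ∷ tail (tail (tail v)))}
                (def-⇒ (def-≤ v₂ v₁)
                (def-⇒ (def-≤ v₁ v₃)
                (def-⇒ (def-≤ v₂ v₀)
                (def-⇒ (def-≤ v₀ v₃)
                (def-sub (sel-∷ v₀ (sel-∷ v₁ (sel-tail (sel-tail (sel-tail (sel-tail sel-id))))))
                  related-def)))))))))))

          chain-def : ∀ n → Def {suc (suc j)} (λ v → T (tail (tail v)) × Chain (tail (tail v)) n (head v) (head (tail v)))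
          chain-def zero = def-∧ (def-sub (sel-tail (sel-tail sel-id)) T-def)
            (def-∧ (def-≤ (sel-param a) v₀) (def-∧ (def-≤ v₀ (sel-param b))
              (def-≡₁ v₀ v₁)))
          chain-def (suc n) = def-resp
            (λ v (r , (t , c) , (_ , g)) → t , r , c , g) (λ v (t , r , c , g) → r , (t , c) , (t , g))
            (def-∃₁ {Q = λ v r → (T (tail (tail v)) × Chain (tail (tail v)) n (head v) r) ×
                (T (tail (tail v)) × Good (tail (tail v)) r (head (tail v)))}
              (def-∧ (def-sub (sel-∷ v₁ (sel-∷ v₀ (sel-tail (sel-tail (sel-tail sel-id))))) (chain-def n))
                     (def-sub (sel-∷ v₀ (sel-tail (sel-tail sel-id))) good-def)))

      -- Every path is a finite chain

      module Covering {I : Set} (V : Pred Carrier 0ℓ) (V-def : LocallyDefinableGroup.DefinableSubset 𝓖 V)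
        (V⁻¹V⊆U : ∀ v w → V v → V w → U (v \\ w)) (I≺κ : I ≺ κ) (g : I → Carrier)
        (cover : ∀ x → ∃[ i ] V (g i \\ x)) {a b : M} {γ : M → Carrier} (γ-path : Path a b γ) where
        open Path γ-path
        open Chains a b γ
        private
          chain-definable : ∀ n → Def {2} (λ v → Chain n (head v) (head (tail v)))
          chain-definable n = def-resp (λ { (x ∷ y ∷ []) → proj₂ }) (λ { (x ∷ y ∷ []) c → tt , c })
            (FamilyDefinability.chain-def {j = 0} {T = λ _ → ⊤} {F = γ ∘ head} (def-true (λ _ → tt))
              (defMap-⊆ (def-∧ segment-def (def-true (λ _ → tt))) (λ _ → proj₁) γ-def) n)

          Gap : M → M → Set
          Gap u v = a ≤ u × u ≤ v × v ≤ b × (∀ n → ¬ Chain n u v)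

          -- Otherwise each point is joined to u or to v by chains of bounded
          -- length, so that the points joined to u form a definable set which is
          -- open and closed.
          opaque
            gap-dense : ∀ {u v} → Gap u v → ∃[ w ] Gap u w × Gap w v
            gap-dense {u} {v} (a≤u , u≤v , v≤b , ¬c) = by-contradiction λ none →
              let N , h = increasing-compactness {X = Segment u v} {Y = λ n w → Chain n u (head w) ⊎ Chain n (head w) v}
                    segment-def
                    (λ n → def-∨ (def-sub (sel-∷ (sel-param u) (sel-∷ v₀ sel-[])) (chain-definable n))
                                 (def-sub (sel-∷ v₀ (sel-∷ (sel-param v) sel-[])) (chain-definable n)))
                    (λ n w → Sum.map (chain-suc n) (chain-suc n))
                    (λ { (w ∷ []) (u≤w , w≤v) → by-contradiction λ ¬joined → none (w ,
                      (a≤u , u≤w , ≤-trans w≤v v≤b , λ n c → ¬joined (n , inj₁ c)) ,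
                      (≤-trans a≤u u≤w , w≤v , v≤b , λ n c → ¬joined (n , inj₂ c))) })
              in bounded N (λ w u≤w w≤v → h (w ∷ []) (u≤w , w≤v))
              where
              bounded : ∀ N → ¬ (∀ w → u ≤ w → w ≤ v → Chain N u w ⊎ Chain N w v)
              bounded N joined = ¬c N (interval-connected {S = Chain N u}
                (def-sub (sel-∷ (sel-param u) (sel-∷ v₀ sel-[])) (chain-definable N))
                local (chain-refl N a≤u (≤-trans u≤v v≤b)) v u≤v ≤-refl)
                where
                transfer : ∀ {x y} → u ≤ x → u ≤ y → y ≤ v → (x ≤ y → Good x y) → Chain N u x → Chain N u y
                transfer {x} {y} u≤x u≤y y≤v good c with ≤-total x y | joined y u≤y y≤v
                ... | inj₂ y≤x | _ = chain-shrink N ≤-refl u≤y y≤x c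
                ... | _ | inj₁ d = d
                -- The chain from u to x, the good piece from x to y and the chain from y to v would
                -- together bridge the gap.
                ... | inj₁ x≤y | inj₂ d = contradiction
                  (chain-trans (suc N) N (chain-trans N 1 c (good⇒chain (good x≤y))) d) (¬c (N + suc N))

                local : ∀ p → u ≤ p → p ≤ v → Near (p ∷ []) (λ q → u ≤ head q → head q ≤ v →
                  (Chain N u p → Chain N u (head q)) × (Chain N u (head q) → Chain N u p))
                local p u≤p p≤v =
                  let B , near , good = good-near γ-cont (≤-trans a≤u u≤p) (≤-trans p≤v v≤b)
                  in near-map (λ { (q ∷ []) q∈B u≤q q≤v →
                       transfer u≤p u≤q q≤v (λ p≤q → good p q (≤-trans a≤u u≤p) p≤q (≤-trans q≤v v≤b) (near-point near) q∈B) ,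
                       transfer u≤q u≤p p≤v (λ q≤p → good q p (≤-trans a≤u u≤q) q≤p (≤-trans p≤v v≤b) q∈B (near-point near)) }) near

          Avoids : M → M → M → Set
          Avoids u v p = ¬ (u ≤ p × p ≤ v)

          avoid-one : ∀ {u v} p → Gap u v → ∃[ u′ ] ∃[ v′ ] Gap u′ v′ × u ≤ u′ × v′ ≤ v × Avoids u′ v′ p
          avoid-one {u} {v} p gap with w , gap₁ , gap₂ ← gap-dense gap | compare p w
          ... | tri< p<w _ _ = w , v , gap₂ , proj₁ (proj₂ gap₁) , ≤-refl , λ (w≤p , _) → <⇒≱ p<w w≤p
          ... | tri> _ _ w<p = u , w , gap₁ , ≤-refl , proj₁ (proj₂ gap₂) , λ (_ , p≤w) → <⇒≱ w<p p≤w
          -- If `p` is the splitting point, both halves contain it. The right half is split once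
          -- more, and its new left end is different from `p`, as the empty chain joins every point
          -- to itself.
          ... | tri≈ _ refl _ with w′ , (a≤p , p≤w′ , w′≤b , ¬c) , gap₃ ← gap-dense gap₂ =
            w′ , v , gap₃ , ≤-trans (proj₁ (proj₂ gap₁)) p≤w′ , ≤-refl ,
            λ (w′≤p , _) → ¬c 0 (a≤p , ≤-trans p≤w′ w′≤b , ≤-antisym p≤w′ w′≤p)

          avoid-finite : ∀ {u v} ps → Gap u v → ∃[ u′ ] ∃[ v′ ] Gap u′ v′ × u ≤ u′ × v′ ≤ v × All (Avoids u′ v′) ps
          avoid-finite []       gap = _ , _ , gap , ≤-refl , ≤-refl , []
          avoid-finite (p ∷ ps) gap
            with u₁ , v₁ , gap₁ , u≤u₁ , v₁≤v , avoids ← avoid-finite ps gap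
            with u₂ , v₂ , gap₂ , u₁≤u₂ , v₂≤v₁ , avoid ← avoid-one p gap₁ =
            u₂ , v₂ , gap₂ , ≤-trans u≤u₁ u₁≤u₂ , ≤-trans v₂≤v₁ v₁≤v ,
            avoid ∷ All.map (λ h (p , q) → h (≤-trans u₁≤u₂ p , ≤-trans q v₂≤v₁)) avoids

          -- The type describing the new gap has the parameters p i and countably many
          -- others.  The families are avoided one at a time because it is not clear
          -- that I ≺ κ gives (I × ℕ) ≺ κ: the usual proof well-orders I, by means of
          -- a choice function that respects extensional equality of predicates.
          opaque
            avoid-family : ∀ {u v} (p : I → M) → Gap u v → ∃[ u′ ] ∃[ v′ ] Gap u′ v′ × u ≤ u′ × v′ ≤ v × (∀ i → Avoids u′ v′ (p i))
            avoid-family {u} {v} p gap@(a≤u , _ , v≤b , _) = by-contradiction λ none → impossible none (subcover none)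
              where
              Inside : Subset 2
              Inside x = u ≤ head x × head x ≤ head (tail x) × head (tail x) ≤ v

              Joined : ℕ → Subset 2
              Joined n x = Chain n (head x) (head (tail x))

              family : ⊤ ⊎ ℕ → Σ[ k ∈ ℕ ] Subset k
              family = [ (λ _ → 2 , Inside) , (λ n → 2 , Joined n) ]′

              family-def : ∀ j → Def (proj₂ (family j))
              family-def (inj₁ _) = def-∧ (def-≤ (sel-param u) v₀) (def-∧ (def-≤ v₀ v₁)
                (def-≤ v₁ (sel-param v)))
              family-def (inj₂ n) = chain-definable n

              common : CommonParameters family
              common = commonParameters (⊤⊎↣ℕ id↣) family family-def

              open CommonParameters common

              val′ : I ⊎ Param → M
              val′ = [ p , val ]′

              module W = Over val′

              Hit : I → Subset 2
              Hit i x = head x ≤ p i × p i ≤ head (tail x)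

              None : Set
              None = ¬ (∃[ u′ ] ∃[ v′ ] Gap u′ v′ × u ≤ u′ × v′ ≤ v × (∀ i → Avoids u′ v′ (p i)))

              Bad : ℕ ⊎ I → Subset 2
              Bad = [ Joined , Hit ]′

              bad-def : ∀ j → W.Def (Bad j)
              bad-def (inj₁ n) = mapParameters inj₂ (λ _ → refl) (overThem (inj₂ n))
              bad-def (inj₂ i) = W.def-∧ (W.def-≤ W.v₀ (W.sel-param (inj₁ i)))
                                         (W.def-≤ (W.sel-param (inj₁ i)) W.v₁)

              subcover : None → Σ[ js ∈ List (ℕ ⊎ I) ] (∀ x → Inside x → Any (λ j → Bad j x) js)
              subcover none = compactness {val = val′} (≺-resp-↣ (⊎-map-↣ small) (⊎ℕ-≺ ℕ≺κ I≺κ))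
                (mapParameters inj₂ (λ _ → refl) (overThem (inj₁ tt))) bad-def
                (λ { (x ∷ y ∷ []) (u≤x , x≤y , y≤v) → by-contradiction λ ¬bad → none (x , y ,
                  (≤-trans a≤u u≤x , x≤y , ≤-trans y≤v v≤b , λ n c → ¬bad (inj₁ n , c)) , u≤x , y≤v ,
                  λ i h → ¬bad (inj₂ i , h)) })

              points : List (ℕ ⊎ I) → List M
              points []            = []
              points (inj₁ n ∷ js) = points js
              points (inj₂ i ∷ js) = p i ∷ points js

              not-bad : ∀ {x y} js → Gap x y → All (Avoids x y) (points js) → ¬ Any (λ j → Bad j (x ∷ y ∷ [])) js
              not-bad (inj₁ n ∷ js) (_ , _ , _ , ¬c) avoids (here c)  = ¬c n c
              not-bad (inj₁ n ∷ js) gap avoids       (there h) = not-bad js gap avoids h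
              not-bad (inj₂ i ∷ js) gap (av ∷ avs)   (here h)  = av h
              not-bad (inj₂ i ∷ js) gap (av ∷ avs)   (there h) = not-bad js gap avs h

              -- A finite subcover mentions only finitely many of the points p i, and a smaller gap
              -- that avoids these lies in no member of the subcover.
              impossible : None → ¬ (Σ[ js ∈ List (ℕ ⊎ I) ] (∀ x → Inside x → Any (λ j → Bad j x) js))
              impossible none (js , covered) =
                let x , y , gap′ , u≤x , y≤v , avoids = avoid-finite (points js) gap
                in not-bad js gap′ avoids (covered (x ∷ y ∷ []) (u≤x , proj₁ (proj₂ gap′) , y≤v))

          -- The families are avoided one after another along a nested sequence of gaps. By
          -- compactness, over the countably many ends of these gaps, some gap is contained in all
          -- of them; the family with number n is avoided from the gap with number n + 1 on.
          avoid-families : ∀ {u v} (p : ℕ → I → M) → Gap u v → ∃[ u′ ] ∃[ v′ ] Gap u′ v′ × (∀ n i → Avoids u′ v′ (p n i))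
          avoid-families {u} {v} p gap = by-contradiction λ none →
            let N , covered = increasing-compactness {X = Inside} {Y = Bad} inside-def bad-def bad-suc
                  (λ { (x ∷ y ∷ []) (a≤x , x≤y , y≤b) → by-contradiction λ ¬bad → none (x , y ,
                    (a≤x , x≤y , y≤b , λ n c → ¬bad (n , inj₁ c)) ,
                    λ n i (x≤p , p≤y) → proj₂ (proj₂ (proj₂ (next n))) i
                      (by-contradiction λ h → ¬bad (suc n , inj₂ λ (l≤x , y≤r) → h (≤-trans l≤x x≤p , ≤-trans p≤y y≤r)))) })
                -- The gap with number `N` is not in `Bad N`, so no single member of the increasing
                -- cover suffices.
                a≤l , l≤r , r≤b , ¬c = gap-at N
            in [ ¬c N , (λ ¬inside → ¬inside (≤-refl , ≤-refl)) ]′ (covered (lo N ∷ hi N ∷ []) (a≤l , l≤r , r≤b))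
            where
            nested : ℕ → Σ[ x ∈ M ] Σ[ y ∈ M ] Gap x y
            next : ∀ n → let x , y , _ = nested n ; x′ , y′ , _ = nested (suc n) in
              Gap x′ y′ × x ≤ x′ × y′ ≤ y × (∀ i → Avoids x′ y′ (p n i))
            nested zero    = u , v , gap
            nested (suc n) = let x , y , gap′ = nested n ; x′ , y′ , gap″ , _ = avoid-family (p n) gap′ in x′ , y′ , gap″
            next n = let x , y , gap′ = nested n in proj₂ (proj₂ (avoid-family (p n) gap′))

            lo hi : ℕ → M
            lo n = proj₁ (nested n)
            hi n = proj₁ (proj₂ (nested n))

            gap-at : ∀ n → Gap (lo n) (hi n)
            gap-at n = proj₂ (proj₂ (nested n))

            Inside : Subset 2
            Inside x = a ≤ head x × head x ≤ head (tail x) × head (tail x) ≤ b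

            inside-def : Def Inside
            inside-def = def-∧ (def-≤ (sel-param a) v₀) (def-∧ (def-≤ v₀ v₁)
              (def-≤ v₁ (sel-param b)))

            Bad : ℕ → Subset 2
            Bad n x = Chain n (head x) (head (tail x)) ⊎ ¬ (lo n ≤ head x × head (tail x) ≤ hi n)

            bad-def : ∀ n → Def (Bad n)
            bad-def n = def-∨ (chain-definable n) (def-¬ (def-∧ (def-≤ (sel-param (lo n)) v₀)
              (def-≤ v₁ (sel-param (hi n)))))

            bad-suc : ∀ n x → Bad n x → Bad (suc n) x
            bad-suc n x = Sum.map (chain-suc n) λ h (l≤x , x≤r) →
              h (≤-trans (proj₁ (proj₂ (next n))) l≤x , ≤-trans x≤r (proj₁ (proj₂ (proj₂ (next n)))))

          open AddExtrema _<_ using (_<±_; <±-trans)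

          Piece∋ : Piece 𝓜 → M → Set
          Piece∋ q x = ⟦_⟧ₚ 𝓜 q x

          piece-convex : ∀ q {x y z} → Piece∋ q x → Piece∋ q y → x ≤ z → z ≤ y → Piece∋ q z
          piece-convex (singleton c)  refl refl x≤z z≤y = ≤-antisym z≤y x≤z
          piece-convex (interval l r) x∈ y∈ (inj₂ refl) z≤y = x∈
          piece-convex (interval l r) x∈ y∈ x≤z (inj₂ refl) = y∈
          piece-convex (interval l r) (l<x , _) (_ , y<r) (inj₁ x<z) (inj₁ z<y) =
            <±-trans <-trans l<x AddExtrema.[ x<z ] , <±-trans <-trans AddExtrema.[ z<y ] y<r

          pick : Piece 𝓜 → M
          pick q with em {P = ∃[ x ] Piece∋ q x}
          ... | yes (x , _) = x
          ... | no _        = a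

          pick∈ : ∀ q {x} → Piece∋ q x → Piece∋ q (pick q)
          pick∈ q {x} x∈ with em {P = ∃[ x ] Piece∋ q x}
          ... | yes (_ , y∈) = y∈
          ... | no empty     = contradiction (x , x∈) empty

          -- Lists of different lengths become sequences over ℕ, the form that `avoid-families`
          -- accepts. The padding value `a` is just one more point to avoid.
          pick-nth : List (Piece 𝓜) → ℕ → M
          pick-nth []       n       = a
          pick-nth (q ∷ qs) zero    = pick q
          pick-nth (q ∷ qs) (suc n) = pick-nth qs n

          in-nth : ∀ qs {x} → Any (λ q → Piece∋ q x) qs → ∃[ n ] Σ[ q ∈ Piece 𝓜 ] Piece∋ q x × Piece∋ q (pick-nth qs n) ×
            (∀ {y} → Piece∋ q y → Any (λ q → Piece∋ q y) qs)
          in-nth (q ∷ qs) (here x∈) = 0 , q , x∈ , pick∈ q x∈ , here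
          in-nth (q ∷ qs) (there h) = let n , q′ , x∈ , p∈ , sub = in-nth qs h in suc n , q′ , x∈ , p∈ , there ∘ sub

          Translate : I → M → Set
          Translate i x = (a ≤ x × x ≤ b) × V (g i \\ γ x)

          pieces : ∀ i → Σ[ qs ∈ List (Piece 𝓜) ] Translate i ≐ (λ x → Any (λ q → Piece∋ q x) qs)
          pieces i = finiteUnion (λ v → Translate i (head v)) (defMap-∈ V-def (defMap-\\ (defMap-const (g i) segment-def) γ-def))

          -- While the path stays in one translate of V, its quotients lie in V⁻¹V, because the
          -- translating element cancels.
          translate-good : ∀ i {x y} → x ≤ y → (∀ z → x ≤ z → z ≤ y → Translate i z) → Good x y
          translate-good i x≤y inside = proj₁ (proj₁ (inside _ ≤-refl x≤y)) , x≤y , proj₂ (proj₁ (inside _ x≤y ≤-refl)) ,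
            λ z w x≤z z≤y x≤w w≤y → subst U (∙-\\-∙ (g i ⁻¹) (γ z) (γ w))
              (V⁻¹V⊆U _ _ (proj₂ (inside z x≤z z≤y)) (proj₂ (inside w x≤w w≤y)))

          -- A point inside the gap lies in some piece of some translate, hence is
          -- joined to the chosen point of that piece, which is outside.
          gap-impossible : ∀ {u v} → Gap u v → ¬ (∀ n i → Avoids u v (pick-nth (proj₁ (pieces i)) n))
          gap-impossible {u} {v} gap avoids = [ right , left ]′ (≤-total w p)
            where
            between : ∃[ w ] Gap u w × Gap w v
            between = gap-dense gap

            w : M
            w = proj₁ between

            gap-uw : Gap u w
            gap-uw = proj₁ (proj₂ between)

            gap-wv : Gap w v
            gap-wv = proj₂ (proj₂ between)

            i : I
            i = proj₁ (cover (γ w))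

            located : ∃[ n ] Σ[ q ∈ Piece 𝓜 ] Piece∋ q w × Piece∋ q (pick-nth (proj₁ (pieces i)) n) ×
              (∀ {y} → Piece∋ q y → Any (λ q → Piece∋ q y) (proj₁ (pieces i)))
            located = in-nth _ (proj₁ (proj₂ (pieces i))
                ((≤-trans (proj₁ gap) (proj₁ (proj₂ gap-uw)) , proj₁ (proj₂ (proj₂ gap-uw))) , proj₂ (cover (γ w))))

            q : Piece 𝓜
            q = proj₁ (proj₂ located)

            w∈ : Piece∋ q w
            w∈ = proj₁ (proj₂ (proj₂ located))

            p : M
            p = pick-nth (proj₁ (pieces i)) (proj₁ located)

            p∈ : Piece∋ q p
            p∈ = proj₁ (proj₂ (proj₂ (proj₂ located)))

            inside : ∀ {y} → Piece∋ q y → Translate i y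
            inside y∈ = proj₂ (proj₂ (pieces i)) (proj₂ (proj₂ (proj₂ (proj₂ located))) y∈)

            avoid : Avoids u v p
            avoid = avoids (proj₁ located) i

            right : ¬ w ≤ p
            right w≤p = [ (λ v<p → proj₂ (proj₂ (proj₂ gap-wv)) 1 (good⇒chain (translate-good i (proj₁ (proj₂ gap-wv))
                λ z w≤z z≤v → inside (piece-convex q w∈ p∈ w≤z (≤-trans z≤v (<⇒≤ v<p)))))) ,
              (λ p≤v → avoid (≤-trans (proj₁ (proj₂ gap-uw)) w≤p , p≤v)) ]′ (<-≤-connex v p)

            left : ¬ p ≤ w
            left p≤w = [ (λ p<u → proj₂ (proj₂ (proj₂ gap-uw)) 1 (good⇒chain (translate-good i (proj₁ (proj₂ gap-uw))
                λ z u≤z z≤w → inside (piece-convex q p∈ w∈ (≤-trans (<⇒≤ p<u) u≤z) z≤w)))) ,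
              (λ u≤p → avoid (u≤p , ≤-trans p≤w (proj₁ (proj₂ gap-wv)))) ]′ (<-≤-connex p u)

        opaque
          subdivision : ∃[ n ] Chain n a b
          subdivision = by-contradiction λ none →
            let u , v , gap , avoids = avoid-families (λ n i → pick-nth (proj₁ (pieces i)) n)
                  (≤-refl , <⇒≤ a<b , ≤-refl , λ n c → none (n , c))
            in gap-impossible gap avoids

      -- Lifts and their uniqueness

      module Lifting (𝓖′ : LocallyDefinableGroup 𝓜) (f : Carrier → LocallyDefinableGroup.Carrier 𝓖′)
        (f-def : IsDefinableMapOn 𝓜 𝓖 𝓖′ U f) (f-hom : IsLocalHomomorphismOn 𝓜 𝓖 𝓖′ U f) where
        private
          module G′ = Groups 𝓜 𝓖′
        open G′ using () renaming (_∙_ to _∙′_; ε to ε′; _⁻¹ to _⁻¹′; Carrier to Carrier′)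

        f-chain : ∀ x y z → U (x \\ y) → U (y \\ z) → U (x \\ z) → f (x \\ y) ∙′ f (y \\ z) ≡ f (x \\ z)
        f-chain x y z p q r = trans (sym (f-hom _ _ p q (subst U (sym (\\-chain x y z)) r))) (cong f (\\-chain x y z))

        f-ε : f ε ≡ ε′
        f-ε = G′.∙-cancelˡ (f ε) _ _ (trans (sym (f-hom ε ε ε∈U ε∈U (subst U (sym (identityˡ ε)) ε∈U)))
          (trans (cong f (identityˡ ε)) (sym (G′.identityʳ (f ε)))))

        f-inverse : ∀ x y → U (x \\ y) → U (y \\ x) → f (x \\ y) ∙′ f (y \\ x) ≡ ε′
        f-inverse x y p q = trans (f-chain x y x p q (\\-self∈U x)) (trans (cong f (\\-self x)) f-ε)

        -- In place of continuity, a lift is required to change locally by the factor that `f`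
        -- prescribes. This involves the topology of 𝓖 only.
        record Lift {n} (A : Subset n) (F : Vec M n → Carrier) (h : Vec M n → Carrier′) : Set where
          constructor lifting
          field
            lift-def   : DefMap 𝓖′ A h
            lift-local : ∀ p → A p → Near p (λ q → A q → U (F p \\ F q) × h q ≡ h p ∙′ f (F p \\ F q))

        open Lift

        lift-∘ : ∀ {m n} {A : Subset n} {F h} {B : Subset m} {σ : Vec M m → Vec M n} →
          (∀ p {Q : Subset n} → Near (σ p) Q → Near p (Q ∘ σ)) → (∀ y → B y → A (σ y)) →
          DefMap 𝓖′ B (h ∘ σ) → Lift A F h → Lift B (F ∘ σ) (h ∘ σ)
        lift-∘ near σ∈A d l = lifting d λ p p∈B →
          near-map (λ q k q∈B → k (σ∈A q q∈B)) (near p (lift-local l _ (σ∈A p p∈B)))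

        lift-sub : ∀ {m n} {A : Subset n} {F h} {B : Subset m} {σ : Vec M m → Vec M n} →
          Sel σ → Def B → (∀ y → B y → A (σ y)) → Lift A F h → Lift B (F ∘ σ) (h ∘ σ)
        lift-sub s B-def σ∈A l = lift-∘ (λ p → near-sel s) σ∈A (defMap-sub s B-def σ∈A (lift-def l)) l

        -- Only quotients of `F` enter, so `F` may be multiplied on the left by a constant.
        lift-cong : ∀ {n} {A : Subset n} {F F₁ h} → (∀ q r → A q → A r → F q \\ F r ≡ F₁ q \\ F₁ r) →
          Lift A F h → Lift A F₁ h
        lift-cong {h = h} eq l = lifting (lift-def l) λ p p∈A → near-map
          (λ q k q∈A → subst (λ x → U x × h q ≡ h p ∙′ f x) (eq p q p∈A q∈A) (k q∈A)) (lift-local l p p∈A)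

        lift-translate : ∀ {n} {A : Subset n} {F h} g → Lift A F h → Lift A F (λ x → g ∙′ h x)
        lift-translate g l = lifting (defMap-∙ (defMap-const g (domain-def (lift-def l))) (lift-def l))
          λ p p∈A → near-map (λ q k q∈A → proj₁ (k q∈A) , trans (cong (g ∙′_) (proj₂ (k q∈A))) (sym (G′.assoc _ _ _)))
              (lift-local l p p∈A)

        lift-const : ∀ {n} {A : Subset n} g z → Def A → Lift A (λ _ → g) (λ _ → z)
        lift-const g z A-def = lifting (defMap-const z A-def) λ p _ → near-all λ q _ →
          \\-self∈U g , sym (trans (cong (z ∙′_) (trans (cong f (\\-self g)) f-ε)) (G′.identityʳ z))

        opaque
          -- Near each point both lifts change by the same factor, so the set where they agree is
          -- locally constant; it is definable since both lifts are.
          lift-unique : ∀ {a b F h h₁} → Lift (Segment a b) F h → Lift (Segment a b) F h₁ →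
            h (a ∷ []) ≡ h₁ (a ∷ []) → ∀ x → a ≤ x → x ≤ b → h (x ∷ []) ≡ h₁ (x ∷ [])
          lift-unique {a} {b} {F} {h} {h₁} l l₁ eq x a≤x x≤b = proj₂ (interval-connected {S = S}
            (def-resp (λ { (x ∷ []) → id }) (λ { (x ∷ []) → id }) (defMap-≡ (lift-def l) (lift-def l₁)))
            (λ p a≤p p≤b → near-map (local p a≤p p≤b) (near-∧ (lift-local l (p ∷ []) (a≤p , p≤b))
                (lift-local l₁ (p ∷ []) (a≤p , p≤b))))
            ((≤-refl , ≤-trans a≤x x≤b) , eq) x a≤x x≤b)
            where
            S : M → Set
            S x = (a ≤ x × x ≤ b) × h (x ∷ []) ≡ h₁ (x ∷ [])

            local : ∀ p → a ≤ p → p ≤ b → ∀ (q : Vec M 1) →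
              (Segment a b q → U (F (p ∷ []) \\ F q) × h q ≡ h (p ∷ []) ∙′ f (F (p ∷ []) \\ F q)) ×
              (Segment a b q → U (F (p ∷ []) \\ F q) × h₁ q ≡ h₁ (p ∷ []) ∙′ f (F (p ∷ []) \\ F q)) →
              a ≤ head q → head q ≤ b → (S p → S (head q)) × (S (head q) → S p)
            local p a≤p p≤b (q ∷ []) (k , k₁) a≤q q≤b = let _ , e = k (a≤q , q≤b) ; _ , e₁ = k₁ (a≤q , q≤b) in
              (λ (_ , e₂) → (a≤q , q≤b) , trans e (trans (cong (_∙′ _) e₂) (sym e₁))) ,
              (λ (_ , e₂) → (a≤p , p≤b) , G′.∙-cancelʳ _ _ _ (trans (sym e) (trans e₂ e₁)))

        module RowLift {a b : M} {γ : M → Carrier} where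
          open Chains a b γ

          IsRowLift : M → (M → Carrier′) → Set
          IsRowLift t h = h a ≡ ε′ × (∀ x y → Good x y → y ≤ t → h y ≡ h x ∙′ f (γ x \\ γ y))

          -- On a new piece starting at r, the value at x is h₀(r) f(γ(r)⁻¹ γ(x)). The relation is
          -- established for all good pieces, not just those of the chosen chain, so that it can be
          -- used without reference to the chain.
          rowLift : ∀ n t → Chain n a t → Σ[ h ∈ (M → Carrier′) ] IsRowLift t h
          rowLift zero    t (_ , _ , refl) = (λ _ → ε′) , refl , λ x y (a≤x , x≤y , _) y≤a →
            let x≡y = trans (≤-antisym (≤-trans x≤y y≤a) a≤x) (≤-antisym (≤-trans a≤x x≤y) y≤a)
            in sym (trans (G′.identityˡ _) (trans (cong (λ z → f (γ x \\ γ z)) (sym x≡y)) (trans (cong f (\\-self (γ x))) f-ε)))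
          rowLift (suc n) t (r , c , r-t@(_ , r≤t , t≤b , r-t-pairs)) = h , h-a , h-good
            where
            a≤r : a ≤ r
            a≤r = proj₁ (proj₂ (chain-bounds n c))

            previous : Σ[ h₀ ∈ (M → Carrier′) ] IsRowLift r h₀
            previous = rowLift n r c

            h₀ : M → Carrier′
            h₀ = proj₁ previous

            split : ∀ x → x ≤ r ⊎ r < x → Carrier′
            split x (inj₁ _) = h₀ x
            split x (inj₂ _) = h₀ r ∙′ f (γ r \\ γ x)

            h : M → Carrier′
            h x = split x (Sum.swap (<-≤-connex r x))

            h-a : h a ≡ ε′
            h-a with <-≤-connex r a
            ... | inj₂ _   = proj₁ (proj₂ previous)
            ... | inj₁ r<a = contradiction a≤r (<⇒≱ r<a)

            h-good : ∀ x y → Good x y → y ≤ t → h y ≡ h x ∙′ f (γ x \\ γ y)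
            h-good x y x-y@(a≤x , x≤y , y≤b , x-y-pairs) y≤t with <-≤-connex r x | <-≤-connex r y
            ... | inj₂ x≤r | inj₂ y≤r = proj₂ (proj₂ previous) x y x-y y≤r
            ... | inj₁ r<x | inj₂ y≤r = contradiction (≤-trans x≤y y≤r) (<⇒≱ r<x)
            -- A good piece across the break point is cut at r: both halves and the whole have their
            -- quotients in U, where `f` is multiplicative.
            ... | inj₂ x≤r | inj₁ r<y = trans (cong (_∙′ f (γ r \\ γ y)) (proj₂ (proj₂ previous) x r x-r ≤-refl))
              (trans (G′.assoc _ _ _) (cong (h₀ x ∙′_)
                  (f-chain _ _ _ (good-∈ x-r) (r-t-pairs r y ≤-refl r≤t (<⇒≤ r<y) y≤t) (good-∈ x-y))))
              where
              x-r : Good x r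
              x-r = good-shrink ≤-refl x≤r (<⇒≤ r<y) x-y
            ... | inj₁ r<x | inj₁ r<y = sym (trans (G′.assoc _ _ _) (cong (h₀ r ∙′_)
              (f-chain _ _ _ (r-t-pairs r x ≤-refl r≤t (<⇒≤ r<x) (≤-trans x≤y y≤t)) (good-∈ x-y)
                (r-t-pairs r y ≤-refl r≤t (<⇒≤ r<y) y≤t))))

          -- Good pieces are oriented, whereas a lift compares p with points on both sides. The
          -- backward relation follows because `f` inverts the quotient.
          rowLift-both : ∀ {h : M → Carrier′} {x y} → (∀ x y → Good x y → h y ≡ h x ∙′ f (γ x \\ γ y)) →
            (x ≤ y → Good x y) → (y ≤ x → Good y x) → U (γ x \\ γ y) × h y ≡ h x ∙′ f (γ x \\ γ y)
          rowLift-both {h} {x} {y} good xy yx = [ (λ x≤y → good-∈ (xy x≤y) , good x y (xy x≤y)) , backwards ]′ (≤-total x y)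
            where
            backwards : y ≤ x → U (γ x \\ γ y) × h y ≡ h x ∙′ f (γ x \\ γ y)
            backwards y≤x = let y-x@(_ , _ , _ , pairs) = yx y≤x ; x\\y = pairs x y y≤x ≤-refl ≤-refl y≤x in
              x\\y , sym (trans (cong (_∙′ f (γ x \\ γ y)) (good y x y-x))
                (trans (G′.assoc _ _ _) (trans (cong (h y ∙′_) (f-inverse _ _ (good-∈ y-x) x\\y)) (G′.identityʳ _))))

        open RowLift

        -- Definable lifts of paths and rectangles

        module WithSubdivisions (subdivide : ∀ {a b γ} → Path a b γ → ∃[ n ] Chains.Chain a b γ n a b) where

          module Family {j} {T : Subset j} {F : Vec M (suc j) → Carrier} {a b : M} (a<b : a < b)
            (T-def : Def T) (F-def : DefMap 𝓖 (λ v → (a ≤ head v × head v ≤ b) × T (tail v)) F)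
            (F-cont : Continuous (λ v → (a ≤ head v × head v ≤ b) × T (tail v)) F) where
            open FamilyDefinability T-def F-def
            open module C (w : Vec M j) = Chains a b (λ x → F (x ∷ w)) using (Good; Chain; chain-bounds; chain-suc; good-∈)

            Domain : Subset (suc j)
            Domain v = (a ≤ head v × head v ≤ b) × T (tail v)

            row-path : ∀ w → T w → Path a b (λ x → F (x ∷ w))
            row-path w w∈T = path a<b
              (defMap-sub (sel-∷ v₀ (sel-const w)) segment-def (λ v h → h , w∈T) F-def)
              (continuous-sub (sel-∷ v₀ (sel-const w)) (λ v h → h , w∈T) F-cont)

            row : ∀ w → Dec (T w) → M → Carrier′
            row w (no _)    = λ _ → ε′
            row w (yes w∈T) = let n , c = subdivide (row-path w w∈T) in proj₁ (rowLift n b c)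

            -- Every row is lifted from ε′ along a chain chosen for that row alone, so nothing is
            -- uniform in the row by construction. Off `T` the value is ε′, and it is irrelevant
            -- there.
            ρ : Vec M (suc j) → Carrier′
            ρ v = row (tail v) em (head v)

            ρ-start : ∀ w → ρ (a ∷ w) ≡ ε′
            ρ-start w with em {P = T w}
            ... | no _ = refl
            ... | yes w∈T = let n , c = subdivide (row-path w w∈T) in proj₁ (proj₂ (rowLift n b c))

            ρ-good : ∀ w → T w → ∀ x y → Good w x y → ρ (y ∷ w) ≡ ρ (x ∷ w) ∙′ f (F (x ∷ w) \\ F (y ∷ w))
            ρ-good w w∈T x y g with em {P = T w}
            ... | no w∉T  = contradiction w∈T w∉T
            ... | yes w∈T = let n , c = subdivide (row-path w w∈T) in
              proj₂ (proj₂ (rowLift n b c)) x y g (proj₁ (proj₂ (proj₂ g)))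

            private
              Reached : ℕ → Subset (suc j)
              Reached n v = T (tail v) × Chain (tail v) n a (head v)

              reached-def : ∀ n → Def (Reached n)
              reached-def n = def-sub (sel-∷ (sel-param a) (sel-∷ v₀ (sel-tail sel-id))) (chain-def n)

              Step : ℕ → Subset (suc (suc j))
              Step n v = (T (tail (tail v)) × Chain (tail (tail v)) n a (head v)) ×
                         (T (tail (tail v)) × Good (tail (tail v)) (head v) (head (tail v)))

              step-def : ∀ n → Def (Step n)
              step-def n = def-∧
                (def-sub (sel-∷ (sel-param a) (sel-∷ v₀ (sel-tail (sel-tail sel-id)))) (chain-def n))
                good-def

              -- A point reached by n + 1 pieces has a last break point r reached by n pieces, and
              -- the value at r determines the value at the point, whichever r is taken. So the
              -- choices made for the rows leave no trace.
              ρ-def-reached : ∀ n → DefMap 𝓖′ (Reached n) ρ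
              ρ-def-reached zero = defMap-cong (λ { (x ∷ w) (_ , _ , _ , refl) → sym (ρ-start w) }) (defMap-const ε′ (reached-def 0))
              ρ-def-reached (suc n) = defMap-descend 1
                {q = λ v → ρ (head v ∷ tail (tail v)) ∙′ f (F (head v ∷ tail (tail v)) \\ F (tail v))}
                (defMap-∙ {X = Step n}
                  (defMap-sub (sel-∷ v₀ (sel-tail (sel-tail sel-id))) (step-def n) (λ v → proj₁) (ρ-def-reached n))
                  (defMap-∘ f-def (defMap-\\ (F-at (sel-∷ v₀ (sel-tail (sel-tail sel-id)))
                      (λ { v ((t , c) , (_ , a≤r , r≤x , x≤b , _)) → (a≤r , ≤-trans r≤x x≤b) , t }))
                    (F-at (sel-tail sel-id) (λ { v ((t , c) , (_ , a≤r , r≤x , x≤b , _)) → (≤-trans a≤r r≤x , x≤b) , t })))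
                    (λ { (r ∷ x ∷ w) (_ , (t , g)) → good-∈ w g })))
                (λ { (x ∷ w) (t , r , c , g) → r ∷ [] , (t , c) , (t , g) })
                (λ { (x ∷ w) (r ∷ []) ((t , c) , (_ , g)) → (t , r , c , g) , ρ-good w t r x g })
                where
                F-at : ∀ {τ : Vec M (suc (suc j)) → Vec M (suc j)} → Sel τ → (∀ v → Step n v → Domain (τ v)) →
                    DefMap 𝓖 (Step n) (F ∘ τ)
                F-at s h = defMap-sub s (step-def n) h F-def

            opaque
              -- The number of pieces may vary with the row, but every point of the domain is
              -- reached eventually, so by saturation one number of pieces serves for all rows.
              ρ-def : DefMap 𝓖′ Domain ρ
              ρ-def =
                let N , h = increasing-compactness {X = Domain} {Y = Reached} (domain-def F-def) reached-def
                      (λ n v (t , c) → t , chain-suc _ n c)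
                      (λ { (x ∷ w) ((a≤x , x≤b) , t) → let n , c = subdivide (row-path w t) in
                           n , t , C.chain-shrink w n ≤-refl a≤x x≤b c })
                in defMap-⊆ (domain-def F-def) h (ρ-def-reached N)

          opaque
            path-lift : ∀ {a b γ} → Path a b γ → Σ[ h ∈ (M → Carrier′) ] Lift (Segment a b) (γ ∘ head) (h ∘ head) × h a ≡ ε′
            path-lift {a} {b} {γ} (path a<b d c) = (λ x → ρ (x ∷ [])) ,
              lifting (defMap-cong {q = λ v → ρ (head v ∷ [])} (λ { (x ∷ []) _ → refl })
                  (defMap-⊆ segment-def (λ v h → h , tt) ρ-def)) local ,
              ρ-start []
              where
              open Family {j = 0} {T = λ _ → ⊤} {F = γ ∘ head} a<b (def-true (λ _ → tt))
                (defMap-⊆ (def-∧ segment-def (def-true (λ _ → tt))) (λ _ → proj₁) d) (continuous-sub sel-id (λ _ → proj₁) c)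
              open Chains a b γ using (good-near)

              local : ∀ p → Segment a b p → Near p (λ q → Segment a b q →
                U (γ (head p) \\ γ (head q)) × ρ (head q ∷ []) ≡ ρ (head p ∷ []) ∙′ f (γ (head p) \\ γ (head q)))
              local (p ∷ []) (a≤p , p≤b) =
                let B , near , good = good-near c a≤p p≤b
                in near-map (λ { (q ∷ []) q∈B (a≤q , q≤b) → rowLift-both {γ = γ} {h = λ x → ρ (x ∷ [])} (ρ-good [] tt)
                     (λ p≤q → good p q a≤p p≤q q≤b (near-point near) q∈B)
                     (λ q≤p → good q p a≤q q≤p p≤b q∈B (near-point near)) }) near

          module Square {a b c d : M} {F : Vec M 2 → Carrier} (a<b : a < b) (c<d : c < d)
            (F-def : DefMap 𝓖 (Rectangle a b c d) F) (F-cont : Continuous (Rectangle a b c d) F) where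
            open Family {j = 1} {T = Segment c d} {F = F} a<b segment-def F-def F-cont

            private
              left-path : Path c d (λ t → F (a ∷ t ∷ []))
              left-path = path c<d
                (defMap-sub (sel-∷ (sel-param a) (sel-∷ v₀ sel-[])) segment-def left∈ F-def)
                (continuous-sub (sel-∷ (sel-param a) (sel-∷ v₀ sel-[])) left∈ F-cont)
                where
                left∈ : ∀ v → Segment c d v → Rectangle a b c d (a ∷ head v ∷ [])
                left∈ v h = (≤-refl , <⇒≤ a<b) , h

              left : M → Carrier′
              left = proj₁ (path-lift left-path)

              left-lift : Lift (Segment c d) (λ v → F (a ∷ head v ∷ [])) (left ∘ head)
              left-lift = proj₁ (proj₂ (path-lift left-path))

              -- All rows of `ρ` start at ε′. The factor `left` shifts them so that they start on
              -- the lift of the left edge.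
              h : Vec M 2 → Carrier′
              h v = left (head (tail v)) ∙′ ρ v

              h-def : DefMap 𝓖′ (Rectangle a b c d) h
              h-def = defMap-∙ (defMap-sub (sel-tail sel-id) rectangle-def (λ v → proj₂) (Lift.lift-def left-lift)) ρ-def

              h-left : ∀ t → h (a ∷ t ∷ []) ≡ left t
              h-left t = trans (cong (left t ∙′_) (ρ-start (t ∷ []))) (G′.identityʳ (left t))

              -- A box on which all quotients of `F` lie in U. Inside it, horizontal steps obey the
              -- lifting relation by construction of the rows; vertical steps remain to be treated.
              record RowBox (s t : M) : Set where
                field
                  l r m n    : M
                  l<s        : l < s
                  s<r        : s < r
                  m<t        : m < t
                  t<n        : t < n
                  quotient∈U : ∀ x y u v → (a ≤ x × x ≤ b) → (a ≤ y × y ≤ b) → (c ≤ u × u ≤ d) → (c ≤ v × v ≤ d) →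
                    l < x → x < r → l < y → y < r → m < u → u < n → m < v → v < n →
                    U (F (x ∷ u ∷ []) \\ F (y ∷ v ∷ []))

                row-step : ∀ x y u → (a ≤ x × x ≤ b) → (a ≤ y × y ≤ b) → (c ≤ u × u ≤ d) →
                  l < x → x < r → l < y → y < r → m < u → u < n →
                  h (y ∷ u ∷ []) ≡ h (x ∷ u ∷ []) ∙′ f (F (x ∷ u ∷ []) \\ F (y ∷ u ∷ []))
                row-step x y u x∈ y∈ u∈ l<x x<r l<y y<r m<u u<n =
                  trans (cong (left u ∙′_) (proj₂ (rowLift-both {γ = λ z → F (z ∷ u ∷ [])} {h = λ z → ρ (z ∷ u ∷ [])}
                      (ρ-good (u ∷ []) u∈)
                    (good x∈ y∈ l<x y<r) (good y∈ x∈ l<y x<r)))) (sym (G′.assoc _ _ _))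
                  where
                  good : ∀ {x y} → (a ≤ x × x ≤ b) → (a ≤ y × y ≤ b) → l < x → y < r → x ≤ y → Chains.Good a b
                      (λ z → F (z ∷ u ∷ [])) x y
                  good (a≤x , _) (_ , y≤b) l<x y<r x≤y = a≤x , x≤y , y≤b , λ z w x≤z z≤y x≤w w≤y →
                    quotient∈U z w u u (≤-trans a≤x x≤z , ≤-trans z≤y y≤b) (≤-trans a≤x x≤w , ≤-trans w≤y y≤b) u∈ u∈
                      (<-≤-trans l<x x≤z) (≤-<-trans z≤y y<r) (<-≤-trans l<x x≤w) (≤-<-trans w≤y y<r) m<u u<n m<u u<n

              rowBox : ∀ s t → Rectangle a b c d (s ∷ t ∷ []) → RowBox s t
              rowBox s t st∈ = let B , near , pairs = continuous-pairs F-cont (s ∷ t ∷ []) st∈ U-nbhd in from near pairs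
                where
                from : ∀ {B} → Near (s ∷ t ∷ []) B →
                  (∀ q r → Rectangle a b c d q → Rectangle a b c d r → B q → B r → U (F q \\ F r)) → RowBox s t
                from (box (l ∷ m ∷ []) (r ∷ n ∷ []) centre inside) pairs = record
                  { l = l ; r = r ; m = m ; n = n
                  ; l<s = proj₁ (centre zero) ; s<r = proj₂ (centre zero)
                  ; m<t = proj₁ (centre (suc zero)) ; t<n = proj₂ (centre (suc zero))
                  ; quotient∈U = λ x y u v x∈ y∈ u∈ v∈ l<x x<r l<y y<r m<u u<n m<v v<n →
                      pairs _ _ (x∈ , u∈) (y∈ , v∈)
                        (inside _ λ { zero → l<x , x<r ; (suc zero) → m<u , u<n })
                        (inside _ λ { zero → l<y , y<r ; (suc zero) → m<v , v<n })
                  }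

              Column : M → M → M → Set
              Column t s u = (Rectangle a b c d (s ∷ u ∷ []) × U (F (s ∷ t ∷ []) \\ F (s ∷ u ∷ []))) ×
                h (s ∷ u ∷ []) ≡ h (s ∷ t ∷ []) ∙′ f (F (s ∷ t ∷ []) \\ F (s ∷ u ∷ []))

              -- The lifting relation along the column through s, near the height t. The bounds l
              -- and r are quantified, which leaves a definable condition on s that can be carried
              -- along the row.
              ColumnLift : M → M → Set
              ColumnLift t s = ∃[ l ] ∃[ r ] l < t × t < r × (∀ u → l < u → u < r → c ≤ u → u ≤ d → Column t s u)

              column-def : ∀ {t} → c ≤ t → t ≤ d → Def {2} (λ v → Column t (head v) (head (tail v)))
              column-def {t} c≤t t≤d = def-resp (λ { (s ∷ u ∷ []) → id }) (λ { (s ∷ u ∷ []) → id })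
                (defMap-≡ (defMap-⊆ domain (λ v → proj₁) h-def)
                  (defMap-∙ (defMap-sub base domain base∈ h-def)
                    (defMap-∘ f-def (defMap-\\ (defMap-sub base domain base∈ F-def)
                        (defMap-⊆ domain (λ v → proj₁) F-def)) (λ v → proj₂))))
                where
                base : Sel {2} (λ v → head v ∷ t ∷ [])
                base = sel-∷ v₀ (sel-∷ (sel-param t) sel-[])

                base∈ : ∀ v → Rectangle a b c d v × U (F (head v ∷ t ∷ []) \\ F v) → Rectangle a b c d (head v ∷ t ∷ [])
                base∈ v ((s∈ , _) , _) = s∈ , (c≤t , t≤d)

                domain : Def (λ v → Rectangle a b c d v × U (F (head v ∷ t ∷ []) \\ F v))
                domain = defMap-∈ U-def (defMap-\\ (defMap-sub base rectangle-def (λ v (s∈ , _) → s∈ , (c≤t , t≤d)) F-def) F-def)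

              columnLift-def : ∀ {t} → c ≤ t → t ≤ d → DefinableSet (ColumnLift t)
              columnLift-def {t} c≤t t≤d =
                def-∃₁ {Q = λ v l → ∃[ r ] l < t × t < r × (∀ u → l < u → u < r → c ≤ u → u ≤ d → Column t (head v) u)}
                (def-∃₁ {Q = λ v r → head v < t × t < r × (∀ u → head v < u → u < r → c ≤ u → u ≤ d → Column t (head (tail v)) u)}
                (def-∧ (def-< v₁ (sel-param t)) (def-∧ (def-< (sel-param t) v₀)
                (def-∀₁ {Q = λ v u → head (tail v) < u → u < head v → c ≤ u → u ≤ d → Column t (head (tail (tail v))) u}
                (def-⇒ (def-< v₂ v₀)
                (def-⇒ (def-< v₀ v₁)
                (def-⇒ (def-≤ (sel-param c) v₀)
                (def-⇒ (def-≤ v₀ (sel-param d))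
                (def-sub (sel-∷ v₃ (sel-∷ v₀ sel-[])) (column-def c≤t t≤d))))))))))

              -- From (y , t) to (y , u) by way of (x , t) and (x , u).
              columnLift-transfer : ∀ {s t} (B : RowBox s t) → c ≤ t → t ≤ d → let open RowBox B in
                ∀ {x y} → (a ≤ x × x ≤ b) → (a ≤ y × y ≤ b) → l < x → x < r → l < y → y < r → ColumnLift t x → ColumnLift t y
              columnLift-transfer {s} {t} B c≤t t≤d {x} {y} x∈ y∈ l<x x<r l<y y<r (l′ , r′ , l′<t , t<r′ , column) =
                let m′ , l′≤m′ , m≤m′ , m′-max = upper l′ m
                    n′ , n′≤r′ , n′≤n , n′-min = lower r′ n
                in m′ , n′ , m′-max l′<t m<t , n′-min t<r′ t<n , λ u m′<u u<n′ c≤u u≤d →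
                  moved u (≤-<-trans m≤m′ m′<u) (<-≤-trans u<n′ n′≤n) (c≤u , u≤d)
                      (column u (≤-<-trans l′≤m′ m′<u) (<-≤-trans u<n′ n′≤r′) c≤u u≤d)
                where
                open RowBox B
                t∈ : c ≤ t × t ≤ d
                t∈ = c≤t , t≤d

                moved : ∀ u → m < u → u < n → c ≤ u × u ≤ d → Column t x u → Column t y u
                moved u m<u u<n u∈ ((_ , xt-xu) , e) = ((y∈ , u∈) , yt-yu) , (begin
                  h (y ∷ u ∷ [])                                                   ≡⟨ row-step x y u x∈ y∈ u∈ l<x x<r l<y y<r m<u u<n ⟩
                  h (x ∷ u ∷ []) ∙′ f (Fxu \\ Fyu)                                 ≡⟨ cong (_∙′ f (Fxu \\ Fyu)) e ⟩
                  (h (x ∷ t ∷ []) ∙′ f (Fxt \\ Fxu)) ∙′ f (Fxu \\ Fyu)             ≡⟨ G′.assoc _ _ _ ⟩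
                  h (x ∷ t ∷ []) ∙′ (f (Fxt \\ Fxu) ∙′ f (Fxu \\ Fyu))
                      ≡⟨ cong (h (x ∷ t ∷ []) ∙′_) (f-chain _ _ _ xt-xu xu-yu xt-yu) ⟩
                  h (x ∷ t ∷ []) ∙′ f (Fxt \\ Fyu)
                      ≡⟨ cong (h (x ∷ t ∷ []) ∙′_) (f-chain _ _ _ xt-yt yt-yu xt-yu) ⟨
                  h (x ∷ t ∷ []) ∙′ (f (Fxt \\ Fyt) ∙′ f (Fyt \\ Fyu))             ≡⟨ G′.assoc _ _ _ ⟨
                  (h (x ∷ t ∷ []) ∙′ f (Fxt \\ Fyt)) ∙′ f (Fyt \\ Fyu)
                      ≡⟨ cong (_∙′ f (Fyt \\ Fyu)) (row-step x y t x∈ y∈ t∈ l<x x<r l<y y<r m<t t<n) ⟨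
                  h (y ∷ t ∷ []) ∙′ f (Fyt \\ Fyu)                                 ∎)
                  where
                  open ≡-Reasoning
                  Fxt Fxu Fyt Fyu : Carrier
                  Fxt = F (x ∷ t ∷ [])
                  Fxu = F (x ∷ u ∷ [])
                  Fyt = F (y ∷ t ∷ [])
                  Fyu = F (y ∷ u ∷ [])
                  xu-yu : U (Fxu \\ Fyu)
                  xu-yu = quotient∈U x y u u x∈ y∈ u∈ u∈ l<x x<r l<y y<r m<u u<n m<u u<n
                  xt-yu : U (Fxt \\ Fyu)
                  xt-yu = quotient∈U x y t u x∈ y∈ t∈ u∈ l<x x<r l<y y<r m<t t<n m<u u<n
                  xt-yt : U (Fxt \\ Fyt)
                  xt-yt = quotient∈U x y t t x∈ y∈ t∈ t∈ l<x x<r l<y y<r m<t t<n m<t t<n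
                  yt-yu : U (Fyt \\ Fyu)
                  yt-yu = quotient∈U y y t u y∈ y∈ t∈ u∈ l<y y<r l<y y<r m<t t<n m<u u<n

              columnLift-left : ∀ t → c ≤ t → t ≤ d → ColumnLift t a
              columnLift-left t c≤t t≤d =
                let l , r , l<t , t<r , near = near-interval (Lift.lift-local left-lift (t ∷ []) (c≤t , t≤d))
                in l , r , l<t , t<r , λ u l<u u<r c≤u u≤d →
                   let q , e = near u l<u u<r (c≤u , u≤d)
                   in (((≤-refl , <⇒≤ a<b) , (c≤u , u≤d)) , q) ,
                      trans (h-left u) (trans e (cong (_∙′ f (F (a ∷ t ∷ []) \\ F (a ∷ u ∷ []))) (sym (h-left t))))

              -- On the left edge `h` is the lift of a path. Across a `RowBox` the condition passes
              -- from one column to another in both directions, so it holds along the entire row.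
              columnLift : ∀ s t → Rectangle a b c d (s ∷ t ∷ []) → ColumnLift t s
              columnLift s t ((a≤s , s≤b) , (c≤t , t≤d)) = interval-connected (columnLift-def c≤t t≤d)
                (λ p a≤p p≤b → local p a≤p p≤b (rowBox p t ((a≤p , p≤b) , (c≤t , t≤d)))) (columnLift-left t c≤t t≤d) s a≤s s≤b
                where
                local : ∀ p → a ≤ p → p ≤ b → RowBox p t →
                  Near (p ∷ []) (λ v → a ≤ head v → head v ≤ b → (ColumnLift t p → ColumnLift t (head v)) ×
                      (ColumnLift t (head v) → ColumnLift t p))
                local p a≤p p≤b B = interval-near l<s s<r λ y l<y y<r a≤y y≤b →
                  columnLift-transfer B c≤t t≤d (a≤p , p≤b) (a≤y , y≤b) l<s s<r l<y y<r ,
                  columnLift-transfer B c≤t t≤d (a≤y , y≤b) (a≤p , p≤b) l<y y<r l<s s<r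
                  where open RowBox B

              local : ∀ p → Rectangle a b c d p → Near p (λ q → Rectangle a b c d q → U (F p \\ F q) × h q ≡ h p ∙′ f (F p \\ F q))
              local (s ∷ t ∷ []) st∈@(s∈ , t∈) = from (rowBox s t st∈) (columnLift s t st∈)
                where
                from : RowBox s t → ColumnLift t s → Near (s ∷ t ∷ []) (λ q → Rectangle a b c d q →
                  U (F (s ∷ t ∷ []) \\ F q) × h q ≡ h (s ∷ t ∷ []) ∙′ f (F (s ∷ t ∷ []) \\ F q))
                from B (l′ , r′ , l′<t , t<r′ , column) =
                  near-map (λ { (y ∷ u ∷ []) ((l<y , y<r) , (m<u , u<n) , (l′<u , u<r′)) (y∈ , u∈) →
                    let (_ , st-su) , e = column u l′<u u<r′ (proj₁ u∈) (proj₂ u∈)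
                        st-yu = quotient∈U s y t u s∈ y∈ t∈ u∈ l<s s<r l<y y<r m<t t<n m<u u<n
                        su-yu = quotient∈U s y u u s∈ y∈ u∈ u∈ l<s s<r l<y y<r m<u u<n m<u u<n
                    -- Up the column from (s,t) to (s,u), then along the row to (y,u).
                    in st-yu , trans (row-step s y u s∈ y∈ u∈ l<s s<r l<y y<r m<u u<n)
                         (trans (cong (_∙′ f (F (s ∷ u ∷ []) \\ F (y ∷ u ∷ []))) e)
                           (trans (G′.assoc _ _ _) (cong (h (s ∷ t ∷ []) ∙′_) (f-chain _ _ _ st-su su-yu st-yu)))) })
                    (near-∧ (near-coordinate (s ∷ t ∷ []) zero l<s s<r)
                      (near-∧ (near-coordinate (s ∷ t ∷ []) (suc zero) m<t t<n) (near-coordinate (s ∷ t ∷ []) (suc zero) l′<t t<r′)))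
                  where open RowBox B

            opaque
              square-lift : Σ[ h ∈ (Vec M 2 → Carrier′) ] Lift (Rectangle a b c d) F h × h (a ∷ c ∷ []) ≡ ε′
              square-lift = h , lifting h-def local , trans (h-left c) (proj₂ (proj₂ (path-lift left-path)))

          -- Holonomy and the extension

          module Extension (simplyConnected : SimplyConnected 𝓜 𝓖 τ) where

            opaque
              holonomy : ∀ {a b γ} → Path a b γ → Carrier′
              holonomy {b = b} p = proj₁ (path-lift p) b

              holonomy-lift : ∀ {a b γ} (p : Path a b γ) →
                Σ[ h ∈ (M → Carrier′) ] Lift (Segment a b) (γ ∘ head) (h ∘ head) × h a ≡ ε′ × h b ≡ holonomy p
              holonomy-lift p = let h , l , e = path-lift p in h , l , e , refl

            -- By uniqueness, an arbitrary lift is the chosen one multiplied on the left by its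
            -- initial value.
            lift-end : ∀ {a b γ h} (p : Path a b γ) → Lift (Segment a b) (γ ∘ head) h → h (b ∷ []) ≡ h (a ∷ []) ∙′ holonomy p
            lift-end {a} {b} {h = h} p l = let k , k-lift , k-a , k-b = holonomy-lift p in
              trans (lift-unique l (lift-translate (h (a ∷ [])) k-lift)
                (sym (trans (cong (h (a ∷ []) ∙′_) k-a) (G′.identityʳ _))) b (<⇒≤ (Path.a<b p)) ≤-refl)
                (cong (h (a ∷ []) ∙′_) k-b)

            lift-end-ε : ∀ {a b γ h} (p : Path a b γ) → Lift (Segment a b) (γ ∘ head) h → h (a ∷ []) ≡ ε′ → h (b ∷ []) ≡ holonomy p
            lift-end-ε p l e = trans (lift-end p l) (trans (cong (_∙′ holonomy p) e) (G′.identityˡ _))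

            lift-constant : ∀ {a b g h} → a < b → Lift (Segment a b) (λ _ → g) h → h (b ∷ []) ≡ h (a ∷ [])
            lift-constant {a} {b} {g} {h} a<b l = lift-unique l (lift-const g (h (a ∷ [])) segment-def) refl b (<⇒≤ a<b) ≤-refl

            holonomy-cong : ∀ {a b γ γ₁} (p : Path a b γ) (p₁ : Path a b γ₁) → (∀ x → γ x ≡ γ₁ x) → holonomy p ≡ holonomy p₁
            holonomy-cong p p₁ eq = let h , l , h-a , h-b = holonomy-lift p in
              trans (sym h-b) (lift-end-ε p₁ (lift-cong (λ q r _ _ → cong₂ _\\_ (eq (head q)) (eq (head r))) l) h-a)

            path-∙ : ∀ {a b γ γ₁} → Path a b γ → Path a b γ₁ → Path a b (λ x → γ x ∙ γ₁ x)
            path-∙ (path a<b d c) (path _ d₁ c₁) = path a<b (defMap-∙ d d₁) (continuous-∙ c c₁)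

            path-\\ : ∀ {a b γ γ₁} → Path a b γ → Path a b γ₁ → Path a b (λ x → γ x \\ γ₁ x)
            path-\\ (path a<b d c) (path _ d₁ c₁) = path a<b (defMap-\\ d d₁) (continuous-\\ c c₁)

            -- The product of the two lifts and the lift of the product are read off the
            -- two sides and the diagonal of a lift of (s , t) ↦ γ(s) γ₁(t).
            opaque
              holonomy-∙ : ∀ {a b γ γ₁} (p : Path a b γ) (p₁ : Path a b γ₁) → γ₁ a ≡ ε →
                holonomy (path-∙ p p₁) ≡ holonomy p ∙′ holonomy p₁
              holonomy-∙ {a} {b} {γ} {γ₁} p@(path a<b d c) p₁@(path _ d₁ c₁) γ₁-a = begin
                holonomy (path-∙ p p₁)                 ≡⟨ lift-end-ε (path-∙ p p₁) diagonal h-aa ⟨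
                h (b ∷ b ∷ [])                         ≡⟨ lift-end p₁ right ⟩
                h (b ∷ a ∷ []) ∙′ holonomy p₁          ≡⟨ cong (_∙′ holonomy p₁) (lift-end-ε p bottom h-aa) ⟩
                holonomy p ∙′ holonomy p₁              ∎
                where
                open ≡-Reasoning
                F : Vec M 2 → Carrier
                F v = γ (head v) ∙ γ₁ (head (tail v))

                first : Sel {2} (λ v → head v ∷ [])
                first = sel-∷ v₀ sel-[]

                second : Sel {2} (λ v → head (tail v) ∷ [])
                second = sel-∷ v₁ sel-[]

                lifted : Σ[ h ∈ (Vec M 2 → Carrier′) ] Lift (Rectangle a b a b) F h × h (a ∷ a ∷ []) ≡ ε′
                lifted = Square.square-lift a<b a<b
                  (defMap-∙ (defMap-sub first rectangle-def (λ v → proj₁) d) (defMap-sub second rectangle-def (λ v → proj₂) d₁))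
                  (continuous-∙ (continuous-sub first (λ v → proj₁) c) (continuous-sub second (λ v → proj₂) c₁))

                h : Vec M 2 → Carrier′
                h = proj₁ lifted

                h-lift : Lift (Rectangle a b a b) F h
                h-lift = proj₁ (proj₂ lifted)

                h-aa : h (a ∷ a ∷ []) ≡ ε′
                h-aa = proj₂ (proj₂ lifted)

                bottom : Lift (Segment a b) (γ ∘ head) (λ v → h (head v ∷ a ∷ []))
                bottom = lift-cong (λ q r _ _ → cong₂ _\\_ (at-a q) (at-a r))
                  (lift-sub (sel-∷ v₀ (sel-∷ (sel-param a) sel-[])) segment-def (λ v v∈ → v∈ , ≤-refl , <⇒≤ a<b) h-lift)
                  where
                  at-a : ∀ v → γ (head v) ∙ γ₁ a ≡ γ (head {n = 0} v)
                  at-a v = trans (cong (γ (head v) ∙_) γ₁-a) (identityʳ _)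

                -- The right side of the square is the path γ(b) γ₁, which has the same quotients as
                -- γ₁.
                right : Lift (Segment a b) (γ₁ ∘ head) (λ v → h (b ∷ head v ∷ []))
                right = lift-cong (λ q r _ _ → ∙-\\-∙ (γ b) _ _)
                  (lift-sub (sel-∷ (sel-param b) (sel-∷ v₀ sel-[])) segment-def (λ v v∈ → (<⇒≤ a<b , ≤-refl) , v∈) h-lift)

                diagonal : Lift (Segment a b) ((λ x → γ x ∙ γ₁ x) ∘ head) (λ v → h (head v ∷ head v ∷ []))
                diagonal = lift-sub (sel-∷ v₀ (sel-∷ v₀ sel-[])) segment-def (λ v v∈ → v∈ , v∈) h-lift

              -- The null-homotopy is constant on three sides of its rectangle, so its lift is
              -- constant there as well. Going around these sides connects the two ends of the
              -- lifted loop.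
              holonomy-loop : ∀ {a b γ} (p : Path a b γ) → γ a ≡ γ b → holonomy p ≡ ε′
              holonomy-loop {a} {b} {γ} p@(path a<b _ _) loop = begin
                holonomy p         ≡⟨ lift-end-ε p bottom h-ac ⟨
                h (b ∷ c ∷ [])     ≡⟨ lift-constant N.c<d right ⟨
                h (b ∷ d ∷ [])     ≡⟨ lift-constant a<b top ⟩
                h (a ∷ d ∷ [])     ≡⟨ lift-constant N.c<d left ⟩
                h (a ∷ c ∷ [])     ≡⟨ h-ac ⟩
                ε′                 ∎
                where
                open ≡-Reasoning
                nullHomotopy : NullHomotopy 𝓜 𝓖 τ a b γ
                nullHomotopy = proj₂ simplyConnected a b γ (toIsPath p) loop

                module N = NullHomotopy nullHomotopy
                open N using (c; d; H)

                lifted : Σ[ h ∈ (Vec M 2 → Carrier′) ] Lift (Rectangle a b c d) H h × h (a ∷ c ∷ []) ≡ ε′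
                lifted = Square.square-lift a<b N.c<d
                  (defMap-⊆ rectangle-def (λ v → proj₁ (rectangle⇔box v)) (defMap (IsDefinableContinuousOnBox.definable N.regular)))
                  (continuous-sub sel-id (λ v → proj₁ (rectangle⇔box v))
                      (fromContinuousOn (IsDefinableContinuousOnBox.continuous N.regular)))

                h : Vec M 2 → Carrier′
                h = proj₁ lifted

                h-lift : Lift (Rectangle a b c d) H h
                h-lift = proj₁ (proj₂ lifted)

                h-ac : h (a ∷ c ∷ []) ≡ ε′
                h-ac = proj₂ (proj₂ lifted)

                horizontal : ∀ t → c ≤ t → t ≤ d → Lift (Segment a b) (λ v → H (head v ∷ t ∷ [])) (λ v → h (head v ∷ t ∷ []))
                horizontal t c≤t t≤d = lift-sub (sel-∷ v₀ (sel-∷ (sel-param t) sel-[])) segment-def (λ v v∈ → v∈ , c≤t , t≤d) h-lift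

                vertical : ∀ s → a ≤ s → s ≤ b → Lift (Segment c d) (λ v → H (s ∷ head v ∷ [])) (λ v → h (s ∷ head v ∷ []))
                vertical s a≤s s≤b = lift-sub (sel-∷ (sel-param s) (sel-∷ v₀ sel-[])) segment-def (λ v v∈ → (a≤s , s≤b) , v∈) h-lift

                bottom : Lift (Segment a b) (γ ∘ head) (λ v → h (head v ∷ c ∷ []))
                bottom = lift-cong (λ q r (p , p′) (p₁ , p₁′) → cong₂ _\\_ (N.start _ p p′) (N.start _ p₁ p₁′))
                    (horizontal c ≤-refl (<⇒≤ N.c<d))

                top : Lift (Segment a b) (λ _ → γ a) (λ v → h (head v ∷ d ∷ []))
                top = lift-cong (λ q r (p , p′) (p₁ , p₁′) → cong₂ _\\_ (N.end _ p p′) (N.end _ p₁ p₁′))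
                    (horizontal d (<⇒≤ N.c<d) ≤-refl)

                left : Lift (Segment c d) (λ _ → γ a) (λ v → h (a ∷ head v ∷ []))
                left = lift-cong (λ q r (p , p′) (p₁ , p₁′) → cong₂ _\\_ (N.left _ p p′) (N.left _ p₁ p₁′))
                    (vertical a ≤-refl (<⇒≤ a<b))

                right : Lift (Segment c d) (λ _ → γ a) (λ v → h (b ∷ head v ∷ []))
                right = lift-cong (λ q r (p , p′) (p₁ , p₁′) → cong₂ _\\_ (N.right _ p p′) (N.right _ p₁ p₁′))
                    (vertical b (<⇒≤ a<b) ≤-refl)

              -- Write γ₁ as γ times the pointwise quotient of γ and γ₁. The quotient is a loop at
              -- ε, whose holonomy is trivial, and holonomy is multiplicative.
              holonomy-endpoint : ∀ {a b γ γ₁} (p : Path a b γ) (p₁ : Path a b γ₁) → γ a ≡ γ₁ a → γ b ≡ γ₁ b → holonomy p ≡ holonomy p₁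
              holonomy-endpoint {a} {b} {γ} {γ₁} p p₁ eq-a eq-b = sym (begin
                holonomy p₁                               ≡⟨ holonomy-cong p₁ (path-∙ p quotient) (λ x → sym (∙-\\ (γ x) (γ₁ x))) ⟩
                holonomy (path-∙ p quotient)              ≡⟨ holonomy-∙ p quotient (trans (cong (_\\ γ₁ a) eq-a) (\\-self (γ₁ a))) ⟩
                holonomy p ∙′ holonomy quotient
                    ≡⟨ cong (holonomy p ∙′_) (holonomy-loop quotient (trans (trans (cong (_\\ γ₁ a) eq-a) (\\-self (γ₁ a)))
                                                               (sym (trans (cong (_\\ γ₁ b) eq-b) (\\-self (γ₁ b)))))) ⟩
                holonomy p ∙′ ε′                          ≡⟨ G′.identityʳ _ ⟩
                holonomy p                                ∎)
                where
                open ≡-Reasoning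
                quotient : Path a b (λ x → γ x \\ γ₁ x)
                quotient = path-\\ p p₁

            -- Without definable bijections between intervals of M, paths can be neither
            -- concatenated nor reversed; but they extend by constants to a common
            -- interval, where they can be multiplied pointwise.
            module Clamp {a b : M} (a<b : a < b) where

              clamp : M → M
              clamp x = [ (λ _ → a) , (λ _ → [ (λ _ → b) , (λ _ → x) ]′ (<-≤-connex b x)) ]′ (<-≤-connex x a)

              clamp-≤ : ∀ {x} → x ≤ a → clamp x ≡ a
              clamp-≤ {x} x≤a with <-≤-connex x a
              ... | inj₁ _ = refl
              ... | inj₂ a≤x with <-≤-connex b x
              ... | inj₁ b<x = contradiction x≤a (<⇒≱ (<-trans a<b b<x))
              ... | inj₂ _   = ≤-antisym x≤a a≤x

              clamp-≥ : ∀ {x} → b ≤ x → clamp x ≡ b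
              clamp-≥ {x} b≤x with <-≤-connex x a
              ... | inj₁ x<a = contradiction b≤x (<⇒≱ (<-trans x<a a<b))
              ... | inj₂ a≤x with <-≤-connex b x
              ... | inj₁ b<x = refl
              ... | inj₂ x≤b = ≤-antisym x≤b b≤x

              clamp-∈ : ∀ {x} → a ≤ x → x ≤ b → clamp x ≡ x
              clamp-∈ {x} a≤x x≤b with <-≤-connex x a
              ... | inj₁ x<a = contradiction a≤x (<⇒≱ x<a)
              ... | inj₂ _ with <-≤-connex b x
              ... | inj₁ b<x = contradiction x≤b (<⇒≱ b<x)
              ... | inj₂ _   = refl

              data Position (x : M) : Set where
                below  : x < a → clamp x ≡ a → Position x
                within : a ≤ x → x ≤ b → clamp x ≡ x → Position x
                above  : b < x → clamp x ≡ b → Position x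

              position : ∀ x → Position x
              position x with <-≤-connex x a
              ... | inj₁ x<a = below x<a (clamp-≤ (<⇒≤ x<a))
              ... | inj₂ a≤x with <-≤-connex b x
              ... | inj₁ b<x = above b<x (clamp-≥ (<⇒≤ b<x))
              ... | inj₂ x≤b = within a≤x x≤b (clamp-∈ a≤x x≤b)

              clamped : Vec M 1 → Vec M 1
              clamped v = clamp (head v) ∷ []

              clamped∈ : ∀ v → Segment a b (clamped v)
              clamped∈ v with position (head v)
              ... | below _ e    = subst (a ≤_) (sym e) ≤-refl , subst (_≤ b) (sym e) (<⇒≤ a<b)
              ... | within p q e = subst (a ≤_) (sym e) p , subst (_≤ b) (sym e) q
              ... | above _ e    = subst (a ≤_) (sym e) (<⇒≤ a<b) , subst (_≤ b) (sym e) ≤-refl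

              near-clamped : ∀ p {Q : Subset 1} → Near (clamped p) Q → Near p (Q ∘ clamped)
              near-clamped (x ∷ []) {Q} near = by-position (position x) (near-interval near)
                where
                by-position : Position x → ∃[ l ] ∃[ r ] l < clamp x × clamp x < r × (∀ y → l < y → y < r → Q (y ∷ [])) →
                  Near (x ∷ []) (Q ∘ clamped)
                by-position (below x<a e) (l , r , l<c , c<r , h) = let z , z<x = noMinimum x in
                  interval-near z<x x<a λ y _ y<a → subst (λ c → Q (c ∷ [])) (trans e (sym (clamp-≤ (<⇒≤ y<a)))) (h _ l<c c<r)
                by-position (above b<x e) (l , r , l<c , c<r , h) = let z , x<z = noMaximum x in
                  interval-near b<x x<z λ y b<y _ → subst (λ c → Q (c ∷ [])) (trans e (sym (clamp-≥ (<⇒≤ b<y)))) (h _ l<c c<r)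
                by-position (within a≤x x≤b e) (l , r , l<c , c<r , h) =
                  interval-near l<x x<r λ y l<y y<r → near-y y l<y y<r (position y)
                  where
                  l<x : l < x
                  l<x = subst (l <_) e l<c
                  x<r : x < r
                  x<r = subst (_< r) e c<r
                  near-y : ∀ y → l < y → y < r → Position y → Q (clamp y ∷ [])
                  near-y y l<y y<r (below y<a e′)  = subst (λ c → Q (c ∷ [])) (sym e′) (h a (<-trans l<y y<a) (≤-<-trans a≤x x<r))
                  near-y y l<y y<r (within _ _ e′) = subst (λ c → Q (c ∷ [])) (sym e′) (h y l<y y<r)
                  near-y y l<y y<r (above b<y e′)  = subst (λ c → Q (c ∷ [])) (sym e′) (h b (<-≤-trans l<x x≤b) (<-trans b<y y<r))

              -- The clamped map is glued from a constant, the given map and another constant.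
              clamped-def : ∀ {𝓗 : LocallyDefinableGroup 𝓜} {h a′ b′} → DefMap 𝓗 (Segment a b) h →
                  DefMap 𝓗 (Segment a′ b′) (h ∘ clamped)
              clamped-def {h = h} d = defMap-⊆ segment-def (λ v _ → cases v (position (head v)))
                (defMap-∪ (defMap-cong (λ v x<a → cong (λ c → h (c ∷ [])) (sym (clamp-≤ (<⇒≤ x<a))))
                    (defMap-const (h (a ∷ [])) (def-< v₀ (sel-param a))))
                (defMap-∪ (defMap-cong (λ { (x ∷ []) (a≤x , x≤b) → cong (λ c → h (c ∷ [])) (sym (clamp-∈ a≤x x≤b)) }) d)
                  (defMap-cong (λ v b<x → cong (λ c → h (c ∷ [])) (sym (clamp-≥ (<⇒≤ b<x))))
                      (defMap-const (h (b ∷ [])) (def-< (sel-param b) v₀)))))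
                where
                cases : ∀ v → Position (head v) → head v < a ⊎ Segment a b v ⊎ b < head v
                cases v (below p _)    = inj₁ p
                cases v (within p q _) = inj₂ (inj₁ (p , q))
                cases v (above p _)    = inj₂ (inj₂ p)

            extend : ∀ {a b γ a′ b′} (p : Path a b γ) → a′ ≤ a → b ≤ b′ → Path a′ b′ (γ ∘ Clamp.clamp (Path.a<b p))
            extend (path a<b d c) a′≤a b≤b′ = path (≤-<-trans a′≤a (<-≤-trans a<b b≤b′)) (clamped-def d)
              (continuous-∘ near-clamped (λ v _ → clamped∈ v) c)
              where open Clamp a<b

            opaque
              -- A lift that is clamped along with its path is a lift of the clamped path, with the
              -- same values at the ends.
              holonomy-extend : ∀ {a b γ a′ b′} (p : Path a b γ) (a′≤a : a′ ≤ a) (b≤b′ : b ≤ b′) →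
                  holonomy (extend p a′≤a b≤b′) ≡ holonomy p
              holonomy-extend {a} {b} {γ} p@(path a<b d c) a′≤a b≤b′ = let h , l , h-a , h-b = holonomy-lift p in
                trans (sym (lift-end-ε (extend p a′≤a b≤b′)
                  (lift-∘ near-clamped (λ v _ → clamped∈ v) (clamped-def (Lift.lift-def l)) l)
                  (trans (cong h (clamp-≤ a′≤a)) h-a))) (trans (cong h (clamp-≥ b≤b′)) h-b)
                where open Clamp a<b

            module Common {a b γ a₁ b₁ γ₁} (p : Path a b γ) (p₁ : Path a₁ b₁ γ₁) where
              a₀ b₀ : M
              a₀ = proj₁ (lower a a₁)
              b₀ = proj₁ (upper b b₁)

              first : Path a₀ b₀ (γ ∘ Clamp.clamp (Path.a<b p))
              first = extend p (proj₁ (proj₂ (lower a a₁))) (proj₁ (proj₂ (upper b b₁)))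

              second : Path a₀ b₀ (γ₁ ∘ Clamp.clamp (Path.a<b p₁))
              second = extend p₁ (proj₁ (proj₂ (proj₂ (lower a a₁)))) (proj₁ (proj₂ (proj₂ (upper b b₁))))

              first-start : γ (Clamp.clamp (Path.a<b p) a₀) ≡ γ a
              first-start = cong γ (Clamp.clamp-≤ (Path.a<b p) (proj₁ (proj₂ (lower a a₁))))

              first-end : γ (Clamp.clamp (Path.a<b p) b₀) ≡ γ b
              first-end = cong γ (Clamp.clamp-≥ (Path.a<b p) (proj₁ (proj₂ (upper b b₁))))

              second-start : γ₁ (Clamp.clamp (Path.a<b p₁) a₀) ≡ γ₁ a₁
              second-start = cong γ₁ (Clamp.clamp-≤ (Path.a<b p₁) (proj₁ (proj₂ (proj₂ (lower a a₁)))))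

              second-end : γ₁ (Clamp.clamp (Path.a<b p₁) b₀) ≡ γ₁ b₁
              second-end = cong γ₁ (Clamp.clamp-≥ (Path.a<b p₁) (proj₁ (proj₂ (proj₂ (upper b b₁)))))

              first-holonomy : holonomy first ≡ holonomy p
              first-holonomy = holonomy-extend p (proj₁ (proj₂ (lower a a₁))) (proj₁ (proj₂ (upper b b₁)))

              second-holonomy : holonomy second ≡ holonomy p₁
              second-holonomy = holonomy-extend p₁ (proj₁ (proj₂ (proj₂ (lower a a₁)))) (proj₁ (proj₂ (proj₂ (upper b b₁))))

            record PathTo (g : Carrier) : Set₁ where
              constructor pathTo
              field
                {start end} : M
                {route}     : M → Carrier
                isPath      : Path start end route
                from-ε      : route start ≡ ε
                to-g        : route end ≡ g

            someRoute : ∀ g → PathTo g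
            someRoute g = let a , b , γ , p , γ-a , γ-b = proj₁ simplyConnected ε g in pathTo (fromIsPath p) γ-a γ-b

            opaque
              f̄ : Carrier → Carrier′
              f̄ g = holonomy (PathTo.isPath (someRoute g))

              f̄-holonomy : ∀ {g} (p : PathTo g) → f̄ g ≡ holonomy (PathTo.isPath p)
              f̄-holonomy {g} (pathTo p γ-a γ-b) = from-route (someRoute g)
                where
                from-route : (r : PathTo g) → holonomy (PathTo.isPath r) ≡ holonomy p
                from-route (pathTo r δ-a δ-b) = trans (sym first-holonomy) (trans (holonomy-endpoint first second
                  (trans first-start (trans δ-a (sym (trans second-start γ-a))))
                      (trans first-end (trans δ-b (sym (trans second-end γ-b))))) second-holonomy)
                  where open Common r p

              -- Over a common interval, the pointwise product of a route to x and a route to y is a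
              -- route to their product.
              f̄-∙ : ∀ x y → f̄ (x ∙ y) ≡ f̄ x ∙′ f̄ y
              f̄-∙ x y = product (someRoute x) (someRoute y)
                where
                product : (p : PathTo x) (q : PathTo y) → f̄ (x ∙ y) ≡ holonomy (PathTo.isPath p) ∙′ holonomy (PathTo.isPath q)
                product (pathTo p γ-a γ-b) (pathTo q δ-a δ-b) =
                  trans (f̄-holonomy (pathTo (path-∙ first second)
                    (trans (cong₂ _∙_ (trans first-start γ-a) (trans second-start δ-a)) (identityˡ ε))
                    (cong₂ _∙_ (trans first-end γ-b) (trans second-end δ-b))))
                  (trans (holonomy-∙ first second (trans second-start δ-a)) (cong₂ _∙′_ first-holonomy second-holonomy))
                  where open Common p q

            f̄-ε : f̄ ε ≡ ε′
            f̄-ε = G′.∙-cancelˡ (f̄ ε) _ _ (trans (sym (f̄-∙ ε ε)) (trans (cong f̄ (identityˡ ε)) (sym (G′.identityʳ (f̄ ε)))))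

            f̄-⁻¹ : ∀ x → f̄ (x ⁻¹) ≡ f̄ x ⁻¹′
            f̄-⁻¹ x = G′.inverseʳ-unique (f̄ x) (f̄ (x ⁻¹)) (trans (sym (f̄-∙ x (x ⁻¹))) (trans (cong f̄ (inverseʳ x)) f̄-ε))

            GoodEnd : Carrier → Set₁
            GoodEnd u = Σ[ p ∈ PathTo u ] let open PathTo p in
              ∀ x y → start ≤ x → x ≤ end → start ≤ y → y ≤ end → U (route x \\ route y)

            goodEnd∈U : ∀ {u} → GoodEnd u → U u
            goodEnd∈U (pathTo p γ-a γ-b , pairs) = subst U (trans (cong₂ _\\_ γ-a γ-b) (ε-\\ _))
              (pairs _ _ ≤-refl (<⇒≤ (Path.a<b p)) (<⇒≤ (Path.a<b p)) ≤-refl)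

            -- Here f ∘ γ itself is a lift: γ(x), γ(y) and the quotient γ(x)⁻¹ γ(y) all lie in U, so
            -- `f` is multiplicative on them.
            f̄-goodEnd : ∀ {u} → GoodEnd u → f̄ u ≡ f u
            f̄-goodEnd {u} (r@(pathTo {a} {b} {γ} p@(path a<b d c) γ-a γ-b) , pairs) =
              trans (f̄-holonomy r) (trans (sym (lift-end-ε p lifted (trans (cong f γ-a) f-ε))) (cong f γ-b))
              where
              γ∈U : ∀ x → Segment a b x → U (γ (head x))
              γ∈U x (a≤x , x≤b) = subst U (trans (cong (_\\ γ (head x)) γ-a) (ε-\\ _)) (pairs _ _ ≤-refl (<⇒≤ a<b) a≤x x≤b)

              lifted : Lift (Segment a b) (γ ∘ head) (λ v → f (γ (head v)))
              lifted = lifting (defMap-∘ f-def d γ∈U) λ x x∈@(a≤x , x≤b) → near-all λ y y∈@(a≤y , y≤b) →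
                pairs _ _ a≤x x≤b a≤y y≤b ,
                trans (cong f (sym (∙-\\ _ _))) (f-hom _ _ (γ∈U x x∈) (pairs _ _ a≤x x≤b a≤y y≤b)
                    (subst U (sym (∙-\\ _ _)) (γ∈U y y∈)))

            good⇒goodEnd : ∀ {a b γ s t} → Path a b γ → Chains.Good a b γ s t → GoodEnd (γ s \\ γ t)
            good⇒goodEnd {a} {b} {γ} {s} {t} (path a<b d c) (a≤s , inj₁ s<t , t≤b , pairs) =
              pathTo (path s<t (defMap-\\ (defMap-const (γ s) segment-def) (defMap-⊆ segment-def sub d))
                               (continuous-\\ (continuous-const (γ s)) (continuous-sub sel-id sub c))) (\\-self (γ s)) refl ,
              λ x y s≤x x≤t s≤y y≤t → subst U (sym (∙-\\-∙ (γ s ⁻¹) (γ x) (γ y))) (pairs x y s≤x x≤t s≤y y≤t)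
              where
              sub : ∀ v → Segment s t v → Segment a b v
              sub v (p , q) = ≤-trans a≤s p , ≤-trans q t≤b
            -- A degenerate piece is no interval of definition for a path, so the constant path at ε
            -- on the original interval takes its place.
            good⇒goodEnd {a} {b} {γ} {s} {t} (path a<b d c) (a≤s , inj₂ refl , t≤b , pairs) =
              pathTo (path a<b (defMap-const ε segment-def) (continuous-const ε)) refl (sym (\\-self (γ s))) ,
              λ x y _ _ _ _ → \\-self∈U ε

            -- Follow a route along a chain: each piece, translated to start at ε, ends in a good
            -- end, by which the point reached so far is multiplied on the right.
            goodEnd-induction : ∀ {ℓ} (Q : Carrier → Set ℓ) → Q ε → (∀ x u → Q x → GoodEnd u → Q (x ∙ u)) → ∀ g → Q g
            goodEnd-induction Q Q-ε Q-∙ g = from-route (someRoute g)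
              where
              from-route : PathTo g → Q g
              from-route (pathTo {a} {b} {γ} p γ-a γ-b) = let n , chain = subdivide p in
                subst Q (trans (cong₂ _\\_ γ-a γ-b) (ε-\\ g)) (go n chain)
                where
                go : ∀ n {t} → Chains.Chain a b γ n a t → Q (γ a \\ γ t)
                go zero    (_ , _ , refl) = subst Q (sym (\\-self (γ a))) Q-ε
                go (suc n) (r , chain , good) = subst Q (\\-chain (γ a) (γ r) _) (Q-∙ _ _ (go n chain) (good⇒goodEnd p good))

            -- Local definability of the extension

            private
              at : Vec M k → Carrier
              at = point-at {𝓖}

              Û : Subset k
              Û = Image embed U

              Û-at : ∀ {w} → Û w → embed (at w) ≡ w × U (at w)
              Û-at (g , g∈U , refl) = cong embed (point-at-embed g) , subst U (sym (point-at-embed g)) g∈U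

              -- Group operations are definable only on definable sets, so every condition on a
              -- quotient comes together with membership of both arguments in U.
              Pair : Subset (k + k)
              Pair v = Û (take k v) × Û (drop k v)

              pair-def : Def Pair
              pair-def = def-∧ (def-sub (sel-take k sel-id) U-def) (def-sub (sel-drop k sel-id) U-def)

              quotient : Vec M (k + k) → Carrier
              quotient v = at (take k v) \\ at (drop k v)

              quotient-def : DefMap 𝓖 Pair quotient
              quotient-def = defMap-\\ (defMap-sub (sel-take k sel-id) pair-def (λ v → proj₁) (defMap-point-at U-def))
                                       (defMap-sub (sel-drop k sel-id) pair-def (λ v → proj₂) (defMap-point-at U-def))

              Unit : Subset k
              Unit w = w ≡ embed ε

              Boxes : Subset (dim + dim)
              Boxes v = OpenBox 𝓜 (take dim v) (drop dim v) (φ ε)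

              Quotient : Subset (k + k)
              Quotient v = Pair v × U (quotient v)

              QuotientBox : Subset ((k + k) + (dim + dim))
              QuotientBox v = Pair (take (k + k) v) ×
                BoxAt (take dim (drop (k + k) v)) (drop dim (drop (k + k) v)) (quotient (take (k + k) v))

              Unit-def : Def Unit
              Unit-def = def-≡ sel-id (sel-const (embed ε))

              Boxes-def : Def Boxes
              Boxes-def = def-OpenBox (sel-take dim sel-id) (sel-drop dim sel-id) (sel-const (φ ε))

              Quotient-def : Def Quotient
              Quotient-def = defMap-∈ U-def quotient-def

              QuotientBox-def : Def QuotientBox
              QuotientBox-def = boxAt-def (sel-take dim (sel-drop (k + k) sel-id)) (sel-drop dim (sel-drop (k + k) sel-id))
                (defMap-sub (sel-take (k + k) sel-id) (def-sub (sel-take (k + k) sel-id) pair-def) (λ v → id) quotient-def)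

              module _ {w z : Vec M k} where
                quotient-elim : Quotient (w ++ z) → Û w × Û z × U (at w \\ at z)
                quotient-elim h rewrite take-++ w z | drop-++ w z = let (p , q) , r = h in p , q , r

                quotient-intro : Û w → Û z → U (at w \\ at z) → Quotient (w ++ z)
                quotient-intro p q r rewrite take-++ w z | drop-++ w z = (p , q) , r

                quotientBox-elim : ∀ {c e} → QuotientBox ((w ++ z) ++ (c ++ e)) → BoxAt c e (at w \\ at z)
                quotientBox-elim {c} {e} h
                  rewrite take-++ (w ++ z) (c ++ e) | drop-++ (w ++ z) (c ++ e) | take-++ w z | drop-++ w z | take-++ c
                      e | drop-++ c e = proj₂ h

                quotientBox-intro : ∀ {c e} → Û w → Û z → BoxAt c e (at w \\ at z) → QuotientBox ((w ++ z) ++ (c ++ e))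
                quotientBox-intro {c} {e} p q h
                  rewrite take-++ (w ++ z) (c ++ e) | drop-++ (w ++ z) (c ++ e) | take-++ w z | drop-++ w z | take-++ c
                      e | drop-++ c e = (p , q) , h

              boxes-intro : ∀ {c e} → OpenBox 𝓜 c e (φ ε) → Boxes (c ++ e)
              boxes-intro {c} {e} h rewrite take-++ c e | drop-++ c e = h

              boxes-elim : ∀ {c e} → Boxes (c ++ e) → OpenBox 𝓜 c e (φ ε)
              boxes-elim {c} {e} h rewrite take-++ c e | drop-++ c e = h

            open DefinablePaths 𝓜 k dim Unit Boxes Quotient QuotientBox

            private
              module Described {r} {χ : Formula L ((1 + k) + r)} {v : Vec M (2 + r)} (describes-v : Describes r χ v) where
                open Describes describes-v

                a b : M
                a = head v
                b = head (tail v)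

                choose : ∀ x → Dec (Within r χ v x) → Carrier
                choose x (yes x∈) = at (proj₁ (total x x∈))
                choose x (no _)   = ε

                γ : M → Carrier
                γ x = choose x em

                -- The diagonal case of coherence.
                Γ⇒Û : ∀ {x w} → Within r χ v x → Γ r χ v x w → Û w
                Γ⇒Û {w = w} x∈ h = proj₁ (quotient-elim {w} {w} (coherent _ _ x∈ x∈ _ _ h h))

                γ-Γ : ∀ {x} → Within r χ v x → Γ r χ v x (embed (γ x))
                γ-Γ {x} x∈ with em {P = Within r χ v x}
                ... | yes x∈′ = let w , h = total x x∈′ in subst (Γ r χ v x) (sym (proj₁ (Û-at (Γ⇒Û x∈′ h)))) h
                ... | no x∉   = contradiction x∈ x∉

                γ-at : ∀ {x w} → Within r χ v x → Γ r χ v x w → embed (γ x) ≡ w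
                γ-at x∈ h = functional _ x∈ _ _ (γ-Γ x∈) h

                γ-def : DefMap 𝓖 (Segment a b) (γ ∘ head)
                γ-def = defMap-intro (def-resp
                  (λ { (x ∷ w) (x∈ , h) → x∈ , γ-at x∈ h })
                  (λ { (x ∷ w) (x∈ , e) → x∈ , subst (Γ r χ v x) e (γ-Γ x∈) })
                  (def-∧ (def-sub (sel-take 1 sel-id) segment-def)
                    (def-sub {τ = λ u → (head u ∷ drop 1 u) ++ tail (tail v)}
                      (sel-++ (sel-∷ v₀ (sel-drop 1 sel-id)) (sel-const (tail (tail v)))) (def-formula χ))))

                -- Every open set around γ(x) contains the translate by γ(x) of some chart box at ε,
                -- and the clause `local` for this box keeps γ in that translate near x.
                γ-cont : Continuous (Segment a b) (γ ∘ head)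
                γ-cont = continuous λ { (x ∷ []) x∈ O O-open γx∈O →
                  let c , e , ε∈ce , ce⊆O = boxAt-basis (translate-open (γ x) O-open) (subst O (sym (identityʳ (γ x))) γx∈O)
                      l , u , l<x , x<u , h = local x x∈ c e (boxes-intro {c} {e} ε∈ce)
                  in interval-near l<x x<u λ y l<y y<u y∈ →
                       let y\\∈ = quotientBox-elim {embed (γ x)} {embed (γ y)} {c} {e} (h y y∈ l<y y<u _ _ (γ-Γ x∈) (γ-Γ y∈))
                           same = cong₂ _\\_ (point-at-embed {𝓖} (γ x)) (point-at-embed {𝓖} (γ y))
                       in subst O (∙-\\ (γ x) (γ y)) (subst (λ g → O (γ x ∙ g)) (trans (ψ-φ _ (proj₁ y\\∈)) same)
                           (ce⊆O _ (proj₂ y\\∈))) }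

                end-good : ∀ {z} → Γ r χ v b z → Û z × GoodEnd (at z)
                end-good {z} h = Γ⇒Û b∈ h ,
                  pathTo (path ordered γ-def γ-cont)
                    (let w , w≡ , start = starts in embed-injective (trans (γ-at a∈ start) w≡))
                    (trans (sym (point-at-embed {𝓖} (γ b))) (cong at (γ-at b∈ h))) ,
                  λ x y a≤x x≤b a≤y y≤b → subst U (cong₂ _\\_ (point-at-embed {𝓖} (γ x)) (point-at-embed {𝓖} (γ y)))
                    (proj₂ (proj₂ (quotient-elim {embed (γ x)} {embed (γ y)} (coherent x y (a≤x , x≤b) (a≤y , y≤b) _ _
                        (γ-Γ (a≤x , x≤b)) (γ-Γ (a≤y , y≤b))))))
                  where
                  a∈ : Within r χ v a
                  a∈ = ≤-refl , <⇒≤ ordered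
                  b∈ : Within r χ v b
                  b∈ = <⇒≤ ordered , ≤-refl

              end-sound : ∀ {r χ z} → End r χ z → Û z × GoodEnd (at z)
              end-sound (v , describes-v , h) = Described.end-good describes-v h

              -- The formula that defines the graph of the given path serves as `χ`, and its
              -- parameters form the tail of `v`.
              end-complete : ∀ {u} → GoodEnd u → Σ[ r ∈ ℕ ] Σ[ χ ∈ Formula L ((1 + k) + r) ] End r χ (embed u)
              end-complete {u} (pathTo {a} {b} {γ} p@(path a<b (defMap ((r , χ , ps) , to , from)) c) γ-a γ-b , pairs) =
                r , χ , v , describes a<b total′ coherent′ functional′ local′ starts′ , intro (<⇒≤ a<b , ≤-refl) (cong embed γ-b)
                where
                v : Vec M (2 + r)
                v = a ∷ b ∷ map id ps

                intro : ∀ {x w} → Within r χ v x → embed (γ x) ≡ w → Γ r χ v x w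
                intro {x} {w} x∈ e = to (x ∷ [] , x∈ , cong (x ∷_) e)

                elim : ∀ {x w} → Γ r χ v x w → embed (γ x) ≡ w
                elim {x} {w} h = elim′ (from {x ∷ w} h)
                  where
                  elim′ : Image (λ v → v ++ embed (γ (head v))) (Segment a b) (x ∷ w) → embed (γ x) ≡ w
                  elim′ (y ∷ [] , _ , refl) = refl

                γ∈U : ∀ {x} → Within r χ v x → U (γ x)
                γ∈U (a≤x , x≤b) = subst U (trans (cong (_\\ γ _) γ-a) (ε-\\ _)) (pairs _ _ ≤-refl (<⇒≤ a<b) a≤x x≤b)

                hat : ∀ {x w} → Within r χ v x → embed (γ x) ≡ w → Û w
                hat x∈ e = _ , γ∈U x∈ , e

                at-γ : ∀ {x w} → embed (γ x) ≡ w → γ x ≡ at w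
                at-γ e = trans (sym (point-at-embed _)) (cong at e)

                total′ : Total r χ v
                total′ x x∈ = _ , intro x∈ refl

                coherent′ : Coherent r χ v
                coherent′ x y x∈ y∈ w z h h′ = quotient-intro {w} {z} (hat x∈ (elim h)) (hat y∈ (elim h′))
                  (subst U (cong₂ _\\_ (at-γ (elim h)) (at-γ (elim h′))) (pairs x y (proj₁ x∈) (proj₂ x∈) (proj₁ y∈) (proj₂ y∈)))

                functional′ : Functional r χ v
                functional′ x x∈ w z h h′ = trans (sym (elim h)) (elim h′)

                local′ : Local r χ v
                local′ x x∈ cl ch boxes =
                  let O , O-open , ε∈O , O⊆ = boxAt-nbhd {cl} {ch} (boxes-elim {cl} {ch} boxes)
                      l , s , l<x , x<s , near = near-interval (continuous-near c (x ∷ []) x∈ O-open ε∈O)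
                  in l , s , l<x , x<s , λ y y∈ l<y y<s w z h h′ →
                       quotientBox-intro {w} {z} {cl} {ch} (hat x∈ (elim h)) (hat y∈ (elim h′))
                         (subst (BoxAt cl ch) (cong₂ _\\_ (at-γ (elim h)) (at-γ (elim h′))) (O⊆ (near y l<y y<s y∈)))

                starts′ : Starts r χ v
                starts′ = embed ε , refl , intro (≤-refl , <⇒≤ a<b) (cong embed γ-a)

              -- Definable sets that contain all products of n good ends, whatever formulas define
              -- the paths to these.
              Products : ℕ → Pred Carrier 0ℓ
              Products zero    g = g ≡ ε
              Products (suc n) g = ∃[ x ] ∃[ y ] Products n x × U y × g ≡ x ∙ y

              multiply : Vec M (k + k) → Carrier
              multiply v = at (take k v) ∙ at (drop k v)

              Factors : ℕ → Subset (k + k)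
              Factors n v = Image embed (Products n) (take k v) × Û (drop k v)

              multiply-def : ∀ n → Def (Image embed (Products n)) → DefMap 𝓖 (Factors n) multiply
              multiply-def n d = defMap-∙ (defMap-sub (sel-take k sel-id) factors-def (λ v → proj₁) (defMap-point-at d))
                                          (defMap-sub (sel-drop k sel-id) factors-def (λ v → proj₂) (defMap-point-at U-def))
                where
                factors-def : Def (Factors n)
                factors-def = def-∧ (def-sub (sel-take k sel-id) d) (def-sub (sel-drop k sel-id) U-def)

              products-def : ∀ n → Def (Image embed (Products n))
              products-def zero = def-resp (λ { v refl → ε , refl , refl }) (λ { v (g , refl , e) → sym e }) Unit-def
              products-def (suc n) = def-resp
                (λ { v (w , (((x , x∈ , e) , (y , y∈ , e′)) , e″)) →
                  _ , (x , y , x∈ , y∈ , cong₂ _∙_ (trans (cong at (sym e)) (point-at-embed x))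
                      (trans (cong at (sym e′)) (point-at-embed y))) , e″ })
                (λ { v (g , (x , y , x∈ , y∈ , refl) , e) → embed x ++ embed y ,
                  ((x , x∈ , sym (take-++ (embed x) (embed y))) , (y , y∈ , sym (drop-++ (embed x) (embed y)))) ,
                  trans (cong embed (cong₂ _∙_ (trans (cong at (take-++ (embed x) (embed y))) (point-at-embed x))
                                               (trans (cong at (drop-++ (embed x) (embed y))) (point-at-embed y)))) e })
                (def-∃ (k + k) {Q = λ v w → Factors n w × embed (multiply w) ≡ v}
                  (def-graph (multiply-def n (products-def n)) (sel-take (k + k) sel-id) (sel-drop (k + k) sel-id)))

              -- Multiplication on a domain that depends on the number of factors only. Each such
              -- restriction has its own parameters, but there are countably many restrictions,
              -- whereas the lists of formulas may be more numerous.
              ProductGraph : ℕ → Subset ((k + k) + k)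
              ProductGraph n v = Factors n (take (k + k) v) × embed (multiply (take (k + k) v)) ≡ drop (k + k) v

              productGraph-def : ∀ n → Def (ProductGraph n)
              productGraph-def n = def-graph (multiply-def n (products-def n)) (sel-take (k + k) sel-id) (sel-drop (k + k) sel-id)

              productGraph-elim : ∀ n {x y z} → ProductGraph n ((x ++ y) ++ z) → Image embed (Products n) x × Û y ×
                  embed (at x ∙ at y) ≡ z
              productGraph-elim n {x} {y} {z} h rewrite take-++ (x ++ y) z | drop-++ (x ++ y) z | take-++ x y | drop-++ x y =
                let (p , q) , e = h in p , q , e

              productGraph-intro : ∀ n {x y z} → Image embed (Products n) x → Û y → embed (at x ∙ at y) ≡ z →
                  ProductGraph n ((x ++ y) ++ z)
              productGraph-intro n {x} {y} {z} p q e rewrite take-++ (x ++ y) z | drop-++ (x ++ y) z | take-++ x y |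
                  drop-++ x y = (p , q) , e

              Shape : Set
              Shape = Σ[ r ∈ ℕ ] Formula L ((1 + k) + r)

              EndOf : Shape → Subset k
              EndOf (r , χ) = End r χ

              -- Products of good ends, one for each formula in the list. A list contains no
              -- parameters, so all these sets are definable over those of the fixed ingredients.
              Reach : List Shape → Subset k
              Reach []      z = Unit z
              Reach (s ∷ l) z = ∃[ x ] ∃[ y ] Reach l x × EndOf s y × ProductGraph (length l) ((x ++ y) ++ z)

              module ReachDefinability {P : Set} {val : P → M} (unit : DefinableOver val Unit) (boxes : DefinableOver val Boxes)
                (quot : DefinableOver val Quotient) (quotBox : DefinableOver val QuotientBox)
                (graph : ∀ n → DefinableOver val (ProductGraph n)) where
                private
                  module W = Over val

                endOf-def : ∀ s → W.Def (EndOf s)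
                endOf-def (r , χ) = end-def r χ unit boxes quot quotBox

                reach-def : ∀ l → W.Def (Reach l)
                reach-def []      = unit
                reach-def (s ∷ l) = W.def-∃ k (W.def-∃ k (W.def-∧ (W.def-sub (W.sel-take k (W.sel-drop k W.sel-id)) (reach-def l))
                  (W.def-∧ (W.def-sub (W.sel-take k W.sel-id) (endOf-def s))
                    (W.def-sub (W.sel-++ (W.sel-++ (W.sel-take k (W.sel-drop k W.sel-id)) (W.sel-take k W.sel-id))
                        (W.sel-drop k (W.sel-drop k W.sel-id)))
                      (graph (length l))))))

              module OverM = ReachDefinability {P = M} {val = id} Unit-def Boxes-def Quotient-def QuotientBox-def productGraph-def

              reach⊆products : ∀ l {z} → Reach l z → Image embed (Products (length l)) z
              reach⊆products []      refl = ε , refl , refl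
              reach⊆products (s ∷ l) (x , y , _ , _ , graph) with (g , g∈ , refl) , (h , h∈U , refl) ,
                  e ← productGraph-elim (length l) {x} {y} graph =
                g ∙ h , (g , h , g∈ , h∈U , refl) , trans (cong embed (cong₂ _∙_ (sym (point-at-embed g)) (sym (point-at-embed h)))) e

              reach-complete : ∀ g → ∃[ l ] Reach l (embed g)
              reach-complete = goodEnd-induction (λ g → ∃[ l ] Reach l (embed g)) ([] , refl) λ x u (l , x∈) good →
                let r , χ , u∈ = end-complete good
                in (r , χ) ∷ l , embed x , embed u , x∈ , u∈ ,
                   productGraph-intro (length l) {embed x} {embed u} (reach⊆products l x∈) (u , goodEnd∈U good , refl)
                     (cong embed (cong₂ _∙_ (point-at-embed x) (point-at-embed u)))

              -- For z = x y with x in `Reach l` and y a good end, the extension takes the value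
              -- f̄(x) f(y), which is definable by induction on the list. The value is the same for
              -- every factorization of z.
              f̄-reach : ∀ l → DefMap 𝓖′ (Reach l) (f̄ ∘ at)
              f̄-reach [] = defMap-cong (λ { v refl → sym (trans (cong f̄ (point-at-embed ε)) f̄-ε) }) (defMap-const ε′ Unit-def)
              f̄-reach (s ∷ l) = defMap-descend (k + k) {T = T} {q = λ v → f̄ (at (take k (take (k + k) v))) ∙′ f
                  (at (drop k (take (k + k) v)))}
                (defMap-∙ (defMap-sub (sel-take k (sel-take (k + k) sel-id)) T-def (λ v → proj₁) (f̄-reach l))
                  (defMap-∘ f-def (defMap-sub (sel-drop k (sel-take (k + k) sel-id)) T-def
                      (λ v (_ , e , _) → proj₁ (end-sound e)) (defMap-point-at U-def))
                    (λ v (_ , e , _) → proj₂ (Û-at (proj₁ (end-sound e))))))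
                (λ z (x , y , x∈ , y∈ , g) → x ++ y , T-intro x∈ y∈ g)
                (λ z u t → descends u t)
                where
                T : Subset ((k + k) + k)
                T v = Reach l (take k (take (k + k) v)) × EndOf s (drop k (take (k + k) v)) × ProductGraph (length l) v

                T-def : Def T
                T-def = def-∧ (def-sub (sel-take k (sel-take (k + k) sel-id)) (OverM.reach-def l))
                  (def-∧ (def-sub (sel-drop k (sel-take (k + k) sel-id)) (OverM.endOf-def s)) (productGraph-def (length l)))

                T-intro : ∀ {x y z} → Reach l x → EndOf s y → ProductGraph (length l) ((x ++ y) ++ z) → T ((x ++ y) ++ z)
                T-intro {x} {y} {z} x∈ y∈ g = subst (Reach l) (sym (trans (cong (take k) (take-++ (x ++ y) z)) (take-++ x y))) x∈ ,
                  subst (EndOf s) (sym (trans (cong (drop k) (take-++ (x ++ y) z)) (drop-++ x y))) y∈ , g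

                descends : ∀ {z} u → T (u ++ z) → Reach (s ∷ l) z ×
                  f̄ (at z) ≡ f̄ (at (take k (take (k + k) (u ++ z)))) ∙′ f (at (drop k (take (k + k) (u ++ z))))
                descends {z} u (x∈ , y∈ , g) =
                  (_ , _ , x∈ , y∈ , graph) , value (productGraph-elim (length l) {take k w} {drop k w} graph)
                  where
                  w : Vec M (k + k)
                  w = take (k + k) (u ++ z)

                  graph : ProductGraph (length l) ((take k w ++ drop k w) ++ z)
                  graph = subst (ProductGraph (length l))
                    (cong (_++ z) (trans (sym (take-++ u z)) (sym (take++drop≡id k w)))) g

                  value : Image embed (Products (length l)) (take k w) × Û (drop k w) × embed (at (take k w) ∙ at (drop k w)) ≡ z →
                    f̄ (at z) ≡ f̄ (at (take k w)) ∙′ f (at (drop k w))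
                  value (_ , _ , e) = trans (cong f̄ (trans (cong at (sym e)) (point-at-embed _)))
                    (trans (f̄-∙ _ _) (cong (f̄ (at (take k w)) ∙′_) (f̄-goodEnd (proj₂ (end-sound y∈)))))

            opaque
              f̄-locallyDefinable : IsLocallyDefinableMap 𝓜 𝓖 𝓖′ f̄
              f̄-locallyDefinable X X-def = definableMapOn (defMap-⊆ X-def (proj₂ finite) (defMap-Any (proj₁ finite)))
                where
                -- The set `X` and all ingredients of `Reach` form one countable family, to be
                -- defined over common parameters.
                family : ℕ → Σ[ m ∈ ℕ ] Subset m
                family 0 = k , Image embed X
                family 1 = k , Unit
                family 2 = dim + dim , Boxes
                family 3 = k + k , Quotient
                family 4 = (k + k) + (dim + dim) , QuotientBox
                family (suc (suc (suc (suc (suc n))))) = (k + k) + k , ProductGraph n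

                family-def : ∀ n → Def (proj₂ (family n))
                family-def 0 = X-def
                family-def 1 = Unit-def
                family-def 2 = Boxes-def
                family-def 3 = Quotient-def
                family-def 4 = QuotientBox-def
                family-def (suc (suc (suc (suc (suc n))))) = productGraph-def n

                common : CommonParameters family
                common = commonParameters id↣ family family-def

                open CommonParameters common

                module R = ReachDefinability (overThem 1) (overThem 2) (overThem 3) (overThem 4)
                    (λ n → overThem (suc (suc (suc (suc (suc n))))))

                -- Every element of the group is reached by some list, because good ends generate;
                -- finitely many lists suffice on `X`.
                finite : Σ[ ls ∈ List (List Shape) ] (∀ z → Image embed X z → Any (λ l → Reach l z) ls)
                finite = compactness Param≺κ (overThem 0) R.reach-def λ { z (g , _ , refl) → reach-complete g }

                defMap-Any : ∀ ls → DefMap 𝓖′ (λ z → Any (λ l → Reach l z) ls) (f̄ ∘ at)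
                defMap-Any []       = defMap-cong (λ z ()) (defMap-const ε′ (def-false λ z ()))
                defMap-Any (l ∷ ls) = defMap-⊆ (def-Any (l ∷ ls) OverM.reach-def) (λ { z (here h) → inj₁ h ; z (there h) → inj₂ h })
                  (defMap-∪ (f̄-reach l) (defMap-Any ls))

            -- Agreement with f on U, and uniqueness

            Agree : Carrier → Carrier → Set
            Agree x y = f̄ (x \\ y) ≡ f (x \\ y)

            agree-refl : ∀ x → Agree x x
            agree-refl x = trans (cong f̄ (\\-self x)) (trans f̄-ε (sym (trans (cong f (\\-self x)) f-ε)))

            agree-sym : ∀ {x y} → U (x \\ y) → U (y \\ x) → Agree x y → Agree y x
            agree-sym {x} {y} p q e = G′.∙-cancelˡ (f (x \\ y)) _ _ (trans (cong (_∙′ f̄ (y \\ x)) (sym e))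
              (trans (sym (f̄-∙ (x \\ y) (y \\ x))) (trans (cong f̄ (trans (\\-chain x y x) (\\-self x)))
                (trans f̄-ε (sym (f-inverse x y p q))))))

            agree-trans : ∀ {x y z} → U (x \\ y) → U (y \\ z) → U (x \\ z) → Agree x y → Agree y z → Agree x z
            agree-trans {x} {y} {z} p q r e e′ = trans (cong f̄ (sym (\\-chain x y z)))
              (trans (f̄-∙ (x \\ y) (y \\ z)) (trans (cong₂ _∙′_ e e′) (f-chain x y z p q r)))

            -- Moving one coordinate of the chart at a time, always in the increasing
            -- direction: segments of M need not have definable reversals.
            module InBox {c e : Vec M dim} (pairs : ∀ v w → OpenBox 𝓜 c e v → OpenBox 𝓜 c e w → U (ψ v \\ ψ w)) where

              agree-segment : ∀ {σ : M → Vec M dim} → Sel (λ v → σ (head {n = 0} v)) → ∀ {x y} → x < y →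
                (∀ z → x ≤ z → z ≤ y → OpenBox 𝓜 c e (σ z)) → Agree (ψ (σ x)) (ψ (σ y))
              agree-segment {σ} σ-sel {x} {y} x<y inside = f̄-goodEnd (good⇒goodEnd {γ = ψ ∘ σ}
                (path x<y (defMap-sub σ-sel segment-def (λ _ _ → tt) ψ-def) (continuous-sub σ-sel (λ _ _ → tt) ψ-cont))
                (≤-refl , <⇒≤ x<y , ≤-refl , λ z w x≤z z≤y x≤w w≤y → pairs _ _ (inside z x≤z z≤y) (inside w x≤w w≤y)))

              agree-coordinate : ∀ {σ : M → Vec M dim} → Sel (λ v → σ (head {n = 0} v)) → ∀ {l r} →
                (∀ z → l < z → z < r → OpenBox 𝓜 c e (σ z)) → ∀ x y → l < x → x < r → l < y → y < r → Agree (ψ (σ x)) (ψ (σ y))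
              agree-coordinate {σ} σ-sel inside x y l<x x<r l<y y<r with compare x y
              ... | tri< x<y _ _ = agree-segment σ-sel x<y λ z x≤z z≤y → inside z (<-≤-trans l<x x≤z) (≤-<-trans z≤y y<r)
              ... | tri≈ _ refl _ = agree-refl (ψ (σ x))
              ... | tri> _ _ y<x = agree-sym (pairs _ _ (inside y l<y y<r) (inside x l<x x<r))
                  (pairs _ _ (inside x l<x x<r) (inside y l<y y<r))
                (agree-segment σ-sel y<x λ z y≤z z≤x → inside z (<-≤-trans l<y y≤z) (≤-<-trans z≤x x<r))

              -- The map `σ` inserts the coordinates that have already reached their targets. The
              -- first remaining coordinate moves while the others rest, and then joins `σ`; every
              -- intermediate point stays in the box.
              agree-box : ∀ {m} (σ : Vec M m → Vec M dim) → Sel σ → ∀ {α β} → (∀ w → OpenBox 𝓜 α β w → OpenBox 𝓜 c e (σ w)) →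
                ∀ v w → OpenBox 𝓜 α β v → OpenBox 𝓜 α β w → Agree (ψ (σ v)) (ψ (σ w))
              agree-box σ σ-sel inside [] [] _ _ = agree-refl (ψ (σ []))
              agree-box σ σ-sel {l ∷ α} {r ∷ β} inside (x ∷ v) (y ∷ w) xv∈ yw∈ =
                agree-trans (pairs _ _ (inside _ xv∈) (inside _ yv∈)) (pairs _ _ (inside _ yv∈) (inside _ yw∈))
                    (pairs _ _ (inside _ xv∈) (inside _ yw∈))
                  (agree-coordinate {σ = λ z → σ (z ∷ v)} (sel-∘ σ-sel (sel-∷ v₀ (sel-const v)))
                    (λ z l<z z<r → inside _ (cons (l<z , z<r) (xv∈ ∘ suc))) x y
                    (proj₁ (xv∈ zero)) (proj₂ (xv∈ zero)) (proj₁ (yw∈ zero)) (proj₂ (yw∈ zero)))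
                  (agree-box (λ u → σ (y ∷ u)) (sel-∘ σ-sel (sel-∷ (sel-param y) sel-id)) {α} {β}
                      (λ u u∈ → inside _ (cons (yw∈ zero) u∈)) v w
                    (xv∈ ∘ suc) (yw∈ ∘ suc))
                where
                cons : ∀ {n} {a b z} {as bs u : Vec M n} → a < z × z < b → OpenBox 𝓜 as bs u → OpenBox 𝓜 (a ∷ as) (b ∷ bs) (z ∷ u)
                cons h k zero    = h
                cons h k (suc i) = k i

                yv∈ : OpenBox 𝓜 (l ∷ α) (r ∷ β) (y ∷ v)
                yv∈ = cons (yw∈ zero) (xv∈ ∘ suc)

            opaque
              agree-near-ε : Neighbourhood ε (λ x → U x × f̄ x ≡ f x)
              agree-near-ε =
                -- The box is placed inside a set all of whose quotients lie in U, as moving within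
                -- the box requires.
                let O , O-open , ε∈O , pairs = divisionNeighbourhood U-nbhd
                    c , e , φε∈ , inside = boxAt-basis O-open ε∈O
                    W , W-open , ε∈W , W⊆ = boxAt-nbhd {c} {e} φε∈
                    quotients : ∀ v w → OpenBox 𝓜 c e v → OpenBox 𝓜 c e w → U (ψ v \\ ψ w)
                    quotients v w v∈ w∈ = pairs _ _ (inside v v∈) (inside w w∈)
                    identify : ∀ {x} → BoxAt c e x → ψ (φ ε) \\ ψ (φ x) ≡ x
                    identify x∈ = trans (cong₂ _\\_ ψ-φε (ψ-φ _ (proj₁ x∈))) (ε-\\ _)
                in W , W-open , ε∈W , λ {x} x∈W → let x∈ = W⊆ x∈W in
                     subst U (identify x∈) (quotients _ _ φε∈ (proj₂ x∈)) ,
                     subst (λ z → f̄ z ≡ f z) (identify x∈) (InBox.agree-box {c} {e} quotients id sel-id {c} {e}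
                         (λ _ → id) (φ ε) (φ x) φε∈ (proj₂ x∈))

            -- The set is the intersection of U with the union of the open translates x W over its
            -- points x.
            relativelyOpen : ∀ {S W : Pred Carrier 0ℓ} → Open W → W ε → S ⊆ U →
              (∀ {x y} → S x → U y → W (x \\ y) → S y) → RelativelyOpen U S
            relativelyOpen {S} {W} W-open ε∈W S⊆U invariant =
              (λ y → Σ[ (x , _) ∈ Σ Carrier S ] W (x \\ y)) ,
              union (λ ((x , _) : Σ Carrier S) y → W (x \\ y)) (λ (x , _) → translate-open (x ⁻¹) W-open) ,
              (λ {x} x∈S → S⊆U x∈S , (x , x∈S) , subst W (sym (\\-self x)) ε∈W) ,
              λ (y∈U , (x , x∈S) , y∈) → invariant x∈S y∈U y∈

            opaque
              -- Right multiplication by W, inside U, multiplies f and f̄ by the same factor. So the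
              -- set of agreement and its complement in U are both relatively open; the former
              -- contains ε, and connectedness leaves the latter empty.
              f̄-extends : DefinablyConnected 𝓜 𝓖 τ U → ∀ u → U u → f̄ u ≡ f u
              f̄-extends U-connected u u∈U = differing-empty (U-connected Same Different same-def different-def
                (relativelyOpen W-open ε∈W proj₁ λ (x∈U , e) y∈U y∈ → y∈U , forwards x∈U y∈U y∈ e)
                (relativelyOpen W-open ε∈W proj₁ λ (x∈U , ne) y∈U y∈ → y∈U , ne ∘ backwards x∈U y∈U y∈)
                (λ x x∈U → Sum.map (x∈U ,_) (x∈U ,_) (toSum em))
                (λ x ((_ , e) , (_ , ne)) → ne e))
                where
                Same Different : Pred Carrier 0ℓ
                Same x = U x × f̄ x ≡ f x
                Different x = U x × ¬ f̄ x ≡ f x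

                W : Pred Carrier 0ℓ
                W = proj₁ agree-near-ε

                W-open : Open W
                W-open = proj₁ (proj₂ agree-near-ε)

                ε∈W : W ε
                ε∈W = proj₁ (proj₂ (proj₂ agree-near-ε))

                W⊆ : ∀ {x} → W x → U x × f̄ x ≡ f x
                W⊆ = proj₂ (proj₂ (proj₂ agree-near-ε))

                f̄-step : ∀ x y → f̄ y ≡ f̄ x ∙′ f̄ (x \\ y)
                f̄-step x y = trans (cong f̄ (sym (∙-\\ x y))) (f̄-∙ x (x \\ y))

                f-step : ∀ {x y} → U x → U y → W (x \\ y) → f y ≡ f x ∙′ f̄ (x \\ y)
                f-step {x} {y} x∈U y∈U y∈ = trans (cong f (sym (∙-\\ x y)))
                  (trans (f-hom x (x \\ y) x∈U (proj₁ (W⊆ y∈)) (subst U (sym (∙-\\ x y)) y∈U)) (cong (f x ∙′_) (sym (proj₂ (W⊆ y∈)))))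

                forwards : ∀ {x y} → U x → U y → W (x \\ y) → f̄ x ≡ f x → f̄ y ≡ f y
                forwards {x} {y} x∈U y∈U y∈ e = trans (f̄-step x y) (trans (cong (_∙′ f̄ (x \\ y)) e) (sym (f-step x∈U y∈U y∈)))

                backwards : ∀ {x y} → U x → U y → W (x \\ y) → f̄ y ≡ f y → f̄ x ≡ f x
                backwards {x} {y} x∈U y∈U y∈ e = G′.∙-cancelʳ (f̄ (x \\ y)) _ _
                    (trans (sym (f̄-step x y)) (trans e (f-step x∈U y∈U y∈)))

                same-at : Def (λ z → Image embed U z × f̄ (at z) ≡ f (at z))
                same-at = defMap-≡ {𝓖 = 𝓖′}
                  (defMap-∘ {D = U} {f = f̄} (f̄-locallyDefinable U U-def) (defMap-point-at U-def) at∈U)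
                  (defMap-∘ {D = U} {f = f} f-def (defMap-point-at U-def) at∈U)
                  where
                  at∈U : ∀ z → Image embed U z → U (at z)
                  at∈U z (g , g∈U , e) = subst U (trans (sym (point-at-embed {𝓖} g)) (cong at e)) g∈U

                same-def : LocallyDefinableGroup.DefinableSubset 𝓖 Same
                same-def = def-resp
                  (λ { z ((g , g∈U , refl) , e) → g , (g∈U , subst (λ h → f̄ h ≡ f h) (point-at-embed {𝓖} g) e) , refl })
                  (λ { z (g , (g∈U , e) , refl) → (g , g∈U , refl) , subst (λ h → f̄ h ≡ f h) (sym (point-at-embed {𝓖} g)) e })
                  same-at

                different-def : LocallyDefinableGroup.DefinableSubset 𝓖 Different
                different-def = def-resp
                  (λ { z ((g , g∈U , refl) , ne) → g , (g∈U , λ e → ne (g , (g∈U , e) , refl)) , refl })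
                  (λ { z (g , (g∈U , ne) , refl) → (g , g∈U , refl) ,
                       λ (h , (_ , e) , eq) → ne (subst (λ h → f̄ h ≡ f h) (embed-injective eq) e) })
                  (def-∧ U-def (def-¬ same-def))

                differing-empty : Empty Same ⊎ Empty Different → f̄ u ≡ f u
                differing-empty (inj₁ none) = contradiction (W⊆ ε∈W) (none ε)
                differing-empty (inj₂ none) = by-contradiction λ ne → none u (u∈U , ne)

            open GroupMorphisms (LocallyDefinableGroup.rawGroup 𝓖) (LocallyDefinableGroup.rawGroup 𝓖′) using (IsGroupHomomorphism)

            f̄-isGroupHomomorphism : IsGroupHomomorphism f̄
            f̄-isGroupHomomorphism = record
              { isMonoidHomomorphism = record
                { isMagmaHomomorphism = record { isRelHomomorphism = record { cong = cong f̄ } ; homo = f̄-∙ }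
                ; ε-homo = f̄-ε
                }
              ; ⁻¹-homo = f̄-⁻¹
              }

            -- Good ends lie in U, where both homomorphisms agree with `f`, and they generate the
            -- group.
            f̄-unique : ∀ {g} → IsGroupHomomorphism g → (∀ x → U x → g x ≡ f x) → f̄ ≗ g
            f̄-unique {g} g-hom g-extends = goodEnd-induction (λ x → f̄ x ≡ g x) (trans f̄-ε (sym g-ε)) λ x u e good →
              trans (f̄-∙ x u) (trans (cong₂ _∙′_ e (trans (f̄-goodEnd good) (sym (g-extends u (goodEnd∈U good))))) (sym (g-∙ x u)))
              where
              open IsGroupHomomorphism g-hom using () renaming (homo to g-∙; ε-homo to g-ε)

            uniqueExtension : DefinablyConnected 𝓜 𝓖 τ U →
              ∃! _≗_ (λ g → IsGroupHomomorphism g × IsLocallyDefinableMap 𝓜 𝓖 𝓖′ g × (∀ x → U x → g x ≡ f x))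
            uniqueExtension U-connected = f̄ , (f̄-isGroupHomomorphism , f̄-locallyDefinable , f̄-extends U-connected) ,
              λ (g-hom , _ , g-extends) → f̄-unique g-hom g-extends

mainTheorem1 :
    (∀ {ℓ} → ExcludedMiddle ℓ) →
    {L : Signature} (𝓜 : Structure L) (κ : Set) →
    IsOMinimal 𝓜 → ℕ ≺ κ → Saturated 𝓜 κ →
    (𝓖 𝓖′ : LocallyDefinableGroup 𝓜) (τ : TauTopology 𝓜 𝓖) →
    let module G = LocallyDefinableGroup 𝓖
        module G′ = LocallyDefinableGroup 𝓖′
        module T = TauTopology τ
        open GroupMorphisms G.rawGroup G′.rawGroup using (IsGroupHomomorphism)
    in
    (U : Pred G.Carrier 0ℓ) →
    G.DefinableSubset U → T.Neighbourhood G.ε U → DefinablyConnected 𝓜 𝓖 τ U →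
    (f : G.Carrier → G′.Carrier) →
    IsDefinableMapOn 𝓜 𝓖 𝓖′ U f → IsLocalHomomorphismOn 𝓜 𝓖 𝓖′ U f →
    (V : Pred G.Carrier 0ℓ) →
    G.DefinableSubset V → T.Neighbourhood G.ε V → Generic 𝓜 𝓖 κ V →
    (∀ v w → v ∈ V → w ∈ V → ((v G.⁻¹) G.∙ w) ∈ U) →
    SimplyConnected 𝓜 𝓖 τ →
    ∃! _≗_ (λ (f̄ : G.Carrier → G′.Carrier) →
      IsGroupHomomorphism f̄ ×
      IsLocallyDefinableMap 𝓜 𝓖 𝓖′ f̄ ×
      (∀ x → x ∈ U → f̄ x ≡ f x))
mainTheorem1 em 𝓜 κ oMinimal ℕ≺κ saturated 𝓖 𝓖′ τ U U-def U-nbhd U-connected f f-def f-hom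
  V V-def V-nbhd ((I , I≺κ , a , cover) , _) V⁻¹V⊆U simplyConnected =
  Model.Topological.Local.Lifting.WithSubdivisions.Extension.uniqueExtension
    em 𝓜 κ oMinimal ℕ≺κ saturated 𝓖 τ U U-def U-nbhd 𝓖′ f f-def f-hom
    (Model.Topological.Local.Covering.subdivision
      em 𝓜 κ oMinimal ℕ≺κ saturated 𝓖 τ U U-def U-nbhd V V-def V⁻¹V⊆U I≺κ a cover′)
    simplyConnected U-connected
  where
  open Groups 𝓜 𝓖 using (_\\_; \\-∙)

  -- Left genericity, restated as membership of a quotient in V.
  cover′ : ∀ x → ∃[ i ] V (a i \\ x)
  cover′ x = let i , v , v∈V , e = cover x in i , subst V (trans (sym (\\-∙ (a i) v)) (cong (a i \\_) (sym e))) v∈V
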